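{- There exists an isomorphism invariant anti-stochastic graph property $A$ such that $\Pr[\mathbf{G}_n\in A]=(2+o(1))/n^2$ as $n\to\infty$.
   Context: For each $n$, $\mathbf{G}_n$ denotes a graph chosen uniformly at random from all $2^{\binom n2}$ graphs on the vertex set $[n]=\{1,\dots,n\}$. A graph property $A$ is identified with a sequence of sets $A_n$ of graphs on $[n]$; it is isomorphism invariant if for any two isomorphic graphs on $[n]$ either both or neither belong to $A_n$. An adversary is a function $f$ assigning to each graph $G$ on $[n]$ a graph $f(G)$ on $[n]$ such that $G$ and $f(G)$ differ in the adjacency of at most one pair of vertices (i.e. $f(G)$ is $G$, or $G$ with one edge added, or $G$ with one edge deleted). A property $A$ is anti-stochastic if $\Pr[\mathbf{G}_n\in A]=o(1)$ and there is an adversary $f$ such that $\Pr[f(\mathbf{G}_n)\in A]=1-o(1)$, as $n\to\infty$. -}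

module Defs where

open import Data.Bool using (Bool; true; false; _≟_)
open import Data.Nat as ℕ using (ℕ; zero; suc; _^_)
open import Data.Nat.Properties using (m^n≢0)
open import Data.Nat.Combinatorics using (_C_)
open import Data.Fin using (Fin; zero; suc; _<_)
open import Data.Vec using (Vec; []; _∷_; lookup)
open import Data.List using (List; []; _∷_; length; filterᵇ; concatMap; map)
open import Data.Product using (_×_; _,_; ∃-syntax; Σ-syntax)
open import Data.Unit using (⊤; tt)
open import Data.Integer using (+_)
open import Data.Rational using (ℚ; _/_; _-_; ∣_∣; 0ℚ)
  renaming (_<_ to _<ℚ_)
open import Relation.Binary.PropositionalEquality using (_≡_; _≢_)
open import Function.Bundles using (_↔_; Inverse)

-- Graphs on the vertex set Fin n (= [n]).
-- A graph on suc n vertices is a graph on the first n vertices together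
-- with the adjacency vector of the new (last) vertex to the old ones.
-- This representation is in bijection with simple graphs on [n]
-- (2^(n C 2) of them) and equality is syntactic.

Graph : ℕ → Set
Graph zero    = ⊤
Graph (suc n) = Graph n × Vec Bool n

open import Data.Fin using (inject₁; fromℕ; toℕ)
open import Data.Fin using (splitAt)

data View : (n : ℕ) → Fin (suc n) → Set where
  old  : ∀ {n} (i : Fin n) → View n (inject₁ i)
  last : ∀ {n} → View n (fromℕ n)

view : ∀ n (i : Fin (suc n)) → View n i
view zero    zero    = last
view (suc n) zero    = old zero
view (suc n) (suc i) with view n i
... | old j = old (suc j)
... | last  = last

adj : ∀ {n} → Graph n → Fin n → Fin n → Bool
adj {zero}  _ ()
adj {suc n} (G , v) i j with view n i | view n j
... | old a | old b = adj G a b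
... | old a | last  = lookup v a
... | last  | old b = lookup v b
... | last  | last  = false

allVecs : ∀ n → List (Vec Bool n)
allVecs zero    = [] ∷ []
allVecs (suc n) = concatMap (λ v → (false ∷ v) ∷ (true ∷ v) ∷ []) (allVecs n)

allGraphs : ∀ n → List (Graph n)
allGraphs zero    = tt ∷ []
allGraphs (suc n) = concatMap (λ G → map (G ,_) (allVecs n)) (allGraphs n)

Property : Set
Property = (n : ℕ) → Graph n → Bool

count : ∀ n → (Graph n → Bool) → ℕ
count n P = length (filterᵇ P (allGraphs n))

Pr : ∀ n → (Graph n → Bool) → ℚ
Pr n P = _/_ (+ count n P) (2 ^ (n C 2)) {{m^n≢0 2 (n C 2)}}

IsomorphismInvariant : Property → Set
IsomorphismInvariant A =
  ∀ n (σ : Fin n ↔ Fin n) (G H : Graph n) →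
    (∀ i j → adj H (Inverse.to σ i) (Inverse.to σ j) ≡ adj G i j) →
    A n G ≡ A n H

Adversary : Set
Adversary = (n : ℕ) → Graph n → Graph n

IsAdversary : Adversary → Set
IsAdversary f =
  ∀ n (G : Graph n) (i j k l : Fin n) → i < j → k < l →
    adj G i j ≢ adj (f n G) i j → adj G k l ≢ adj (f n G) k l →
    (i ≡ k × j ≡ l)

Tendsto : (ℕ → ℚ) → ℚ → Set
Tendsto a L = ∀ (ε : ℚ) → 0ℚ <ℚ ε →
  ∃[ N ] ∀ n → N ℕ.≤ n → ∣ a n - L ∣ <ℚ ε

AntiStochastic : Property → Set
AntiStochastic A =
  Tendsto (λ n → Pr n (A n)) 0ℚ ×
  ∃[ f ] (IsAdversary f × Tendsto (λ n → Pr n (λ G → A n (f n G))) (+ 1 / 1))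

{-# OPTIONS --safe #-}
module Submission where

-- Idea.  Let N = n(n-1)/2.  It suffices to colour almost all graphs on [n] invariantly
-- with M = (1+o(1))N colours so that flipping single pairs of a typical graph shows almost
-- all colours: the colour classes partition the graphs, so averaging gives a class A of
-- density about 1/M whose uncovered graphs are rare, and covering forces |A| ≥ (1-o(1)) 2^N / N.
--
-- Colours come from a nearly perfect binary code.  Arrange 2^m Q of the pairs in Q blocks of
-- 2^m, where Q is a power of a large prime p.  A flip in a block changes its Hamming syndrome
-- to an arbitrary value; these syndromes, read as integers, are the symbols of a
-- code with check values Σ u_h modulo q ≈ 2^m and Σ h u_h modulo Q.  Flips that move a symbol by
-- a multiple of p are a fraction 1/p, all others show distinct colours.  The numbers
-- 2^m p^j are multiplicatively dense, so 2^m Q ≈ N can be achieved for every n.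
--
-- To make the colour invariant, relabel the graph by the permutation for which the adjacencies of
-- the first s = n/E labels are lexicographically smallest, among those permutations for which
-- these adjacencies alone certify that no other permutation gives the same picture.  Almost
-- every graph has such a certificate (union bound over permutations), and the relabelling
-- changes only when the flipped pair meets the s special vertices before or after the flip,
-- which on average concerns at most 2sn pairs.

-- The obstacle is that a code depends on the labelling, whereas a canonical labelling can change
-- entirely when one pair is flipped. So the labelling is made to depend only on pairs meeting the
-- special labels, and the code occupies pairs that avoid them. The certificate must be readable
-- from the same few pairs; otherwise a flip elsewhere could create or destroy it. A Hamming code
-- alone fits only numbers of pairs near a power of two, hence the second factor, a power of `p`.
-- For a given precision `p` is fixed and `Q` stays bounded while `2 ^ m` grows, so the gap between
-- `M` and the code length becomes negligible. In the union bound, a permutation moving many special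
-- labels imposes more equations than the `n ^ n` maps can compensate; one moving few of them forces
-- two vertices to have nearly the same special neighbours and needs a count of its own. Everything
-- is proved with relative error `1 / K` for large `n`; letting `K` grow with `n` is a diagonal
-- choice made at the end.

open import Defs
open import Data.Bool using (Bool; true; false; not; if_then_else_; _xor_)
import Data.Bool as Bool
import Data.Bool.Properties as Bool
open import Data.Empty using (⊥)
open import Data.Fin using (Fin; zero; suc; toℕ; fromℕ; fromℕ<; inject₁; inject≤; combine; remQuot; _↑ʳ_)
import Data.Fin as Fin
import Data.Fin.Properties as Fin
open import Data.Integer using (ℤ; -[1+_]; ∣_∣) renaming (+_ to pos; -_ to neg; _+_ to _+ℤ_; _-_ to _-ℤ_; _*_ to _*ℤ_; _≤_ to _≤ℤ_; _<_ to _<ℤ_)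
import Data.Integer as ℤ
open import Data.Integer.Divisibility.Signed using (_∣_; ∣⇒∣ᵤ; ∣ᵤ⇒∣; ∣m∣n⇒∣m-n; ∣n⇒∣m*n) renaming (divides to dividesℤ; ∣-trans to ∣ℤ-trans)
import Data.Integer.Properties as ℤ
import Data.Integer.Tactic.RingSolver as ℤ-Solver
open import Data.List using (List; []; _∷_; _++_; length; map; concatMap; filter; filterᵇ; upTo; allFin; cartesianProduct; cartesianProductWith) renaming (lookup to lookupₗ)
open import Data.List.Membership.Propositional using (_∈_; _∉_; find; lose)
open import Data.List.Membership.Propositional.Properties
open import Data.List.Properties using (length-++; length-map; length-tabulate; length-upTo)
open import Data.List.Relation.Unary.All as All using (All; []; _∷_; all?)
open import Data.List.Relation.Unary.AllPairs using ([]; _∷_)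
open import Data.List.Relation.Unary.Any using (Any; here; there; any?)
open import Data.List.Relation.Unary.Unique.Propositional using (Unique)
import Data.List.Relation.Unary.Unique.Propositional.Properties as Uniq
open import Data.Maybe using (Maybe; just; nothing)
open import Data.Maybe.Properties using (just-injective) renaming (≡-dec to Maybe-≡-dec)
open import Data.Nat using (ℕ; zero; suc; _+_; _*_; _∸_; _^_; _!; _⊔_; _≤_; _<_; z≤n; s≤s; _≤?_; _<?_; NonZero; >-nonZero; >-nonZero⁻¹; ≢-nonZero⁻¹)
import Data.Nat as ℕ
open import Data.Nat.Combinatorics using (_C_; nC1≡n; nCk+nC[k+1]≡[n+1]C[k+1])
open import Data.Nat.Divisibility using (divides; ∣-trans; ∣⇒≤; ∣1⇒≡1; 1∣_; m∣m*n; n∣m*n; ∣m+n∣m⇒∣n; *-monoʳ-∣; *-cancelˡ-∣; m≤n⇒m!∣n!) renaming (_∣_ to _∣ₙ_)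
open import Data.Nat.DivMod using (_%_; m≡m%n+[m/n]*n; [m+kn]%n≡m%n; m<n⇒m%n≡m; m%n<n; m/n≤m; m/n*n≤m; m*n/n≡m; /-monoˡ-≤) renaming (_/_ to _/ₙ_)
open import Data.Nat.ListAction using (product)
open import Data.Nat.Primality using (Prime; euclidsLemma; prime⇒nonZero; ¬prime[1])
open import Data.Nat.Primality.Factorisation using (factorise)
open import Data.Nat.Properties
open import Data.Nat.Tactic.RingSolver using (solve-∀)
open import Data.Product using (_×_; _,_; proj₁; proj₂; ∃-syntax)
open import Data.Product.Properties using () renaming (≡-dec to ×-≡-dec)
open import Data.Rational using (ℚ; _/_; 0ℚ; mkℚ; toℚᵘ; *<*; module ℚ) renaming (_*_ to _*ℚ_; _-_ to _-ℚ_; -_ to -ℚ_; _<_ to _<ℚ_; ∣_∣ to ∣_∣ℚ)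
import Data.Rational.Properties as ℚₚ
open import Data.Rational.Unnormalised using (mkℚᵘ; *≡*; *<*) renaming (_≃_ to _≃ᵘ_; _+_ to _+ᵘ_; -_ to -ᵘ_; ∣_∣ to ∣_∣ᵘ)
import Data.Rational.Unnormalised.Properties as ℚᵘₚ
open import Data.Sum using (_⊎_; inj₁; inj₂)
open import Data.Vec as Vec using (Vec; []; _∷_; lookup; tabulate; toList; updateAt; zipWith; replicate)
open import Data.Vec.Properties using (lookup∘tabulate; tabulate-cong; lookup∘updateAt; lookup∘updateAt′; lookup-map; length-toList; zipWith-assoc; zipWith-comm; zipWith-identityˡ)
open import Function.Bundles using (_↔_; Inverse)
open import Function.Construct.Symmetry using (↔-sym)
open import Relation.Binary.Definitions using (tri<; tri≈; tri>)
open import Relation.Binary.PropositionalEquality using (_≡_; _≢_; refl; sym; trans; cong; cong₂; subst; subst₂; module ≡-Reasoning)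
open import Relation.Nullary using (¬_; Dec; yes; no; contradiction; ¬?)
open import Relation.Nullary.Decidable using (⌊_⌋; map′; _×-dec_; _⊎-dec_; _→-dec_)

-- Finite sums

∑ : {A : Set} → List A → (A → ℕ) → ℕ
∑ []       f = 0
∑ (x ∷ xs) f = f x + ∑ xs f

⟦_⟧ : {P : Set} → Dec P → ℕ
⟦ yes _ ⟧ = 1
⟦ no  _ ⟧ = 0

⟦⟧-mono : {P Q : Set} → (P → Q) → (p : Dec P) (q : Dec Q) → ⟦ p ⟧ ≤ ⟦ q ⟧
⟦⟧-mono f (no _)  _       = z≤n
⟦⟧-mono f (yes _) (yes _) = ≤-refl
⟦⟧-mono f (yes x) (no ¬y) = contradiction (f x) ¬y

⟦⟧≤1 : {P : Set} (p : Dec P) → ⟦ p ⟧ ≤ 1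
⟦⟧≤1 (yes _) = ≤-refl
⟦⟧≤1 (no _)  = z≤n

⟦⟧-yes : {P : Set} (p : Dec P) → P → ⟦ p ⟧ ≡ 1
⟦⟧-yes (yes _) _ = refl
⟦⟧-yes (no ¬p) p = contradiction p ¬p

⟦⟧≢0 : {P : Set} (p : Dec P) → ⟦ p ⟧ ≢ 0 → P
⟦⟧≢0 (yes p) _   = p
⟦⟧≢0 (no _)  0≢0 = contradiction refl 0≢0

⟦⟧-disjoint : {P Q R : Set} (p : Dec P) (q : Dec Q) (r : Dec R) →
  (P → R) → (Q → R) → (P → ¬ Q) → ⟦ p ⟧ + ⟦ q ⟧ ≤ ⟦ r ⟧
⟦⟧-disjoint (no _)  q       r f g d = ⟦⟧-mono g q r
⟦⟧-disjoint (yes x) (no _)  r f g d = ⟦⟧-mono f (yes x) r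
⟦⟧-disjoint (yes x) (yes y) r f g d = contradiction y (d x)

∑-mono : {A : Set} (xs : List A) {f g : A → ℕ} → (∀ x → f x ≤ g x) → ∑ xs f ≤ ∑ xs g
∑-mono []       h = z≤n
∑-mono (x ∷ xs) h = +-mono-≤ (h x) (∑-mono xs h)

∑-cong : {A : Set} (xs : List A) {f g : A → ℕ} → (∀ x → f x ≡ g x) → ∑ xs f ≡ ∑ xs g
∑-cong []       h = refl
∑-cong (x ∷ xs) h = cong₂ _+_ (h x) (∑-cong xs h)

∑-+ : {A : Set} (xs : List A) (f g : A → ℕ) → ∑ xs (λ x → f x + g x) ≡ ∑ xs f + ∑ xs g
∑-+ []       f g = refl
∑-+ (x ∷ xs) f g rewrite ∑-+ xs f g = interchange (f x) (g x) (∑ xs f) (∑ xs g)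
  where
  interchange : ∀ a b c d → a + b + (c + d) ≡ a + c + (b + d)
  interchange = solve-∀

∑-* : {A : Set} (xs : List A) (c : ℕ) (f : A → ℕ) → ∑ xs (λ x → c * f x) ≡ c * ∑ xs f
∑-* []       c f = sym (*-zeroʳ c)
∑-* (x ∷ xs) c f rewrite ∑-* xs c f = sym (*-distribˡ-+ c (f x) (∑ xs f))

∑-const : {A : Set} (xs : List A) (c : ℕ) → ∑ xs (λ _ → c) ≡ length xs * c
∑-const []       c = refl
∑-const (x ∷ xs) c = cong (c +_) (∑-const xs c)

∑-1 : {A : Set} (xs : List A) → ∑ xs (λ _ → 1) ≡ length xs
∑-1 xs = trans (∑-const xs 1) (*-identityʳ _)

∑-swap : {A B : Set} (xs : List A) (ys : List B) (f : A → B → ℕ) →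
         ∑ xs (λ x → ∑ ys (f x)) ≡ ∑ ys (λ y → ∑ xs (λ x → f x y))
∑-swap []       ys f = sym (trans (∑-const ys 0) (*-zeroʳ (length ys)))
∑-swap (x ∷ xs) ys f rewrite ∑-swap xs ys f = sym (∑-+ ys (f x) (λ y → ∑ xs (λ x → f x y)))

∑-++ : {A : Set} (xs ys : List A) (f : A → ℕ) → ∑ (xs ++ ys) f ≡ ∑ xs f + ∑ ys f
∑-++ []       ys f = refl
∑-++ (x ∷ xs) ys f rewrite ∑-++ xs ys f = sym (+-assoc (f x) (∑ xs f) (∑ ys f))

∑-map : {A B : Set} (g : A → B) (xs : List A) (f : B → ℕ) → ∑ (map g xs) f ≡ ∑ xs (λ x → f (g x))
∑-map g []       f = refl
∑-map g (x ∷ xs) f = cong (f (g x) +_) (∑-map g xs f)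

∑-concatMap : {A B : Set} (g : A → List B) (xs : List A) (f : B → ℕ) →
              ∑ (concatMap g xs) f ≡ ∑ xs (λ x → ∑ (g x) f)
∑-concatMap g []       f = refl
∑-concatMap g (x ∷ xs) f =
  trans (∑-++ (g x) (concatMap g xs) f) (cong (∑ (g x) f +_) (∑-concatMap g xs f))

∑-cartesianProduct : {A B : Set} (xs : List A) (ys : List B) (f : A × B → ℕ) →
                     ∑ (cartesianProduct xs ys) f ≡ ∑ xs (λ x → ∑ ys (λ y → f (x , y)))
∑-cartesianProduct []       ys f = refl
∑-cartesianProduct (x ∷ xs) ys f =
  trans (∑-++ (map (x ,_) ys) (cartesianProduct xs ys) f)
        (cong₂ _+_ (∑-map (x ,_) ys f) (∑-cartesianProduct xs ys f))

∑-member : {A : Set} {xs : List A} {x : A} (f : A → ℕ) → x ∈ xs → f x ≤ ∑ xs f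
∑-member f (here refl) = m≤m+n _ _
∑-member {xs = y ∷ _} f (there x∈) = ≤-trans (∑-member f x∈) (m≤n+m _ (f y))

length-filter-∑ : {A : Set} {P : A → Set} (P? : ∀ x → Dec (P x)) (xs : List A) →
                  length (filter P? xs) ≡ ∑ xs (λ x → ⟦ P? x ⟧)
length-filter-∑ P? [] = refl
length-filter-∑ P? (x ∷ xs) with P? x
... | yes _ = cong suc (length-filter-∑ P? xs)
... | no  _ = length-filter-∑ P? xs

length-× : {A B C : Set} (f : A → B → C) (xs : List A) (ys : List B) →
           length (cartesianProductWith f xs ys) ≡ length xs * length ys
length-× f []       ys = refl
length-× f (x ∷ xs) ys =
  trans (length-++ (map (f x) ys)) (cong₂ _+_ (length-map (f x) ys) (length-× f xs ys))

-- Membership and injectivity are asked only where `w` is nonzero, so with indicator weights a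
-- sublist of `xs` is compared with its image. Each image is deleted from `ys` before the induction
-- continues. Most counting bounds below are instances of this.
∑-injection : {A B : Set} (xs : List A) (ys : List B) (w : A → ℕ) (v : B → ℕ) (g : A → B) →
  Unique xs →
  (∀ {x} → x ∈ xs → w x ≢ 0 → g x ∈ ys) →
  (∀ {x x′} → x ∈ xs → x′ ∈ xs → w x ≢ 0 → w x′ ≢ 0 → g x ≡ g x′ → x ≡ x′) →
  (∀ x → w x ≤ v (g x)) →
  ∑ xs w ≤ ∑ ys v
∑-injection [] ys w v g _ _ _ _ = z≤n
∑-injection (x ∷ xs) ys w v g (x∉ ∷ u) mem inj le with w x in eq
... | zero = ∑-injection xs ys w v g u (λ p → mem (there p))
               (λ p q → inj (there p) (there q)) le
... | suc k with ∈-∃++ (mem (here refl) (λ e → 1+n≢0 (trans (sym eq) e)))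
... | ys₁ , ys₂ , refl = begin
  suc k + ∑ xs w                       ≡⟨ cong (_+ ∑ xs w) eq ⟨
  w x + ∑ xs w                         ≤⟨ +-mono-≤ (le x) (∑-injection xs (ys₁ ++ ys₂) w v g u mem′
                                            (λ p q → inj (there p) (there q)) le) ⟩
  v (g x) + ∑ (ys₁ ++ ys₂) v           ≡⟨ cong (v (g x) +_) (∑-++ ys₁ ys₂ v) ⟩
  v (g x) + (∑ ys₁ v + ∑ ys₂ v)        ≡⟨ rotate (v (g x)) (∑ ys₁ v) (∑ ys₂ v) ⟩
  ∑ ys₁ v + (v (g x) + ∑ ys₂ v)        ≡⟨ ∑-++ ys₁ (g x ∷ ys₂) v ⟨
  ∑ (ys₁ ++ g x ∷ ys₂) v               ∎
  where
  open ≤-Reasoning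
  rotate : ∀ a b c → a + (b + c) ≡ b + (a + c)
  rotate = solve-∀
  wx≢0 : w x ≢ 0
  wx≢0 e = 1+n≢0 (trans (sym eq) e)
  mem′ : ∀ {y} → y ∈ xs → w y ≢ 0 → g y ∈ ys₁ ++ ys₂
  mem′ {y} y∈ wy with ∈-++⁻ ys₁ (mem (there y∈) wy)
  ... | inj₁ q = ∈-++⁺ˡ q
  ... | inj₂ (there q) = ∈-++⁺ʳ ys₁ q
  ... | inj₂ (here q) = contradiction (inj (here refl) (there y∈) wx≢0 wy (sym q)) (All.lookup x∉ y∈)

-- The averaging principle: the least value is at most the mean.
∑-pick : {A : Set} (xs : List A) (f : A → ℕ) → 0 < length xs →
         ∃[ x ] (x ∈ xs × length xs * f x ≤ ∑ xs f)
∑-pick (x ∷ []) f _ = x , here refl , ≤-refl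
∑-pick (x ∷ xs@(_ ∷ _)) f _ with ∑-pick xs f (s≤s z≤n)
... | y , y∈ , h with ≤-total (f x) (f y)
...   | inj₁ fx≤fy = x , here refl , +-monoʳ-≤ (f x) (≤-trans (*-monoʳ-≤ (length xs) fx≤fy) h)
...   | inj₂ fy≤fx = y , there y∈ , +-mono-≤ fy≤fx h

words : {A : Set} → List A → (k : ℕ) → List (Vec A k)
words xs zero    = [] ∷ []
words xs (suc k) = cartesianProductWith _∷_ xs (words xs k)

length-words : {A : Set} (xs : List A) (k : ℕ) → length (words xs k) ≡ length xs ^ k
length-words xs zero    = refl
length-words xs (suc k) =
  trans (length-× _∷_ xs (words xs k)) (cong (length xs *_) (length-words xs k))

∈-words : {A : Set} (xs : List A) → (∀ x → x ∈ xs) → ∀ {k} (v : Vec A k) → v ∈ words xs k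
∈-words xs all []      = here refl
∈-words xs all (x ∷ v) = ∈-cartesianProductWith⁺ _∷_ (all x) (∈-words xs all v)

words-unique : {A : Set} {xs : List A} → Unique xs → ∀ k → Unique (words xs k)
words-unique u zero    = [] ∷ []
words-unique u (suc k) = Uniq.cartesianProductWith⁺ _∷_ (λ { refl → refl , refl }) u (words-unique u k)

-- Graphs and toggled pairs

toggle : ∀ {n} → Fin n → Fin n → Graph n → Graph n
toggle {suc n} i j (G , v) with view n i | view n j
... | old a | old b = toggle a b G , v
... | old a | last  = G , updateAt v a not
... | last  | old b = G , updateAt v b not
... | last  | last  = G , v

SameEdge : ∀ {n} → Fin n → Fin n → Fin n → Fin n → Set
SameEdge a b i j = (a ≡ i × b ≡ j) ⊎ (a ≡ j × b ≡ i)

adj-sym : ∀ {n} (G : Graph n) i j → adj G i j ≡ adj G j i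
adj-sym {suc n} (G , v) i j with view n i | view n j
... | old a | old b = adj-sym G a b
... | old a | last  = refl
... | last  | old b = refl
... | last  | last  = refl

toggle-sym : ∀ {n} i j (G : Graph n) → toggle i j G ≡ toggle j i G
toggle-sym {suc n} i j (G , v) with view n i | view n j
... | old a | old b = cong (_, v) (toggle-sym a b G)
... | old a | last  = refl
... | last  | old b = refl
... | last  | last  = refl

adj-toggle : ∀ {n} i j (G : Graph n) → i ≢ j → adj (toggle i j G) i j ≡ not (adj G i j)
adj-toggle {suc n} i j (G , v) i≢j with view n i | view n j
... | old a | old b = adj-toggle a b G (λ e → i≢j (cong inject₁ e))
... | old a | last = lookup∘updateAt a v
... | last  | old b = lookup∘updateAt b v
... | last  | last  = contradiction refl i≢j

adj-toggle-other : ∀ {n} i j (G : Graph n) a b → ¬ SameEdge a b i j → adj (toggle i j G) a b ≡ adj G a b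
adj-toggle-other {suc n} i j (G , v) a b ne with view n i | view n j
... | last  | last  = refl
adj-toggle-other {suc n} i j (G , v) a b ne | old i′ | old j′ with view n a | view n b
... | old a′ | old b′ = adj-toggle-other i′ j′ G a′ b′
                          λ { (inj₁ (e , f)) → ne (inj₁ (cong inject₁ e , cong inject₁ f))
                            ; (inj₂ (e , f)) → ne (inj₂ (cong inject₁ e , cong inject₁ f)) }
... | old a′ | last   = refl
... | last   | old b′ = refl
... | last   | last   = refl
adj-toggle-other {suc n} i j (G , v) a b ne | old i′ | last with view n a | view n b
... | old a′ | old b′ = refl
... | old a′ | last   = lookup∘updateAt′ a′ i′ (λ e → ne (inj₁ (cong inject₁ e , refl))) v
... | last   | old b′ = lookup∘updateAt′ b′ i′ (λ e → ne (inj₂ (refl , cong inject₁ e))) v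
... | last   | last   = refl
adj-toggle-other {suc n} i j (G , v) a b ne | last | old j′ with view n a | view n b
... | old a′ | old b′ = refl
... | old a′ | last   = lookup∘updateAt′ a′ j′ (λ e → ne (inj₂ (cong inject₁ e , refl))) v
... | last   | old b′ = lookup∘updateAt′ b′ j′ (λ e → ne (inj₁ (refl , cong inject₁ e))) v
... | last   | last   = refl

∑-allVecs-suc : ∀ n (φ : Vec Bool (suc n) → ℕ) →
  ∑ (allVecs (suc n)) φ ≡ ∑ (allVecs n) (λ v → φ (false ∷ v) + φ (true ∷ v))
∑-allVecs-suc n φ = trans (∑-concatMap _ (allVecs n) φ)
  (∑-cong (allVecs n) (λ v → cong (φ (false ∷ v) +_) (+-identityʳ _)))

∑-allVecs-flip : ∀ {n} (a : Fin n) (φ : Vec Bool n → ℕ) →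
  ∑ (allVecs n) (λ v → φ (updateAt v a not)) ≡ ∑ (allVecs n) φ
∑-allVecs-flip {suc n} zero φ = trans (∑-allVecs-suc n _)
  (trans (∑-cong (allVecs n) (λ v → +-comm (φ (true ∷ v)) _)) (sym (∑-allVecs-suc n φ)))
∑-allVecs-flip {suc n} (suc a) φ = trans (∑-allVecs-suc n _)
  (trans (∑-allVecs-flip a (λ v → φ (false ∷ v) + φ (true ∷ v))) (sym (∑-allVecs-suc n φ)))

∑-allGraphs-suc : ∀ n (φ : Graph (suc n) → ℕ) →
  ∑ (allGraphs (suc n)) φ ≡ ∑ (allGraphs n) (λ G → ∑ (allVecs n) (λ v → φ (G , v)))
∑-allGraphs-suc n φ = trans (∑-concatMap _ (allGraphs n) φ)
  (∑-cong (allGraphs n) (λ G → ∑-map (G ,_) (allVecs n) φ))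

-- Flipping a pair permutes the graphs (on the diagonal `toggle` is the identity). Re-indexing by a
-- flip turns statements about the graph after the flip into statements about an arbitrary graph.
∑-toggle : ∀ {n} i j (φ : Graph n → ℕ) →
  ∑ (allGraphs n) (λ G → φ (toggle i j G)) ≡ ∑ (allGraphs n) φ
∑-toggle {suc n} i j φ = trans (∑-allGraphs-suc n _) (trans step (sym (∑-allGraphs-suc n φ)))
  where
  step : ∑ (allGraphs n) (λ G → ∑ (allVecs n) (λ v → φ (toggle i j (G , v)))) ≡
         ∑ (allGraphs n) (λ G → ∑ (allVecs n) (λ v → φ (G , v)))
  step with view n i | view n j
  ... | old a | old b = ∑-toggle a b (λ G → ∑ (allVecs n) (λ v → φ (G , v)))
  ... | old a | last  = ∑-cong (allGraphs n) (λ G → ∑-allVecs-flip a (λ v → φ (G , v)))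
  ... | last  | old b = ∑-cong (allGraphs n) (λ G → ∑-allVecs-flip b (λ v → φ (G , v)))
  ... | last  | last  = refl

length-allVecs : ∀ n → length (allVecs n) ≡ 2 ^ n
length-allVecs zero    = refl
length-allVecs (suc n) = begin
  length (allVecs (suc n))        ≡⟨ ∑-1 (allVecs (suc n)) ⟨
  ∑ (allVecs (suc n)) (λ _ → 1)   ≡⟨ ∑-allVecs-suc n _ ⟩
  ∑ (allVecs n) (λ _ → 2)         ≡⟨ ∑-const (allVecs n) 2 ⟩
  length (allVecs n) * 2          ≡⟨ *-comm (length (allVecs n)) 2 ⟩
  2 * length (allVecs n)          ≡⟨ cong (2 *_) (length-allVecs n) ⟩
  2 ^ suc n                       ∎
  where open ≡-Reasoning

[1+n]C2 : ∀ n → suc n C 2 ≡ n C 2 + n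
[1+n]C2 n = trans (sym (nCk+nC[k+1]≡[n+1]C[k+1] n 1))
  (trans (cong (_+ n C 2) (nC1≡n n)) (+-comm n (n C 2)))

2*nC2 : ∀ n → 2 * (suc n C 2) ≡ suc n * n
2*nC2 zero    = refl
2*nC2 (suc n) rewrite [1+n]C2 (suc n) = trans (*-distribˡ-+ 2 (suc n C 2) (suc n))
  (trans (cong (_+ 2 * suc n) (2*nC2 n)) (lem n))
  where
  lem : ∀ n → suc n * n + 2 * suc n ≡ suc (suc n) * suc n
  lem = solve-∀

∑-allGraphs-1 : ∀ n → ∑ (allGraphs n) (λ _ → 1) ≡ 2 ^ (n C 2)
∑-allGraphs-1 zero    = refl
∑-allGraphs-1 (suc n) = begin
  ∑ (allGraphs (suc n)) (λ _ → 1)                      ≡⟨ ∑-allGraphs-suc n _ ⟩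
  ∑ (allGraphs n) (λ _ → ∑ (allVecs n) (λ _ → 1))      ≡⟨ ∑-cong (allGraphs n) (λ _ → trans (trans (∑-1 (allVecs n)) (length-allVecs n)) (sym (*-identityʳ _))) ⟩
  ∑ (allGraphs n) (λ _ → 2 ^ n * 1)                    ≡⟨ ∑-* (allGraphs n) (2 ^ n) (λ _ → 1) ⟩
  2 ^ n * ∑ (allGraphs n) (λ _ → 1)                    ≡⟨ cong (2 ^ n *_) (∑-allGraphs-1 n) ⟩
  2 ^ n * 2 ^ (n C 2)                                  ≡⟨ *-comm (2 ^ n) _ ⟩
  2 ^ (n C 2) * 2 ^ n                                  ≡⟨ ^-distribˡ-+-* 2 (n C 2) n ⟨
  2 ^ (n C 2 + n)                                      ≡⟨ cong (2 ^_) ([1+n]C2 n) ⟨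
  2 ^ (suc n C 2)                                      ∎
  where open ≡-Reasoning

count-∑ : ∀ n (P : Graph n → Bool) → count n P ≡ ∑ (allGraphs n) (λ G → ⟦ P G Bool.≟ true ⟧)
count-∑ n P = go (allGraphs n)
  where
  go : ∀ xs → length (filterᵇ P xs) ≡ ∑ xs (λ G → ⟦ P G Bool.≟ true ⟧)
  go [] = refl
  go (G ∷ xs) with P G
  ... | true  = cong suc (go xs)
  ... | false = go xs

edges : ∀ n → List (Fin n × Fin n)
edges zero    = []
edges (suc n) = map (λ (i , j) → inject₁ i , inject₁ j) (edges n) ++ map (λ i → inject₁ i , fromℕ n) (allFin n)

length-edges : ∀ n → length (edges n) ≡ n C 2
length-edges zero    = refl
length-edges (suc n) = begin
  length (edges (suc n))           ≡⟨ length-++ (map _ (edges n)) ⟩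
  length (map _ (edges n)) + length (map _ (allFin n)) ≡⟨ cong₂ _+_ (length-map _ (edges n)) (length-map _ (allFin n)) ⟩
  length (edges n) + length (allFin n) ≡⟨ cong₂ _+_ (length-edges n) (length-tabulate {n = n} (λ i → i)) ⟩
  n C 2 + n                        ≡⟨ [1+n]C2 n ⟨
  suc n C 2                        ∎
  where open ≡-Reasoning

∈-edges : ∀ {n} (i j : Fin n) → i ≢ j → ((i , j) ∈ edges n) ⊎ ((j , i) ∈ edges n)
∈-edges {suc n} i j i≢j with view n i | view n j
... | last  | last  = contradiction refl i≢j
... | old a | last  = inj₁ (∈-++⁺ʳ (map _ (edges n)) (∈-map⁺ _ (∈-allFin a)))
... | last  | old b = inj₂ (∈-++⁺ʳ (map _ (edges n)) (∈-map⁺ _ (∈-allFin b)))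
... | old a | old b with ∈-edges a b (λ e → i≢j (cong inject₁ e))
...   | inj₁ p = inj₁ (∈-++⁺ˡ (∈-map⁺ _ p))
...   | inj₂ p = inj₂ (∈-++⁺ˡ (∈-map⁺ _ p))

edges-ordered : ∀ {n} {i j : Fin n} → (i , j) ∈ edges n → i Fin.< j
edges-ordered {suc n} {i} {j} p with ∈-++⁻ (map _ (edges n)) p
... | inj₁ q with ∈-map⁻ _ q
...   | (a , b) , r , refl rewrite Fin.toℕ-inject₁ a | Fin.toℕ-inject₁ b = edges-ordered r
edges-ordered {suc n} {i} {j} p | inj₂ q with ∈-map⁻ _ q
...   | a , r , refl rewrite Fin.toℕ-inject₁ a | Fin.toℕ-fromℕ n = Fin.toℕ<n a

edges-unique : ∀ n → Unique (edges n)
edges-unique zero    = []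
edges-unique (suc n) = Uniq.++⁺
  (Uniq.map⁺ (λ e → cong₂ _,_ (Fin.inject₁-injective (cong proj₁ e)) (Fin.inject₁-injective (cong proj₂ e))) (edges-unique n))
  (Uniq.map⁺ (λ e → Fin.inject₁-injective (cong proj₁ e)) (Uniq.allFin⁺ n))
  disj
  where
  disj : ∀ {x} → ¬ (x ∈ map _ (edges n) × x ∈ map _ (allFin n))
  disj (p , q) with ∈-map⁻ _ p | ∈-map⁻ _ q
  ... | (a , b) , _ , e | c , _ , f = Fin.fromℕ≢inject₁ (cong proj₂ (trans (sym f) e))

-- Toggling the pivot of a constraint breaks that constraint and keeps all
-- others, so each constraint halves the number of graphs.
halving : ∀ {n} {I : Set} (ref piv : I → Fin n × Fin n) (xs : List I) → Unique xs →
  (∀ {x} → x ∈ xs → proj₁ (piv x) ≢ proj₂ (piv x)) →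
  (∀ {x y} → x ∈ xs → y ∈ xs → ¬ SameEdge (proj₁ (ref x)) (proj₂ (ref x)) (proj₁ (piv y)) (proj₂ (piv y))) →
  (∀ {x y} → x ∈ xs → y ∈ xs → x ≢ y → ¬ SameEdge (proj₁ (piv x)) (proj₂ (piv x)) (proj₁ (piv y)) (proj₂ (piv y))) →
  2 ^ length xs * ∑ (allGraphs n) (λ G → ⟦ all? (λ x → adj G (proj₁ (ref x)) (proj₂ (ref x)) Bool.≟ adj G (proj₁ (piv x)) (proj₂ (piv x))) xs ⟧)
    ≤ 2 ^ (n C 2)
halving {n} ref piv [] _ _ _ _ = ≤-reflexive (trans (+-identityʳ _) (∑-allGraphs-1 n))
halving {n} ref piv (x ∷ xs) (x∉ ∷ u) loop rp pp = begin
  2 ^ suc (length xs) * ∑ Gs sat₊           ≡⟨ rearr (2 ^ length xs) (∑ Gs sat₊) ⟩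
  2 ^ length xs * (∑ Gs sat₊ + ∑ Gs sat₊)   ≤⟨ *-monoʳ-≤ (2 ^ length xs) double ⟩
  2 ^ length xs * ∑ Gs sat                  ≤⟨ halving ref piv xs u (λ p → loop (there p)) (λ p q → rp (there p) (there q)) (λ p q → pp (there p) (there q)) ⟩
  2 ^ (n C 2)                               ∎
  where
  open ≤-Reasoning
  Gs = allGraphs n
  c? = λ (G : Graph n) y → adj G (proj₁ (ref y)) (proj₂ (ref y)) Bool.≟ adj G (proj₁ (piv y)) (proj₂ (piv y))
  sat sat₊ : Graph n → ℕ
  sat  G = ⟦ all? (c? G) xs ⟧
  sat₊ G = ⟦ all? (c? G) (x ∷ xs) ⟧
  τ = toggle {n} (proj₁ (piv x)) (proj₂ (piv x))
  rearr : ∀ a b → 2 * a * b ≡ a * (b + b)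
  rearr = solve-∀
  refτ : ∀ G {y} → y ∈ x ∷ xs → adj (τ G) (proj₁ (ref y)) (proj₂ (ref y)) ≡ adj G (proj₁ (ref y)) (proj₂ (ref y))
  refτ G {y} y∈ = adj-toggle-other _ _ G _ _ (rp y∈ (here refl))
  pivτ : ∀ G {y} → y ∈ xs → adj (τ G) (proj₁ (piv y)) (proj₂ (piv y)) ≡ adj G (proj₁ (piv y)) (proj₂ (piv y))
  pivτ G {y} y∈ = adj-toggle-other _ _ G _ _ (pp (there y∈) (here refl) λ e → All.lookup x∉ y∈ (sym e))
  keep : ∀ G → All (λ y → adj G (proj₁ (ref y)) (proj₂ (ref y)) ≡ adj G (proj₁ (piv y)) (proj₂ (piv y))) xs →
               All (λ y → adj (τ G) (proj₁ (ref y)) (proj₂ (ref y)) ≡ adj (τ G) (proj₁ (piv y)) (proj₂ (piv y))) xs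
  keep G a = All.tabulate λ y∈ → trans (refτ G (there y∈)) (trans (All.lookup a y∈) (sym (pivτ G y∈)))
  point : ∀ G → sat₊ G + sat₊ (τ G) ≤ sat (τ G)
  point G = ⟦⟧-disjoint (all? (c? G) (x ∷ xs)) (all? (c? (τ G)) (x ∷ xs)) (all? (c? (τ G)) xs)
    (λ a → keep G (All.tail a)) All.tail
    (λ a b → Bool.not-¬ refl (trans (sym (All.head a))
      (trans (sym (refτ G (here refl))) (trans (All.head b) (adj-toggle _ _ G (loop (here refl)))))))
  double : ∑ Gs sat₊ + ∑ Gs sat₊ ≤ ∑ Gs sat
  double = begin
    ∑ Gs sat₊ + ∑ Gs sat₊                  ≡⟨ cong (∑ Gs sat₊ +_) (∑-toggle (proj₁ (piv x)) (proj₂ (piv x)) sat₊) ⟨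
    ∑ Gs sat₊ + ∑ Gs (λ G → sat₊ (τ G))    ≡⟨ ∑-+ Gs sat₊ (λ G → sat₊ (τ G)) ⟨
    ∑ Gs (λ G → sat₊ G + sat₊ (τ G))       ≤⟨ ∑-mono Gs point ⟩
    ∑ Gs (λ G → sat (τ G))                 ≡⟨ ∑-toggle (proj₁ (piv x)) (proj₂ (piv x)) sat ⟩
    ∑ Gs sat                               ∎

-- Canonical relabelling

bit : Bool → ℕ
bit false = 0
bit true  = 1

-- Binary value, lowest bit first. It serves twice: it orders the windows of labelled graphs, and it
-- turns Hamming syndromes into integer symbols.
enc : ∀ {k} → Vec Bool k → ℕ
enc []      = 0
enc (b ∷ v) = bit b + 2 * enc v

enc-injective : ∀ {k} (v w : Vec Bool k) → enc v ≡ enc w → v ≡ w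
enc-injective [] [] _ = refl
enc-injective (false ∷ v) (false ∷ w) e = cong (false ∷_) (enc-injective v w (*-cancelˡ-≡ _ _ 2 e))
enc-injective (true ∷ v)  (true ∷ w)  e = cong (true ∷_) (enc-injective v w (*-cancelˡ-≡ _ _ 2 (suc-injective e)))
enc-injective (false ∷ v) (true ∷ w)  e = contradiction e (even≢odd (enc v) (enc w))
enc-injective (true ∷ v)  (false ∷ w) e = contradiction (sym e) (even≢odd (enc w) (enc v))

enc<2^k : ∀ {k} (v : Vec Bool k) → enc v < 2 ^ k
enc<2^k [] = s≤s z≤n
enc<2^k {suc k} (b ∷ v) = begin
  suc (bit b + 2 * enc v) ≤⟨ s≤s (+-monoˡ-≤ (2 * enc v) (bit≤1 b)) ⟩
  2 + 2 * enc v           ≡⟨ *-suc 2 (enc v) ⟨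
  2 * suc (enc v)         ≤⟨ *-monoʳ-≤ 2 (enc<2^k v) ⟩
  2 ^ suc k               ∎
  where
  open ≤-Reasoning
  bit≤1 : ∀ b → bit b ≤ 1
  bit≤1 false = z≤n
  bit≤1 true  = s≤s z≤n

argmin : {A : Set} {P : A → Set} (P? : ∀ x → Dec (P x)) (f : A → ℕ) (xs : List A) →
  (∀ {x} → x ∈ xs → ¬ P x) ⊎ (∃[ x ] (P x × ∀ {y} → y ∈ xs → P y → f x ≤ f y))
argmin P? f [] = inj₁ λ ()
argmin P? f (x ∷ xs) with P? x | argmin P? f xs
... | no ¬p | inj₁ none = inj₁ λ { (here refl) → ¬p ; (there q) → none q }
... | no ¬p | inj₂ (y , py , min) = inj₂ (y , py , λ { (here refl) p → contradiction p ¬p ; (there q) → min q })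
... | yes p | inj₁ none = inj₂ (x , p , λ { (here refl) _ → ≤-refl ; (there q) pz → contradiction pz (none q) })
... | yes p | inj₂ (y , py , min) with ≤-total (f x) (f y)
...   | inj₁ le = inj₂ (x , p , λ { (here refl) _ → ≤-refl ; (there q) pz → ≤-trans le (min q pz) })
...   | inj₂ le = inj₂ (y , py , λ { (here refl) _ → le ; (there q) → min q })

-- A candidate relabelling: a map from labels to vertices and its would-be inverse.
Map : ℕ → Set
Map n = Vec (Fin n) n × Vec (Fin n) n

infix 20 _⟨_⟩ _⟨_⟩⁻¹

_⟨_⟩ : ∀ {n} → Map n → Fin n → Fin n
π ⟨ i ⟩ = lookup (proj₁ π) i

_⟨_⟩⁻¹ : ∀ {n} → Map n → Fin n → Fin n
π ⟨ i ⟩⁻¹ = lookup (proj₂ π) i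

record IsPerm {n} (π : Map n) : Set where
  constructor mkPerm
  field
    from-to : ∀ i → π ⟨ π ⟨ i ⟩ ⟩⁻¹ ≡ i
    to-from : ∀ i → π ⟨ π ⟨ i ⟩⁻¹ ⟩ ≡ i

open IsPerm

isPerm? : ∀ {n} (π : Map n) → Dec (IsPerm π)
isPerm? π = map′ (λ (p , q) → mkPerm p q) (λ p → from-to p , to-from p)
  (Fin.all? (λ i → _ Fin.≟ _) ×-dec Fin.all? (λ i → _ Fin.≟ _))

perm-injective : ∀ {n} (π : Map n) → IsPerm π → ∀ {i j} → π ⟨ i ⟩ ≡ π ⟨ j ⟩ → i ≡ j
perm-injective π p {i} {j} e = trans (sym (from-to p i)) (trans (cong (π ⟨_⟩⁻¹) e) (from-to p j))

perm-injective⁻¹ : ∀ {n} (π : Map n) → IsPerm π → ∀ {i j} → π ⟨ i ⟩⁻¹ ≡ π ⟨ j ⟩⁻¹ → i ≡ j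
perm-injective⁻¹ π p {i} {j} e = trans (sym (to-from p i)) (trans (cong (π ⟨_⟩) e) (to-from p j))

tabMap : ∀ {n} → (Fin n → Fin n) → (Fin n → Fin n) → Map n
tabMap f g = tabulate f , tabulate g

tabMap-to : ∀ {n} (f g : Fin n → Fin n) i → tabMap f g ⟨ i ⟩ ≡ f i
tabMap-to f g i = lookup∘tabulate f i

tabMap-from : ∀ {n} (f g : Fin n → Fin n) i → tabMap f g ⟨ i ⟩⁻¹ ≡ g i
tabMap-from f g i = lookup∘tabulate g i

tabMap-perm : ∀ {n} (f g : Fin n → Fin n) → (∀ i → g (f i) ≡ i) → (∀ i → f (g i) ≡ i) → IsPerm (tabMap f g)
tabMap-perm f g gf fg = mkPerm
  (λ i → trans (tabMap-from f g _) (trans (cong g (tabMap-to f g i)) (gf i)))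
  (λ i → trans (tabMap-to f g _) (trans (cong f (tabMap-from f g i)) (fg i)))

maps : ∀ n → List (Map n)
maps n = cartesianProduct (words (allFin n) n) (words (allFin n) n)

∈-maps : ∀ {n} (π : Map n) → π ∈ maps n
∈-maps (v , w) = ∈-cartesianProduct⁺ (∈-words _ ∈-allFin v) (∈-words _ ∈-allFin w)

module Labelling (n s : ℕ) where

  T : Fin n → Set
  T v = toℕ v < s

  T? : ∀ v → Dec (T v)
  T? v = toℕ v <? s

  -- Only pairs of labels with a special end are compared. `window` stores the same information as a
  -- bit vector, so that labellings can be ranked by `enc`.
  record Agree (G : Graph n) (π : Map n) (H : Graph n) (π′ : Map n) : Set where
    constructor mkAgree
    field
      at : ∀ i v → T i → adj G (π ⟨ i ⟩) (π ⟨ v ⟩) ≡ adj H (π′ ⟨ i ⟩) (π′ ⟨ v ⟩)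

  open Agree

  entry : Graph n → Map n → Fin n × Fin n → Bool
  entry G π (i , v) with T? i
  ... | yes _ = adj G (π ⟨ i ⟩) (π ⟨ v ⟩)
  ... | no _  = false

  window : Graph n → Map n → Vec Bool (n * n)
  window G π = tabulate λ k → entry G π (remQuot n k)

  agree⇒window : ∀ {G π H π′} → Agree G π H π′ → window G π ≡ window H π′
  agree⇒window {G} {π} {H} {π′} ag = tabulate-cong λ k → go (remQuot n k)
    where
    go : ∀ iv → entry G π iv ≡ entry H π′ iv
    go (i , v) with T? i
    ... | yes t = at ag i v t
    ... | no _  = refl

  entry-T : ∀ G π i v → T i → entry G π (i , v) ≡ adj G (π ⟨ i ⟩) (π ⟨ v ⟩)
  entry-T G π i v t with T? i
  ... | yes _ = refl
  ... | no ¬t = contradiction t ¬t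

  lookup-window : ∀ G π i v → lookup (window G π) (combine i v) ≡ entry G π (i , v)
  lookup-window G π i v = trans (lookup∘tabulate (λ k → entry G π (remQuot n k)) (combine i v))
    (cong (entry G π) (Fin.remQuot-combine i v))

  window⇒agree : ∀ {G π H π′} → window G π ≡ window H π′ → Agree G π H π′
  window⇒agree {G} {π} {H} {π′} eq = mkAgree λ i v t → begin
    adj G (π ⟨ i ⟩) (π ⟨ v ⟩)            ≡⟨ entry-T G π i v t ⟨
    entry G π (i , v)                    ≡⟨ lookup-window G π i v ⟨
    lookup (window G π) (combine i v)    ≡⟨ cong (λ w → lookup w (combine i v)) eq ⟩
    lookup (window H π′) (combine i v)   ≡⟨ lookup-window H π′ i v ⟩
    entry H π′ (i , v)                   ≡⟨ entry-T H π′ i v t ⟩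
    adj H (π′ ⟨ i ⟩) (π′ ⟨ v ⟩)          ∎
    where open ≡-Reasoning

  -- Only pairs meeting T are compared, so whether ρ is an automorphism in this
  -- sense can be read off from the part of the relabelled graph that meets T.
  Cons : Graph n → Map n → Map n → Set
  Cons G π ρ = ∀ i v → T i → T (ρ ⟨ i ⟩) ⊎ T (ρ ⟨ v ⟩) →
    adj G (π ⟨ i ⟩) (π ⟨ v ⟩) ≡ adj G (π ⟨ ρ ⟨ i ⟩ ⟩) (π ⟨ ρ ⟨ v ⟩ ⟩)

  cons? : ∀ G π ρ → Dec (Cons G π ρ)
  cons? G π ρ = Fin.all? λ i → Fin.all? λ v →
    T? i →-dec ((T? (ρ ⟨ i ⟩) ⊎-dec T? (ρ ⟨ v ⟩)) →-dec (_ Bool.≟ _))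

  -- All labels must be fixed, not only the special ones, because the colour is read from the pairs
  -- of ordinary labels.
  Rigid : Graph n → Map n → Set
  Rigid G π = All (λ ρ → IsPerm ρ → Cons G π ρ → ∀ i → ρ ⟨ i ⟩ ≡ i) (maps n)

  rigid? : ∀ G π → Dec (Rigid G π)
  rigid? G π = all? (λ ρ → isPerm? ρ →-dec (cons? G π ρ →-dec Fin.all? (λ i → _ Fin.≟ _))) (maps n)

  Valid : Graph n → Map n → Set
  Valid G π = IsPerm π × Rigid G π

  valid? : ∀ G π → Dec (Valid G π)
  valid? G π = isPerm? π ×-dec rigid? G π

  agree-sym : ∀ {G π H π′} → Agree G π H π′ → Agree H π′ G π
  agree-sym ag = mkAgree λ i v t → sym (at ag i v t)

  -- Both pairs in each equation of `Cons` have a special label at one end, so agreement transports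
  -- both sides; adjacency is turned round when that end is the second one. Hence the certificate
  -- survives every change outside the window.
  rigid-agree : ∀ {G π H π′} → Agree G π H π′ → Rigid G π → Rigid H π′
  rigid-agree {G} {π} {H} {π′} ag = All.map λ {ρ} r p c → r p λ i v t t′ →
    trans (at ag i v t) (trans (c i v t t′) (sym (ends ρ i v t′)))
    where
    ends : ∀ ρ i v → T (ρ ⟨ i ⟩) ⊎ T (ρ ⟨ v ⟩) →
      adj G (π ⟨ ρ ⟨ i ⟩ ⟩) (π ⟨ ρ ⟨ v ⟩ ⟩) ≡ adj H (π′ ⟨ ρ ⟨ i ⟩ ⟩) (π′ ⟨ ρ ⟨ v ⟩ ⟩)
    ends ρ i v (inj₁ t) = at ag _ _ t
    ends ρ i v (inj₂ t) = trans (adj-sym G _ _) (trans (at ag _ _ t) (adj-sym H _ _))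

  -- The permutation `ρ` comparing the two labellings satisfies `Cons`, so rigidity of the first
  -- makes it the identity.
  agree-unique : ∀ {G π π′} → Valid G π → IsPerm π′ → Agree G π G π′ → ∀ i → π ⟨ i ⟩ ≡ π′ ⟨ i ⟩
  agree-unique {G} {π} {π′} (p , rigid) p′ ag i = begin
    π ⟨ i ⟩         ≡⟨ cong (π ⟨_⟩) (All.lookup rigid (∈-maps ρ) ρ-perm ρ-cons i) ⟨
    π ⟨ ρ ⟨ i ⟩ ⟩   ≡⟨ πρ i ⟩
    π′ ⟨ i ⟩        ∎
    where
    open ≡-Reasoning
    f g : Fin n → Fin n
    f j = π ⟨ π′ ⟨ j ⟩ ⟩⁻¹
    g j = π′ ⟨ π ⟨ j ⟩ ⟩⁻¹
    ρ = tabMap f g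
    ρ-perm : IsPerm ρ
    ρ-perm = tabMap-perm f g
      (λ j → trans (cong (π′ ⟨_⟩⁻¹) (to-from p _)) (from-to p′ j))
      (λ j → trans (cong (π ⟨_⟩⁻¹) (to-from p′ _)) (from-to p j))
    πρ : ∀ j → π ⟨ ρ ⟨ j ⟩ ⟩ ≡ π′ ⟨ j ⟩
    πρ j = trans (cong (π ⟨_⟩) (tabMap-to f g j)) (to-from p _)
    ρ-cons : Cons G π ρ
    ρ-cons j v t _ = trans (at ag j v t) (sym (cong₂ (adj G) (πρ j) (πρ v)))

  score : Graph n → Map n → ℕ
  score G π = enc (window G π)

  Best : Graph n → Map n → Set
  Best G π = Valid G π × (∀ π′ → Valid G π′ → score G π ≤ score G π′)

  best : ∀ G → (∀ π → ¬ Valid G π) ⊎ (∃[ π ] Best G π)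
  best G with argmin (valid? G) (score G) (maps n)
  ... | inj₁ none = inj₁ λ π → none (∈-maps π)
  ... | inj₂ (π , v , min) = inj₂ (π , v , λ π′ → min (∈-maps π′))

  -- Each minimal window also occurs in the other graph, so the two scores bound each other and the
  -- windows coincide; rigidity then identifies the labellings. It is used with `ρ` a transported
  -- labelling when the graphs are isomorphic, and with `ρ` equal to `π` when they differ by a flip
  -- outside both windows.
  best-unique : ∀ {G H π π′ ρ ρ′} → Best G π → Best H π′ →
    IsPerm ρ → Agree G π H ρ → IsPerm ρ′ → Agree H π′ G ρ′ → ∀ i → π′ ⟨ i ⟩ ≡ ρ ⟨ i ⟩
  best-unique {G} {H} {π} {π′} {ρ} {ρ′} ((p , r) , min) ((p′ , r′) , min′) q ag q′ ag′ =
    agree-unique (p′ , r′) q (window⇒agree (enc-injective _ _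
      (≤-antisym (min′ ρ (q , rigid-agree ag r))
        (begin
          score H ρ   ≡⟨ cong enc (agree⇒window (agree-sym ag)) ⟩
          score G π   ≤⟨ min ρ′ (q′ , rigid-agree ag′ r′) ⟩
          score G ρ′  ≡⟨ cong enc (agree⇒window (agree-sym ag′)) ⟩
          score H π′  ∎))))
    where open ≤-Reasoning

  Free : Map n → Fin n → Fin n → Set
  Free π i j = ¬ T (π ⟨ i ⟩⁻¹) × ¬ T (π ⟨ j ⟩⁻¹)

  agree-toggle : ∀ {G π i j} → IsPerm π → Free π i j → Agree G π (toggle i j G) π
  agree-toggle {G} {π} {i} {j} p (fi , fj) = mkAgree λ a v t → sym (adj-toggle-other i j G _ _
    λ { (inj₁ (e , _)) → fi (subst T (trans (sym (from-to p a)) (cong (π ⟨_⟩⁻¹) e)) t)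
      ; (inj₂ (e , _)) → fj (subst T (trans (sym (from-to p a)) (cong (π ⟨_⟩⁻¹) e)) t) })

  best-toggle : ∀ {G i j π π′} → Best G π → Best (toggle i j G) π′ →
    Free π i j → Free π′ i j → ∀ a → π′ ⟨ a ⟩ ≡ π ⟨ a ⟩
  best-toggle b@((p , _) , _) b′@((p′ , _) , _) fr fr′ =
    best-unique b b′ p (agree-toggle p fr) p′ (agree-sym (agree-toggle p′ fr′))

  transport : (Fin n ↔ Fin n) → Map n → Map n
  transport σ π = tabMap (λ i → Inverse.to σ (π ⟨ i ⟩)) (λ i → π ⟨ Inverse.from σ i ⟩⁻¹)

  transport-perm : ∀ σ π → IsPerm π → IsPerm (transport σ π)
  transport-perm σ π p = tabMap-perm _ _
    (λ i → trans (cong (π ⟨_⟩⁻¹) (Inverse.strictlyInverseʳ σ _)) (from-to p i))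
    (λ i → trans (cong (Inverse.to σ) (to-from p _)) (Inverse.strictlyInverseˡ σ i))

  transport-adj : ∀ σ {G H} → (∀ i j → adj H (Inverse.to σ i) (Inverse.to σ j) ≡ adj G i j) →
    ∀ π i j → adj G (π ⟨ i ⟩) (π ⟨ j ⟩) ≡ adj H (transport σ π ⟨ i ⟩) (transport σ π ⟨ j ⟩)
  transport-adj σ {G} {H} iso π i j = trans (sym (iso _ _))
    (sym (cong₂ (adj H) (lookup∘tabulate (λ k → Inverse.to σ (π ⟨ k ⟩)) i) (lookup∘tabulate (λ k → Inverse.to σ (π ⟨ k ⟩)) j)))

  module Colouring {C : Set} (colour : (Fin n → Fin n → Bool) → C)
    (colour-cong : ∀ {g h} → (∀ i j → g i j ≡ h i j) → colour g ≡ colour h) where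

    relabel : Graph n → Map n → Fin n → Fin n → Bool
    relabel G π i j = adj G (π ⟨ i ⟩) (π ⟨ j ⟩)

    -- Graphs without a certified labelling get `nothing`, which is not among the colours to be
    -- covered.
    S : Graph n → Maybe C
    S G with best G
    ... | inj₁ _       = nothing
    ... | inj₂ (π , _) = just (colour (relabel G π))

    S-invariant : ∀ (σ : Fin n ↔ Fin n) G H →
      (∀ i j → adj H (Inverse.to σ i) (Inverse.to σ j) ≡ adj G i j) → S G ≡ S H
    S-invariant σ G H iso = compare
      where
      iso⁻¹ : ∀ i j → adj G (Inverse.from σ i) (Inverse.from σ j) ≡ adj H i j
      iso⁻¹ i j = trans (sym (iso _ _)) (cong₂ (adj H) (Inverse.strictlyInverseˡ σ i) (Inverse.strictlyInverseˡ σ j))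
      forth : ∀ π → Agree G π H (transport σ π)
      forth π = mkAgree λ i v _ → transport-adj σ iso π i v
      back : ∀ π → Agree H π G (transport (↔-sym σ) π)
      back π = mkAgree λ i v _ → transport-adj (↔-sym σ) iso⁻¹ π i v
      compare : S G ≡ S H
      compare with best G | best H
      ... | inj₁ _    | inj₁ _    = refl
      ... | inj₂ (π , ((p , r) , _)) | inj₁ none = contradiction
              (transport-perm σ π p , rigid-agree (forth π) r) (none _)
      ... | inj₁ none | inj₂ (π , ((p , r) , _)) = contradiction
              (transport-perm (↔-sym σ) π p , rigid-agree (back π) r) (none _)
      ... | inj₂ (π , b@((p , _) , _)) | inj₂ (π′ , b′@((p′ , _) , _)) =
        cong just (colour-cong λ i j → trans (transport-adj σ iso π i j) (sym (cong₂ (adj H) (same i) (same j))))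
        where
        same : ∀ i → π′ ⟨ i ⟩ ≡ transport σ π ⟨ i ⟩
        same = best-unique b b′
          (transport-perm σ π p) (forth π) (transport-perm (↔-sym σ) π′ p′) (back π′)

-- Almost every graph is rigid

∈-toList : ∀ {A : Set} {k} (v : Vec A k) l → lookup v l ∈ toList v
∈-toList (x ∷ v) zero    = here refl
∈-toList (x ∷ v) (suc l) = there (∈-toList v l)

module _ {n : ℕ} where
  open import Data.List.Membership.DecPropositional (Fin._≟_ {n}) public using (_∈?_)

module Rarity (n s : ℕ) (s≤n : s ≤ n) where
  open Labelling n s

  ∑-T-lower : s ≤ ∑ (allFin n) (λ v → ⟦ T? v ⟧)
  ∑-T-lower = begin
    s                              ≡⟨ length-tabulate {n = s} (λ i → i) ⟨
    length (allFin s)              ≡⟨ ∑-1 (allFin s) ⟨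
    ∑ (allFin s) (λ _ → 1)         ≤⟨ ∑-injection (allFin s) (allFin n) (λ _ → 1) (λ v → ⟦ T? v ⟧) (λ i → Fin.inject≤ i s≤n)
                                        (Uniq.allFin⁺ s) (λ _ _ → ∈-allFin _)
                                        (λ _ _ _ _ → Fin.inject≤-injective s≤n s≤n _ _)
                                        (λ i → ≤-reflexive (sym (⟦⟧-yes (T? _) (subst (_< s) (sym (Fin.toℕ-inject≤ i s≤n)) (Fin.toℕ<n i))))) ⟩
    ∑ (allFin n) (λ v → ⟦ T? v ⟧)  ∎
    where open ≤-Reasoning

  fresh? : ∀ (V : List (Fin n)) v → Dec (T v × v ∉ V)
  fresh? V v = T? v ×-dec ¬? (v ∈? V)

  -- Pairs joining these vertices to `V` become the pivots for `halving`; removing `V` keeps the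
  -- pivots apart from the pairs they are compared with.
  fresh : List (Fin n) → List (Fin n)
  fresh V = filter (fresh? V) (allFin n)

  fresh-∉ : ∀ {V v} → v ∈ fresh V → v ∉ V
  fresh-∉ {V} p = proj₂ (proj₂ (∈-filter⁻ (fresh? V) {xs = allFin n} p))

  fresh-T : ∀ {V v} → v ∈ fresh V → T v
  fresh-T {V} p = proj₁ (proj₂ (∈-filter⁻ (fresh? V) {xs = allFin n} p))

  fresh-unique : ∀ V → Unique (fresh V)
  fresh-unique V = Uniq.filter⁺ (fresh? V) (Uniq.allFin⁺ n)

  length-fresh : ∀ V → s ≤ length (fresh V) + length V
  length-fresh V = begin
    s                                                                   ≤⟨ ∑-T-lower ⟩
    ∑ (allFin n) (λ v → ⟦ T? v ⟧)                                       ≤⟨ ∑-mono (allFin n) split ⟩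
    ∑ (allFin n) (λ v → ⟦ fresh? V v ⟧ + ⟦ v ∈? V ⟧)                    ≡⟨ ∑-+ (allFin n) _ _ ⟩
    ∑ (allFin n) (λ v → ⟦ fresh? V v ⟧) + ∑ (allFin n) (λ v → ⟦ v ∈? V ⟧) ≤⟨ +-mono-≤ (≤-reflexive (sym (length-filter-∑ (fresh? V) (allFin n)))) inV ⟩
    length (fresh V) + length V                                         ∎
    where
    open ≤-Reasoning
    split : ∀ v → ⟦ T? v ⟧ ≤ ⟦ fresh? V v ⟧ + ⟦ v ∈? V ⟧
    split v with T? v | v ∈? V
    ... | no _  | _     = z≤n
    ... | yes _ | yes _ = ≤-refl
    ... | yes _ | no _  = ≤-refl
    inV : ∑ (allFin n) (λ v → ⟦ v ∈? V ⟧) ≤ length V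
    inV = ≤-trans (∑-injection (allFin n) V (λ v → ⟦ v ∈? V ⟧) (λ _ → 1) (λ v → v) (Uniq.allFin⁺ n)
            (λ {x} _ ne → ⟦⟧≢0 (x ∈? V) ne) (λ _ _ _ _ e → e) (λ v → ⟦⟧≤1 (v ∈? V)))
            (≤-reflexive (∑-1 V))

  weaken : ∀ {a b c S t} → a ≤ b + c → 2 ^ b * S ≤ t → 2 ^ a * S ≤ 2 ^ c * t
  weaken {a} {b} {c} {S} {t} le h = begin
    2 ^ a * S            ≤⟨ *-monoˡ-≤ S (^-monoʳ-≤ 2 le) ⟩
    2 ^ (b + c) * S      ≡⟨ cong (_* S) (^-distribˡ-+-* 2 b c) ⟩
    2 ^ b * 2 ^ c * S    ≡⟨ rearr (2 ^ b) (2 ^ c) S ⟩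
    2 ^ c * (2 ^ b * S)  ≤⟨ *-monoʳ-≤ (2 ^ c) h ⟩
    2 ^ c * t            ∎
    where
    open ≤-Reasoning
    rearr : ∀ x y z → x * y * z ≡ y * (x * z)
    rearr = solve-∀

  ∑-zero : ∀ {c t} → c * ∑ (allGraphs n) (λ _ → 0) ≤ t
  ∑-zero {c} rewrite ∑-const (allGraphs n) 0 | *-zeroʳ (length (allGraphs n)) | *-zeroʳ c = z≤n

  -- The trace of a permutation moving few special vertices: `y` is the image of `x`, the list `W`
  -- covers the special vertices that move, and the fixed ones cannot distinguish `x` from `y`.
  Twins : ∀ {w} → Fin n × Fin n × Vec (Fin n) w → Graph n → Set
  Twins (x , y , W) G = x ≢ y × All (λ v → adj G x v ≡ adj G y v) (fresh (x ∷ y ∷ toList W))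

  twins? : ∀ {w} (d : Fin n × Fin n × Vec (Fin n) w) G → Dec (Twins d G)
  twins? (x , y , W) G = ¬? (x Fin.≟ y) ×-dec all? (λ v → adj G x v Bool.≟ adj G y v) (fresh (x ∷ y ∷ toList W))

  twins-rare : ∀ {w} (d : Fin n × Fin n × Vec (Fin n) w) →
    2 ^ s * ∑ (allGraphs n) (λ G → ⟦ twins? d G ⟧) ≤ 2 ^ (2 + w) * 2 ^ (n C 2)
  twins-rare {w} (x , y , W) with x Fin.≟ y
  ... | yes _ = ∑-zero {2 ^ s}
  ... | no x≢y = weaken {a = s} {b = length F} {c = 2 + w} {S = ∑ (allGraphs n) _}
      (subst (λ z → s ≤ length F + (2 + z)) (length-toList W) (length-fresh (x ∷ y ∷ toList W)))
      (≤-trans (*-monoʳ-≤ (2 ^ length F) (∑-mono (allGraphs n) λ G → ⟦⟧-mono proj₂ (yes x≢y ×-dec all? (λ v → adj G x v Bool.≟ adj G y v) F) (all? (λ v → adj G x v Bool.≟ adj G y v) F)))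
        (halving (x ,_) (y ,_) F (fresh-unique _)
          (λ p e → fresh-∉ p (there (here (sym e))))
          (λ { p q (inj₁ (e , _)) → x≢y e ; p q (inj₂ (e , _)) → fresh-∉ q (here (sym e)) })
          (λ { p q ne (inj₁ (_ , e)) → ne e ; p q ne (inj₂ (e , _)) → fresh-∉ q (there (here (sym e))) })))
    where
    F = fresh (x ∷ y ∷ toList W)

  ShiftedData : ℕ → Set
  ShiftedData b = Vec (Fin n) b × Vec (Fin n) b × Vec (Fin n) n

  Distinct : ∀ {b} → Vec (Fin n) b → Vec (Fin n) b → Set
  Distinct js ks = (∀ l l′ → lookup ks l ≡ lookup ks l′ → l ≡ l′) × (∀ l l′ → lookup js l ≢ lookup ks l′)

  distinct? : ∀ {b} (js ks : Vec (Fin n) b) → Dec (Distinct js ks)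
  distinct? js ks = (Fin.all? λ l → Fin.all? λ l′ → (_ Fin.≟ _) →-dec (_ Fin.≟ _))
              ×-dec (Fin.all? λ l → Fin.all? λ l′ → ¬? (_ Fin.≟ _))

  grid : ∀ {b} → Vec (Fin n) b → Vec (Fin n) b → List (Fin b × Fin n)
  grid {b} js ks = cartesianProduct (allFin b) (fresh (toList js ++ toList ks))

  -- The trace of a permutation moving many special vertices. Entries of `ks` are preimages of the
  -- entries of `js`, and `α` lists the values of the permutation, so each equation says that the
  -- pair of `i` and a preimage is carried to an equal adjacency.
  Shifted : ∀ {b} → ShiftedData b → Graph n → Set
  Shifted (js , ks , α) G = Distinct js ks ×
    All (λ (l , i) → adj G (lookup α i) (lookup js l) ≡ adj G i (lookup ks l)) (grid js ks)

  shifted? : ∀ {b} (d : ShiftedData b) G → Dec (Shifted d G)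
  shifted? (js , ks , α) G = distinct? js ks ×-dec
    all? (λ (l , i) → adj G (lookup α i) (lookup js l) Bool.≟ adj G i (lookup ks l)) (grid js ks)

  -- There are `b` rows of about `s` constraints. Distinct entries of `ks` separate the pivots, and
  -- disjointness of `js` from `ks` keeps the reference pairs off them. The loss `b * (b + b)`
  -- allows for the vertices of `V` missing from each row.
  shifted-rare : ∀ {b} (d : ShiftedData b) →
    2 ^ (b * s) * ∑ (allGraphs n) (λ G → ⟦ shifted? d G ⟧) ≤ 2 ^ (b * (b + b)) * 2 ^ (n C 2)
  shifted-rare {b} (js , ks , α) with distinct? js ks
  ... | no _ = ∑-zero {2 ^ (b * s)}
  ... | yes d@(ks-inj , js≢ks) = weaken {a = b * s} {b = length F} {c = b * (b + b)} {S = ∑ (allGraphs n) _} size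
      (≤-trans (*-monoʳ-≤ (2 ^ length F) (∑-mono (allGraphs n) λ G → ⟦⟧-mono proj₂
            (yes d ×-dec all? (λ (l , i) → adj G (lookup α i) (lookup js l) Bool.≟ adj G i (lookup ks l)) F)
            (all? (λ (l , i) → adj G (lookup α i) (lookup js l) Bool.≟ adj G i (lookup ks l)) F)))
        (halving (λ (l , i) → lookup α i , lookup js l) (λ (l , i) → i , lookup ks l) F
          (Uniq.cartesianProduct⁺ (Uniq.allFin⁺ b) (fresh-unique V))
          (λ {x} p e → ∉ks (proj₂ x) (proj₁ x) (snd p) e)
          (λ { {x} {y} p q (inj₁ (_ , e)) → js≢ks (proj₁ x) (proj₁ y) e
             ; {x} {y} p q (inj₂ (_ , e)) → ∉js (proj₂ y) (proj₁ x) (snd q) (sym e) })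
          (λ { {x} {y} p q ne (inj₁ (e , f)) → ne (cong₂ _,_ (ks-inj (proj₁ x) (proj₁ y) f) e)
             ; {x} {y} p q ne (inj₂ (e , _)) → ∉ks (proj₂ x) (proj₁ y) (snd p) e })))
    where
    V = toList js ++ toList ks
    F = grid js ks
    snd : ∀ {x} → x ∈ F → proj₂ x ∈ fresh V
    snd p = proj₂ (∈-cartesianProduct⁻ (allFin b) (fresh V) p)
    ∉js : ∀ i l → i ∈ fresh V → i ≢ lookup js l
    ∉js i l p refl = fresh-∉ p (∈-++⁺ˡ (∈-toList js l))
    ∉ks : ∀ i l → i ∈ fresh V → i ≢ lookup ks l
    ∉ks i l p refl = fresh-∉ p (∈-++⁺ʳ (toList js) (∈-toList ks l))
    len-V : length V ≡ b + b
    len-V = trans (length-++ (toList js)) (cong₂ _+_ (length-toList js) (length-toList ks))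
    size : b * s ≤ length F + b * (b + b)
    size = begin
      b * s                                      ≤⟨ *-monoʳ-≤ b (length-fresh V) ⟩
      b * (length (fresh V) + length V)          ≡⟨ *-distribˡ-+ b (length (fresh V)) (length V) ⟩
      b * length (fresh V) + b * length V        ≡⟨ cong₂ _+_ (cong (_* length (fresh V)) (length-tabulate {n = b} (λ i → i))) (cong (b *_) (sym len-V)) ⟨
      length (allFin b) * length (fresh V) + b * (b + b) ≡⟨ cong (_+ b * (b + b)) (length-× _,_ (allFin b) (fresh V)) ⟨
      length F + b * (b + b)                     ∎
      where open ≤-Reasoning

  module Greedy (ρ : Map n) (p : IsPerm ρ) (x : Fin n) where

    -- Each chosen vertex blocks itself, its preimage and its image; any moved special vertex
    -- outside these can be added to a `Spread` list.
    triples : ∀ {b} → Vec (Fin n) b → Vec (Fin n) (b * 3)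
    triples []       = []
    triples (j ∷ js) = j ∷ ρ ⟨ j ⟩⁻¹ ∷ ρ ⟨ j ⟩ ∷ triples js

    ∈-triples : ∀ {b} (js : Vec (Fin n) b) l →
      (lookup js l ∈ toList (triples js)) × (ρ ⟨ lookup js l ⟩⁻¹ ∈ toList (triples js)) × (ρ ⟨ lookup js l ⟩ ∈ toList (triples js))
    ∈-triples (j ∷ js) zero    = here refl , there (here refl) , there (there (here refl))
    ∈-triples (j ∷ js) (suc l) with ∈-triples js l
    ... | q , r , t = there (there (there q)) , there (there (there r)) , there (there (there t))

    record Spread {b} (js : Vec (Fin n) b) : Set where
      field
        inT   : ∀ l → T (lookup js l)
        inj   : ∀ l l′ → lookup js l ≡ lookup js l′ → l ≡ l′
        apart : ∀ l l′ → lookup js l ≢ ρ ⟨ lookup js l′ ⟩⁻¹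

    open Spread public

    Covers : ∀ {w} → Vec (Fin n) w → Set
    Covers W = ∀ v → T v → ρ ⟨ v ⟩ ≢ v → v ∈ toList W

    extend : ∀ {b} {js : Vec (Fin n) b} {v} → Spread js → T v → ρ ⟨ v ⟩ ≢ v → v ∉ toList (triples js) → Spread (v ∷ js)
    extend {js = js} {v} sp t mv v∉ = record { inT = inT′ ; inj = inj′ ; apart = apart′ }
      where
      inT′ : ∀ l → T (lookup (v ∷ js) l)
      inT′ zero    = t
      inT′ (suc l) = inT sp l
      inj′ : ∀ l l′ → lookup (v ∷ js) l ≡ lookup (v ∷ js) l′ → l ≡ l′
      inj′ zero    zero     _ = refl
      inj′ zero    (suc l′) e = contradiction (subst (_∈ toList (triples js)) (sym e) (proj₁ (∈-triples js l′))) v∉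
      inj′ (suc l) zero     e = contradiction (subst (_∈ toList (triples js)) e (proj₁ (∈-triples js l))) v∉
      inj′ (suc l) (suc l′) e = cong suc (inj sp l l′ e)
      apart′ : ∀ l l′ → lookup (v ∷ js) l ≢ ρ ⟨ lookup (v ∷ js) l′ ⟩⁻¹
      apart′ zero    zero     e = mv (trans (cong (ρ ⟨_⟩) e) (to-from p v))
      apart′ zero    (suc l′) e = v∉ (subst (_∈ toList (triples js)) (sym e) (proj₁ (proj₂ (∈-triples js l′))))
      apart′ (suc l) zero     e = v∉ (subst (_∈ toList (triples js)) (trans (cong (ρ ⟨_⟩) e) (to-from p v)) (proj₂ (proj₂ (∈-triples js l))))
      apart′ (suc l) (suc l′) e = apart sp l l′ e

    greedy : ∀ b → (∃[ W ] Covers {b * 3} W) ⊎ (∃[ js ] Spread {b} js)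
    greedy zero = inj₂ ([] , record { inT = λ () ; inj = λ () ; apart = λ () })
    greedy (suc b) with greedy b
    -- Three copies of `x` only pad the cover to the required length.
    ... | inj₁ (W , cov) = inj₁ (x ∷ x ∷ x ∷ W , λ v t mv → there (there (there (cov v t mv))))
    ... | inj₂ (js , sp) with Fin.any? (λ v → T? v ×-dec (¬? (ρ ⟨ v ⟩ Fin.≟ v) ×-dec ¬? (v ∈? toList (triples js))))
    ...   | yes (v , t , mv , v∉) = inj₂ (v ∷ js , extend sp t mv v∉)
    ...   | no none = inj₁ (x ∷ x ∷ x ∷ triples js , λ v t mv → there (there (there (cov v t mv))))
      where
      cov : Covers (triples js)
      cov v t mv with v ∈? toList (triples js)
      ... | yes q = q
      ... | no v∉ = contradiction (v , t , mv , v∉) none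

  idMap : Map n
  idMap = tabMap (λ i → i) (λ i → i)

  idMap-perm : IsPerm idMap
  idMap-perm = tabMap-perm _ _ (λ _ → refl) (λ _ → refl)

  TwinsData : ℕ → Set
  TwinsData b = Fin n × Fin n × Vec (Fin n) (b * 3)

  twinsData : ∀ b → List (TwinsData b)
  twinsData b = cartesianProduct (allFin n) (cartesianProduct (allFin n) (words (allFin n) (b * 3)))

  shiftedData : ∀ b → List (ShiftedData b)
  shiftedData b = cartesianProduct (words (allFin n) b) (cartesianProduct (words (allFin n) b) (words (allFin n) n))

  -- Either `b` moved special vertices can be chosen away from each other's preimages, giving `b`
  -- rows of equations, or the greedy choice stops early and `b * 3` vertices cover all moved
  -- special vertices, giving twins. The second case is indexed by its short cover, since the few
  -- equations there cannot pay for all `n ^ n` maps.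
  nonrigid-cause : ∀ b G → ¬ Rigid G idMap →
    (∃[ d ] (d ∈ twinsData b × Twins d G)) ⊎ (∃[ d ] (d ∈ shiftedData b × Shifted d G))
  nonrigid-cause b G ¬rigid with any? (λ d → twins? d G) (twinsData b) | any? (λ d → shifted? d G) (shiftedData b)
  ... | yes a | _     = inj₁ (find a)
  ... | no _  | yes c = inj₂ (find c)
  ... | no ¬a | no ¬c = contradiction (All.tabulate λ {ρ} _ p c x → fixed ρ p c x) ¬rigid
    where
    fixed : ∀ ρ → IsPerm ρ → Cons G idMap ρ → ∀ x → ρ ⟨ x ⟩ ≡ x
    fixed ρ p c x with ρ ⟨ x ⟩ Fin.≟ x
    ... | yes e = e
    ... | no mv = contradiction (greedy b) λ { (inj₁ (W , cov)) → caseA W cov ; (inj₂ (js , sp)) → caseB js sp }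
      where
      open Greedy ρ p x
      c′ : ∀ i v → T i → T (ρ ⟨ i ⟩) ⊎ T (ρ ⟨ v ⟩) → adj G i v ≡ adj G (ρ ⟨ i ⟩) (ρ ⟨ v ⟩)
      c′ i v t t′ = trans (sym (cong₂ (adj G) (at-id i) (at-id v)))
        (trans (c i v t t′) (cong₂ (adj G) (at-id _) (at-id _)))
        where
        at-id : ∀ i → idMap ⟨ i ⟩ ≡ i
        at-id = tabMap-to (λ i → i) (λ i → i)
      caseA : ∀ W → Covers W → ⊥
      caseA W cov = ¬a (lose (∈-cartesianProduct⁺ (∈-allFin _) (∈-cartesianProduct⁺ (∈-allFin _) (∈-words _ ∈-allFin W)))
        ((λ e → mv (sym e)) , All.tabulate λ {v} v∈ → twin v (fresh-T v∈) (λ q → fresh-∉ v∈ (there (there q)))))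
        where
        twin : ∀ v → T v → v ∉ toList W → adj G x v ≡ adj G (ρ ⟨ x ⟩) v
        -- A fixed special `v` is special on both sides of the equation, so `Cons` applies even if
        -- `x` is ordinary.
        twin v t v∉ with ρ ⟨ v ⟩ Fin.≟ v
        ... | no mv′ = contradiction (cov v t mv′) v∉
        ... | yes e = trans (adj-sym G x v) (trans (c′ v x t (inj₁ (subst T (sym e) t)))
                (trans (cong (λ u → adj G u (ρ ⟨ x ⟩)) e) (adj-sym G v _)))
      caseB : ∀ js → Spread {b} js → ⊥
      caseB js sp = ¬c (lose {x = js , ks , proj₁ ρ} (∈-cartesianProduct⁺ (∈-words _ ∈-allFin js) (∈-cartesianProduct⁺ (∈-words _ ∈-allFin ks) (∈-words _ ∈-allFin (proj₁ ρ))))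
        ( ( (λ l l′ e → inj sp l l′ (perm-injective⁻¹ ρ p (trans (sym (ks-at l)) (trans e (ks-at l′)))))
          , (λ l l′ e → apart sp l l′ (trans e (ks-at l′))) )
        , All.tabulate λ {y} y∈ → shift (proj₁ y) (proj₂ y) (fresh-T (proj₂ (∈-cartesianProduct⁻ (allFin b) (fresh (toList js ++ toList ks)) y∈)))))
        where
        ks = Vec.map (ρ ⟨_⟩⁻¹) js
        ks-at : ∀ l → lookup ks l ≡ ρ ⟨ lookup js l ⟩⁻¹
        ks-at l = lookup-map l (ρ ⟨_⟩⁻¹) js
        ρks : ∀ l → ρ ⟨ lookup ks l ⟩ ≡ lookup js l
        ρks l = trans (cong (ρ ⟨_⟩) (ks-at l)) (to-from p _)
        shift : ∀ l i → T i → adj G (ρ ⟨ i ⟩) (lookup js l) ≡ adj G i (lookup ks l)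
        -- The image of `i` may be ordinary; what makes `Cons` applicable is that `lookup ks l` is
        -- sent to the special vertex `lookup js l`.
        shift l i t = sym (trans (c′ i (lookup ks l) t (inj₂ (subst T (sym (ρks l)) (inT sp l)))) (cong (adj G (ρ ⟨ i ⟩)) (ρks l)))

  -- Testing the given labelling is enough: a graph rigid in it has a valid labelling, hence a
  -- canonical one.
  nonrigid : ℕ
  nonrigid = ∑ (allGraphs n) (λ G → ⟦ ¬? (rigid? G idMap) ⟧)

  union-bound : ∀ {D : Set} (ds : List D) {E : D → Graph n → Set} (E? : ∀ d G → Dec (E d G)) {u v} →
    (∀ d → u * ∑ (allGraphs n) (λ G → ⟦ E? d G ⟧) ≤ v) →
    u * ∑ (allGraphs n) (λ G → ∑ ds (λ d → ⟦ E? d G ⟧)) ≤ length ds * v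
  union-bound ds E? {u} {v} h = begin
    u * ∑ (allGraphs n) (λ G → ∑ ds (λ d → ⟦ E? d G ⟧))    ≡⟨ cong (u *_) (∑-swap (allGraphs n) ds _) ⟩
    u * ∑ ds (λ d → ∑ (allGraphs n) (λ G → ⟦ E? d G ⟧))    ≡⟨ ∑-* ds u _ ⟨
    ∑ ds (λ d → u * ∑ (allGraphs n) (λ G → ⟦ E? d G ⟧))    ≤⟨ ∑-mono ds h ⟩
    ∑ ds (λ _ → v)                                         ≡⟨ ∑-const ds v ⟩
    length ds * v                                          ∎
    where open ≤-Reasoning

  length-twinsData : ∀ b → length (twinsData b) ≡ n ^ (2 + b * 3)
  length-twinsData b = trans (length-× _,_ (allFin n) _) (cong₂ _*_ (length-tabulate {n = n} (λ i → i))
    (trans (length-× _,_ (allFin n) (words (allFin n) (b * 3))) (cong₂ _*_ (length-tabulate {n = n} (λ i → i))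
      (trans (length-words (allFin n) (b * 3)) (cong (_^ (b * 3)) (length-tabulate {n = n} (λ i → i)))))))

  length-shiftedData : ∀ b → length (shiftedData b) ≡ n ^ (b + (b + n))
  length-shiftedData b = trans (length-× _,_ (words (allFin n) b) _) (trans (cong₂ _*_ (w b) (trans (length-× _,_ (words (allFin n) b) _)
     (trans (cong₂ _*_ (w b) (w n)) (sym (^-distribˡ-+-* n b n))))) (sym (^-distribˡ-+-* n b (b + n))))
    where
    w : ∀ k → length (words (allFin n) k) ≡ n ^ k
    w k = trans (length-words (allFin n) k) (cong (_^ k) (length-tabulate {n = n} (λ i → i)))

  -- Here `x` counts twins and `y` counts shifts. The powers of `n` are the numbers of possible
  -- witnesses; the second is dominated by the `n ^ n` value vectors.
  nonrigid-rare : ∀ b → ∃[ x ] ∃[ y ] (nonrigid ≤ x + y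
    × 2 ^ s * x ≤ n ^ (2 + b * 3) * (2 ^ (2 + b * 3) * 2 ^ (n C 2))
    × 2 ^ (b * s) * y ≤ n ^ (b + (b + n)) * (2 ^ (b * (b + b)) * 2 ^ (n C 2)))
  nonrigid-rare b = ∑ (allGraphs n) fA , ∑ (allGraphs n) fB ,
    ≤-trans (∑-mono (allGraphs n) point) (≤-reflexive (∑-+ (allGraphs n) fA fB)) ,
    subst (λ z → 2 ^ s * ∑ (allGraphs n) fA ≤ z * (2 ^ (2 + b * 3) * 2 ^ (n C 2))) (length-twinsData b) (union-bound (twinsData b) twins? {2 ^ s} twins-rare) ,
    subst (λ z → 2 ^ (b * s) * ∑ (allGraphs n) fB ≤ z * (2 ^ (b * (b + b)) * 2 ^ (n C 2))) (length-shiftedData b) (union-bound (shiftedData b) shifted? {2 ^ (b * s)} shifted-rare)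
    where
    fA fB : Graph n → ℕ
    fA G = ∑ (twinsData b) (λ d → ⟦ twins? d G ⟧)
    fB G = ∑ (shiftedData b) (λ d → ⟦ shifted? d G ⟧)
    point : ∀ G → ⟦ ¬? (rigid? G idMap) ⟧ ≤ fA G + fB G
    point G with rigid? G idMap
    ... | yes _ = z≤n
    ... | no ¬r with nonrigid-cause b G ¬r
    ...   | inj₁ (d , d∈ , e) = ≤-trans (≤-trans (≤-reflexive (sym (⟦⟧-yes (twins? d G) e))) (∑-member _ d∈)) (m≤m+n _ _)
    ...   | inj₂ (d , d∈ , e) = ≤-trans (≤-trans (≤-reflexive (sym (⟦⟧-yes (shifted? d G) e))) (∑-member _ d∈)) (m≤n+m _ _)

-- The code

%≡⇒∣ : ∀ q .{{_ : NonZero q}} a b → a % q ≡ b % q → pos q ∣ pos a -ℤ pos b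
%≡⇒∣ q a b e = dividesℤ (pos (a /ₙ q) -ℤ pos (b /ₙ q)) (begin
  pos a -ℤ pos b                                                        ≡⟨ cong₂ _-ℤ_ (split a) (split b) ⟩
  (pos (a % q) +ℤ pos (a /ₙ q) *ℤ pos q) -ℤ (pos (b % q) +ℤ pos (b /ₙ q) *ℤ pos q)  ≡⟨ cong (λ z → (pos z +ℤ pos (a /ₙ q) *ℤ pos q) -ℤ (pos (b % q) +ℤ pos (b /ₙ q) *ℤ pos q)) e ⟩
  (pos (b % q) +ℤ pos (a /ₙ q) *ℤ pos q) -ℤ (pos (b % q) +ℤ pos (b /ₙ q) *ℤ pos q)  ≡⟨ ring (pos (b % q)) (pos (a /ₙ q)) (pos (b /ₙ q)) (pos q) ⟩
  (pos (a /ₙ q) -ℤ pos (b /ₙ q)) *ℤ pos q                                   ∎)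
  where
  open ≡-Reasoning
  split : ∀ a → pos a ≡ pos (a % q) +ℤ pos (a /ₙ q) *ℤ pos q
  split a = trans (cong pos (m≡m%n+[m/n]*n a q)) (trans (ℤ.pos-+ (a % q) (a /ₙ q * q)) (cong (pos (a % q) +ℤ_) (ℤ.pos-* (a /ₙ q) q)))
  ring : ∀ r x y q → (r +ℤ x *ℤ q) -ℤ (r +ℤ y *ℤ q) ≡ (x -ℤ y) *ℤ q
  ring = ℤ-Solver.solve-∀

%-shift : ∀ q .{{_ : NonZero q}} {a b} → b ≤ a → q ∣ₙ a ∸ b → a % q ≡ b % q
%-shift q {b = b} b≤a (divides k e) =
  trans (cong (_% q) (trans (sym (m+[n∸m]≡n b≤a)) (cong (b +_) e))) ([m+kn]%n≡m%n b k q)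

∣⇒%≡ : ∀ q .{{_ : NonZero q}} a b → pos q ∣ pos a -ℤ pos b → a % q ≡ b % q
∣⇒%≡ q a b d with ≤-total b a
... | inj₁ b≤a = %-shift q b≤a (subst (q ∣ₙ_) (cong ∣_∣ (trans (ℤ.m-n≡m⊖n a b) (ℤ.⊖-≥ b≤a))) (∣⇒∣ᵤ d))
... | inj₂ a≤b = sym (%-shift q a≤b (subst (q ∣ₙ_)
  (trans (ℤ.∣i-j∣≡∣j-i∣ (pos a) (pos b)) (cong ∣_∣ (trans (ℤ.m-n≡m⊖n b a) (ℤ.⊖-≥ a≤b)))) (∣⇒∣ᵤ d)))

∣∧<⇒≡ : ∀ {q a b} → a < q → b < q → pos q ∣ pos a -ℤ pos b → a ≡ b
∣∧<⇒≡ {suc q} {a} {b} a<q b<q d = trans (sym (m<n⇒m%n≡m a<q)) (trans (∣⇒%≡ (suc q) a b d) (m<n⇒m%n≡m b<q))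

-- Euclid's lemma takes one factor `p` at a time, always from `a`.
prime-power-cancel : ∀ {p} → Prime p → ∀ j a d → ¬ p ∣ₙ d → p ^ j ∣ₙ a * d → p ^ j ∣ₙ a
prime-power-cancel pr zero a d ¬p _ = 1∣ a
prime-power-cancel {p} pr (suc j) a d ¬p pj∣ with euclidsLemma a d pr (∣-trans (m∣m*n (p ^ j)) pj∣)
... | inj₂ p∣d = contradiction p∣d ¬p
... | inj₁ (divides k refl) = subst (p ^ suc j ∣ₙ_) (*-comm p k)
  (*-monoʳ-∣ p (prime-power-cancel pr j k d ¬p (*-cancelˡ-∣ p {{prime⇒nonZero pr}} (subst (p ^ suc j ∣ₙ_) (rearr k p d) pj∣))))
  where
  rearr : ∀ k p d → k * p * d ≡ p * (k * d)
  rearr = solve-∀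

∑-update : {A : Set} {xs : List A} {f g : A → ℕ} {h : A} → Unique xs → h ∈ xs →
  (∀ k → k ≢ h → g k ≡ f k) → ∑ xs g + f h ≡ ∑ xs f + g h
∑-update {xs = x ∷ xs} {f} {g} {h} (x∉ ∷ u) (here refl) same =
  trans (cong (λ t → g h + t + f h) (rest xs (λ k∈ e → All.lookup x∉ k∈ (sym e)))) (rearr (g h) (∑ xs f) (f h))
  where
  rest : ∀ xs → (∀ {k} → k ∈ xs → k ≢ h) → ∑ xs g ≡ ∑ xs f
  rest [] _ = refl
  rest (y ∷ ys) ne = cong₂ _+_ (same y (ne (here refl))) (rest ys (λ k∈ → ne (there k∈)))
  rearr : ∀ a b c → a + b + c ≡ c + b + a
  rearr = solve-∀
∑-update {xs = x ∷ xs} {f} {g} {h} (x∉ ∷ u) (there h∈) same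
  rewrite same x (All.lookup x∉ h∈) = trans (+-assoc (f x) (∑ xs g) (f h))
    (trans (cong (f x +_) (∑-update u h∈ same)) (sym (+-assoc (f x) (∑ xs f) (g h))))

-- Bit vectors under exclusive or

infixl 6 _⊕_
_⊕_ : ∀ {m} → Vec Bool m → Vec Bool m → Vec Bool m
_⊕_ = zipWith _xor_

𝟎 : ∀ {m} → Vec Bool m
𝟎 = replicate _ false

⊕-self : ∀ {m} (u : Vec Bool m) → u ⊕ u ≡ 𝟎
⊕-self []      = refl
⊕-self (x ∷ u) = cong₂ _∷_ (Bool.xor-same x) (⊕-self u)

⊕-cancelˡ : ∀ {m} (u : Vec Bool m) {a b} → u ⊕ a ≡ u ⊕ b → a ≡ b
⊕-cancelˡ u {a} {b} e = trans (sym (undo a)) (trans (cong (u ⊕_) e) (undo b))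
  where
  undo : ∀ a → u ⊕ (u ⊕ a) ≡ a
  undo a = trans (sym (zipWith-assoc Bool.xor-assoc u u a))
    (trans (cong (_⊕ a) (⊕-self u)) (zipWith-identityˡ Bool.xor-identityˡ a))

bitVecs : ∀ m → List (Vec Bool m)
bitVecs = words (false ∷ true ∷ [])

bitVecs-unique : ∀ m → Unique (bitVecs m)
bitVecs-unique = words-unique (((λ ()) ∷ []) ∷ [] ∷ [])

∈-bitVecs : ∀ {m} (v : Vec Bool m) → v ∈ bitVecs m
∈-bitVecs = ∈-words _ λ { false → here refl ; true → there (here refl) }

select : ∀ {m} → Bool → Vec Bool m → Vec Bool m
select b a = if b then a else 𝟎

select-not : ∀ {m} b (a : Vec Bool m) → select (not b) a ≡ select b a ⊕ a
select-not false a = sym (zipWith-identityˡ Bool.xor-identityˡ a)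
select-not true  a = sym (⊕-self a)

⨁ : ∀ {m} → List (Vec Bool m) → (Vec Bool m → Bool) → Vec Bool m
⨁ []       x = 𝟎
⨁ (a ∷ as) x = select (x a) a ⊕ ⨁ as x

⨁-cong : ∀ {m} (as : List (Vec Bool m)) {x y : Vec Bool m → Bool} → (∀ {a} → a ∈ as → x a ≡ y a) → ⨁ as x ≡ ⨁ as y
⨁-cong []       h = refl
⨁-cong (a ∷ as) h = cong₂ (λ b u → select b a ⊕ u) (h (here refl)) (⨁-cong as (λ a∈ → h (there a∈)))

⨁-flip : ∀ {m} {as : List (Vec Bool m)} {x y : Vec Bool m → Bool} {a} → Unique as → a ∈ as →
  y a ≡ not (x a) → (∀ b → b ≢ a → y b ≡ x b) → ⨁ as y ≡ ⨁ as x ⊕ a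
⨁-flip {as = _ ∷ as} {x} {y} {a} (a∉ ∷ u) (here refl) fl same = begin
  select (y a) a ⊕ ⨁ as y          ≡⟨ cong₂ (λ b u → select b a ⊕ u) fl (⨁-cong as (λ b∈ → same _ (λ e → All.lookup a∉ b∈ (sym e)))) ⟩
  select (not (x a)) a ⊕ ⨁ as x    ≡⟨ cong (_⊕ ⨁ as x) (select-not (x a) a) ⟩
  select (x a) a ⊕ a ⊕ ⨁ as x      ≡⟨ zipWith-assoc Bool.xor-assoc _ a (⨁ as x) ⟩
  select (x a) a ⊕ (a ⊕ ⨁ as x)    ≡⟨ cong (select (x a) a ⊕_) (zipWith-comm Bool.xor-comm a (⨁ as x)) ⟩
  select (x a) a ⊕ (⨁ as x ⊕ a)    ≡⟨ zipWith-assoc Bool.xor-assoc _ (⨁ as x) a ⟨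
  select (x a) a ⊕ ⨁ as x ⊕ a      ∎
  where open ≡-Reasoning
⨁-flip {as = b ∷ as} {x} {y} {a} (b∉ ∷ u) (there a∈) fl same = begin
  select (y b) b ⊕ ⨁ as y          ≡⟨ cong₂ (λ c u → select c b ⊕ u) (same b (All.lookup b∉ a∈)) (⨁-flip u a∈ fl same) ⟩
  select (x b) b ⊕ (⨁ as x ⊕ a)    ≡⟨ zipWith-assoc Bool.xor-assoc _ (⨁ as x) a ⟨
  select (x b) b ⊕ ⨁ as x ⊕ a      ∎
  where open ≡-Reasoning

-- Bits are indexed by pairs (a , h).  The bits with a fixed h are condensed into
-- their Hamming syndrome u h, which one flip can change to any other value; the
-- values enc (u h) are then treated as symbols of a code over ℤ/Q.  Flipping a bit at
-- h that moves the symbol by d moves the colour by (d , h * d).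
module Code (m Q q p j : ℕ) {{_ : NonZero Q}} {{_ : NonZero q}} {{_ : NonZero p}}
  (p-prime : Prime p) (Q≡p^j : Q ≡ p ^ j) (Q∣q : Q ∣ₙ q) (2^m≤q : 2 ^ m ≤ q) where

  Bits : Set
  Bits = Vec Bool m → Fin Q → Bool

  -- The zero address is included, so that a block has exactly `2 ^ m` bits; flipping that bit
  -- leaves the syndrome unchanged.
  syndrome : Bits → Fin Q → Vec Bool m
  syndrome x h = ⨁ (bitVecs m) (λ a → x a h)

  total weighted : (Fin Q → Vec Bool m) → ℕ
  total    u = ∑ (allFin Q) (λ h → enc (u h))
  weighted u = ∑ (allFin Q) (λ h → toℕ h * enc (u h))

  -- Two check values for one changed symbol: the first records the displacement, the second the
  -- displacement times the position.
  colour : Bits → ℕ × ℕ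
  colour x = total (syndrome x) % q , weighted (syndrome x) % Q

  colour-cong : ∀ {x y : Bits} → (∀ a h → x a h ≡ y a h) → colour x ≡ colour y
  colour-cong {x} {y} e = cong₂ _,_ (cong (_% q) (∑-cong (allFin Q) λ h → cong enc (s h)))
                            (cong (_% Q) (∑-cong (allFin Q) λ h → cong (λ u → toℕ h * enc u) (s h)))
    where
    s : ∀ h → syndrome x h ≡ syndrome y h
    s h = ⨁-cong (bitVecs m) (λ {a} _ → e a h)

  colours : List (ℕ × ℕ)
  colours = cartesianProduct (upTo q) (upTo Q)

  colour-∈ : ∀ x → colour x ∈ colours
  colour-∈ x = ∈-cartesianProduct⁺ (∈-upTo⁺ (m%n<n _ q)) (∈-upTo⁺ (m%n<n _ Q))

  record Flip (x y : Bits) (a : Vec Bool m) (h : Fin Q) : Set where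
    field
      flipped : y a h ≡ not (x a h)
      kept    : ∀ b k → ¬ (b ≡ a × k ≡ h) → y b k ≡ x b k

  open Flip

  moved : Bits → Vec Bool m → Fin Q → ℕ
  moved x a h = enc (syndrome x h ⊕ a)

  -- The displacement of the symbol is divisible by `p`, so it may fail to be invertible modulo `Q`.
  NonUnit : Bits → Vec Bool m → Fin Q → Set
  NonUnit x a h = moved x a h % p ≡ enc (syndrome x h) % p

  nonUnit? : ∀ x a h → Dec (NonUnit x a h)
  nonUnit? x a h = _ ℕ.≟ _

  -- As `a` varies the new symbols are distinct integers below `2 ^ m`, and those in one residue
  -- class modulo `p` are told apart by their quotients.
  nonUnit-rare : ∀ x h → ∑ (bitVecs m) (λ a → ⟦ nonUnit? x a h ⟧) ≤ suc (2 ^ m /ₙ p)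
  nonUnit-rare x h = begin
    ∑ (bitVecs m) (λ a → ⟦ nonUnit? x a h ⟧)
      ≤⟨ ∑-injection (bitVecs m) (upTo (suc (2 ^ m /ₙ p))) (λ a → ⟦ nonUnit? x a h ⟧) (λ _ → 1) (λ a → moved x a h /ₙ p) (bitVecs-unique m)
           (λ {a} _ _ → ∈-upTo⁺ (s≤s (/-monoˡ-≤ p (<⇒≤ (enc<2^k (syndrome x h ⊕ a))))))
           (λ {a} {b} _ _ na nb e → ⊕-cancelˡ (syndrome x h) (enc-injective _ _ (same a b (⟦⟧≢0 (nonUnit? x a h) na) (⟦⟧≢0 (nonUnit? x b h) nb) e)))
           (λ a → ⟦⟧≤1 (nonUnit? x a h)) ⟩
    ∑ (upTo (suc (2 ^ m /ₙ p))) (λ _ → 1)     ≡⟨ ∑-1 (upTo (suc (2 ^ m /ₙ p))) ⟩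
    length (upTo (suc (2 ^ m /ₙ p)))          ≡⟨ length-upTo _ ⟩
    suc (2 ^ m /ₙ p)                          ∎
    where
    open ≤-Reasoning
    same : ∀ a b → NonUnit x a h → NonUnit x b h → moved x a h /ₙ p ≡ moved x b h /ₙ p → moved x a h ≡ moved x b h
    same a b na nb e = trans (m≡m%n+[m/n]*n _ p) (trans (cong₂ (λ r k → r + k * p) (trans na (sym nb)) e) (sym (m≡m%n+[m/n]*n _ p)))

  module _ {x y : Bits} {a : Vec Bool m} {h : Fin Q} (fl : Flip x y a h) where

    Δ : ℤ
    Δ = pos (moved x a h) -ℤ pos (enc (syndrome x h))

    private
      syn-at : syndrome y h ≡ syndrome x h ⊕ a
      syn-at = ⨁-flip (bitVecs-unique m) (∈-bitVecs a) (flipped fl) (λ b ne → kept fl b h (λ (e , _) → ne e))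

      syn-off : ∀ k → k ≢ h → syndrome y k ≡ syndrome x k
      syn-off k ne = ⨁-cong (bitVecs m) (λ {b} _ → kept fl b k (λ (_ , e) → ne e))

      solveΔ : ∀ w′ w u v → w′ + u ≡ w + v → pos w′ ≡ pos w +ℤ (pos v -ℤ pos u)
      solveΔ w′ w u v e = trans (ring (pos w′) (pos u)) (trans (cong (_-ℤ pos u) (trans (sym (ℤ.pos-+ w′ u)) (trans (cong pos e) (ℤ.pos-+ w v)))) (ℤ.+-assoc (pos w) (pos v) (neg (pos u))))
        where
        ring : ∀ a b → a ≡ (a +ℤ b) -ℤ b
        ring = ℤ-Solver.solve-∀

    total-flip : pos (total (syndrome y)) ≡ pos (total (syndrome x)) +ℤ Δ
    total-flip = solveΔ (total (syndrome y)) (total (syndrome x)) _ _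
      (trans (∑-update {f = λ k → enc (syndrome x k)} (Uniq.allFin⁺ Q) (∈-allFin h) (λ k ne → cong enc (syn-off k ne)))
             (cong (λ u → total (syndrome x) + enc u) syn-at))

    weighted-flip : pos (weighted (syndrome y)) ≡ pos (weighted (syndrome x)) +ℤ pos (toℕ h) *ℤ Δ
    weighted-flip = trans (solveΔ (weighted (syndrome y)) (weighted (syndrome x)) (toℕ h * enc (syndrome x h)) (toℕ h * moved x a h)
      (trans (∑-update {f = λ k → toℕ k * enc (syndrome x k)} (Uniq.allFin⁺ Q) (∈-allFin h) (λ k ne → cong (λ u → toℕ k * enc u) (syn-off k ne)))
             (cong (λ u → weighted (syndrome x) + toℕ h * enc u) syn-at)))
      (cong (pos (weighted (syndrome x)) +ℤ_) (trans (cong₂ _-ℤ_ (ℤ.pos-* (toℕ h) (moved x a h)) (ℤ.pos-* (toℕ h) (enc (syndrome x h)))) (ring (pos (toℕ h)) (pos (moved x a h)) (pos (enc (syndrome x h))))))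
      where
      ring : ∀ h v u → h *ℤ v -ℤ h *ℤ u ≡ h *ℤ (v -ℤ u)
      ring = ℤ-Solver.solve-∀

  -- The totals give `D ≡ E` modulo `q`. As `Q` divides `q`, the weighted totals then give
  -- `(H - K) D ≡ 0` modulo `Q`, and since `p` does not divide `D` the positions agree. Finally
  -- `D ≡ E` modulo `q`, with symbols below `2 ^ m ≤ q`, recovers the address. Only the first
  -- displacement is asked to be a unit.
  colour-injective : ∀ {x y z : Bits} {a h b k} → Flip x y a h → Flip x z b k → ¬ NonUnit x a h →
    colour y ≡ colour z → (a , h) ≡ (b , k)
  colour-injective {x} {y} {z} {a} {h} {b} {k} fy fz unit same = done h≡k
    where
    D E H K : ℤ
    D = Δ fy
    E = Δ fz
    H = pos (toℕ h)
    K = pos (toℕ k)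
    q∣D-E : pos q ∣ D -ℤ E
    q∣D-E = subst (pos q ∣_) (trans (cong₂ _-ℤ_ (total-flip fy) (total-flip fz)) (ring (pos (total (syndrome x))) D E))
              (%≡⇒∣ q _ _ (cong proj₁ same))
      where
      ring : ∀ w d e → (w +ℤ d) -ℤ (w +ℤ e) ≡ d -ℤ e
      ring = ℤ-Solver.solve-∀
    Q∣hD-kE : pos Q ∣ H *ℤ D -ℤ K *ℤ E
    Q∣hD-kE = subst (pos Q ∣_) (trans (cong₂ _-ℤ_ (weighted-flip fy) (weighted-flip fz)) (ring (pos (weighted (syndrome x))) (H *ℤ D) (K *ℤ E)))
              (%≡⇒∣ Q _ _ (cong proj₂ same))
      where
      ring : ∀ w d e → (w +ℤ d) -ℤ (w +ℤ e) ≡ d -ℤ e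
      ring = ℤ-Solver.solve-∀
    Q∣[h-k]D : pos Q ∣ (H -ℤ K) *ℤ D
    Q∣[h-k]D = subst (pos Q ∣_) (ring H K D E) (∣m∣n⇒∣m-n Q∣hD-kE (∣n⇒∣m*n K (∣ℤ-trans (∣ᵤ⇒∣ Q∣q) q∣D-E)))
      where
      ring : ∀ h k d e → (h *ℤ d -ℤ k *ℤ e) -ℤ k *ℤ (d -ℤ e) ≡ (h -ℤ k) *ℤ d
      ring = ℤ-Solver.solve-∀
    Q∣h-k : pos Q ∣ H -ℤ K
    Q∣h-k = ∣ᵤ⇒∣ (subst (_∣ₙ ∣ H -ℤ K ∣) (sym Q≡p^j) (prime-power-cancel p-prime j ∣ H -ℤ K ∣ ∣ D ∣
      (λ p∣D → unit (∣⇒%≡ p _ _ (∣ᵤ⇒∣ p∣D)))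
      (subst (_∣ₙ ∣ H -ℤ K ∣ * ∣ D ∣) Q≡p^j (subst (Q ∣ₙ_) (ℤ.abs-* (H -ℤ K) D) (∣⇒∣ᵤ Q∣[h-k]D)))))
    h≡k : h ≡ k
    h≡k = Fin.toℕ-injective (∣∧<⇒≡ (Fin.toℕ<n h) (Fin.toℕ<n k) Q∣h-k)
    done : h ≡ k → (a , h) ≡ (b , k)
    done refl = cong (_, h) (⊕-cancelˡ (syndrome x h) (enc-injective _ _
      (∣∧<⇒≡ (<-≤-trans (enc<2^k (syndrome x h ⊕ a)) 2^m≤q) (<-≤-trans (enc<2^k (syndrome x h ⊕ b)) 2^m≤q)
        (subst (pos q ∣_) (ring (pos (moved x a h)) (pos (moved x b h)) (pos (enc (syndrome x h)))) q∣D-E))))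
      where
      ring : ∀ v w u → (v -ℤ u) -ℤ (w -ℤ u) ≡ v -ℤ w
      ring = ℤ-Solver.solve-∀

-- Colouring graphs

module Covering (n s : ℕ) (s≤n : s ≤ n) (m Q q p j : ℕ) {{_ : NonZero Q}} {{_ : NonZero q}} {{_ : NonZero p}}
  (p-prime : Prime p) (Q≡p^j : Q ≡ p ^ j) (Q∣q : Q ∣ₙ q) (2^m≤q : 2 ^ m ≤ q)
  (slot : Vec Bool m × Fin Q → Fin n × Fin n)
  (slot-high : ∀ x → (s ≤ toℕ (proj₁ (slot x))) × (s ≤ toℕ (proj₂ (slot x))))
  (slot-loop : ∀ x → proj₁ (slot x) ≢ proj₂ (slot x))
  (slot-inj : ∀ x y → SameEdge (proj₁ (slot x)) (proj₂ (slot x)) (proj₁ (slot y)) (proj₂ (slot y)) → x ≡ y)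
  where

  open Labelling n s public
  open Rarity n s s≤n public
  open Code m Q q p j p-prime Q≡p^j Q∣q 2^m≤q

  N M tot : ℕ
  N = n C 2
  M = q * Q
  tot = 2 ^ N

  Gs : List (Graph n)
  Gs = allGraphs n

  slots : (Fin n → Fin n → Bool) → Bits
  slots g a h = g (proj₁ (slot (a , h))) (proj₂ (slot (a , h)))

  graphColour : (Fin n → Fin n → Bool) → ℕ × ℕ
  graphColour g = colour (slots g)

  open Colouring graphColour (λ e → colour-cong (λ a h → e _ _))

  S? : ∀ G t → Dec (S G ≡ just t)
  S? G t = Maybe-≡-dec (×-≡-dec ℕ._≟_ ℕ._≟_) (S G) (just t)

  Touched : Graph n → Fin n → Fin n → Set
  Touched G i j with best G
  ... | inj₁ _       = ⊥
  ... | inj₂ (π , _) = T (π ⟨ i ⟩⁻¹) ⊎ T (π ⟨ j ⟩⁻¹)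

  touched? : ∀ G i j → Dec (Touched G i j)
  touched? G i j with best G
  ... | inj₁ _       = no λ ()
  ... | inj₂ (π , _) = T? (π ⟨ i ⟩⁻¹) ⊎-dec T? (π ⟨ j ⟩⁻¹)

  Seen : Graph n → ℕ × ℕ → Set
  Seen G t = Any (λ (i , j) → S (toggle i j G) ≡ just t) (edges n)

  seen? : ∀ G t → Dec (Seen G t)
  seen? G t = any? (λ (i , j) → S? (toggle i j G) t) (edges n)

  pairs : List (Fin n × Fin n)
  pairs = cartesianProduct (allFin n) (allFin n)

  -- The labelling meant here is that of the graph after the flip, which may have made the flipped
  -- pair special. No bound is claimed for a single graph, only for the sum over all graphs.
  disturbed : Graph n → ℕ
  disturbed G = ∑ pairs (λ (i , j) → ⟦ touched? (toggle i j G) i j ⟧)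

  -- If the pair avoids the special labels before and after the flip, each canonical labelling
  -- competes in the other graph with its window unchanged, so the labels stay the same.
  toggle-S : ∀ {G π i j} → Best G π → Free π i j → ¬ Touched (toggle i j G) i j →
    S (toggle i j G) ≡ just (graphColour (relabel (toggle i j G) π))
  toggle-S {G} {π} {i} {j} b@((p , r) , _) fr nt with best (toggle i j G)
  ... | inj₁ none = contradiction (p , rigid-agree (agree-toggle p fr) r) (none π)
  ... | inj₂ (π′ , b′) = cong just (colour-cong λ a h → cong₂ (adj (toggle i j G)) (same _) (same _))
    where
    same : ∀ a → π′ ⟨ a ⟩ ≡ π ⟨ a ⟩
    same = best-toggle b b′ fr ((λ t → nt (inj₁ t)) , (λ t → nt (inj₂ t)))

  index : List (Vec Bool m × Fin Q)
  index = cartesianProduct (bitVecs m) (allFin Q)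

  index-unique : Unique index
  index-unique = Uniq.cartesianProduct⁺ (bitVecs-unique m) (Uniq.allFin⁺ Q)

  length-index : length index ≡ 2 ^ m * Q
  length-index = trans (length-× _,_ (bitVecs m) (allFin Q))
    (cong₂ _*_ (length-words (false ∷ true ∷ []) m) (length-tabulate {n = Q} (λ i → i)))

  module Labelled (G : Graph n) (π : Map n) (b : Best G π) where

    π-perm : IsPerm π
    π-perm = proj₁ (proj₁ b)

    place : Vec Bool m × Fin Q → Fin n × Fin n
    place x = π ⟨ proj₁ (slot x) ⟩ , π ⟨ proj₂ (slot x) ⟩

    move : Vec Bool m × Fin Q → Graph n
    move x = toggle (proj₁ (place x)) (proj₂ (place x)) G

    place-loop : ∀ x → proj₁ (place x) ≢ proj₂ (place x)
    place-loop x e = slot-loop x (perm-injective π π-perm e)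

    place-free : ∀ x → Free π (proj₁ (place x)) (proj₂ (place x))
    place-free x = (λ t → <⇒≱ (subst T (from-to π-perm _) t) (proj₁ (slot-high x)))
                 , (λ t → <⇒≱ (subst T (from-to π-perm _) t) (proj₂ (slot-high x)))

    before : Bits
    before = slots (relabel G π)

    flip : ∀ x → Flip before (slots (relabel (move x) π)) (proj₁ x) (proj₂ x)
    flip x = record
      { flipped = adj-toggle _ _ G (place-loop x)
      ; kept    = λ c k ne → adj-toggle-other _ _ G _ _ λ e → ne (both (slot-inj (c , k) x (unplace e)))
      }
      where
      both : ∀ {c k} → (c , k) ≡ x → c ≡ proj₁ x × k ≡ proj₂ x
      both refl = refl , refl
      unplace : ∀ {u v u′ v′} → SameEdge (π ⟨ u ⟩) (π ⟨ v ⟩) (π ⟨ u′ ⟩) (π ⟨ v′ ⟩) → SameEdge u v u′ v′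
      unplace (inj₁ (e , f)) = inj₁ (perm-injective π π-perm e , perm-injective π π-perm f)
      unplace (inj₂ (e , f)) = inj₂ (perm-injective π π-perm e , perm-injective π π-perm f)

    nu? : ∀ x → Dec (NonUnit before (proj₁ x) (proj₂ x))
    nu? x = nonUnit? before (proj₁ x) (proj₂ x)

    to? : ∀ x → Dec (Touched (move x) (proj₁ (place x)) (proj₂ (place x)))
    to? x = touched? (move x) (proj₁ (place x)) (proj₂ (place x))

    good? : ∀ x → Dec (¬ NonUnit before (proj₁ x) (proj₂ x) × ¬ Touched (move x) (proj₁ (place x)) (proj₂ (place x)))
    good? x = ¬? (nu? x) ×-dec ¬? (to? x)

    target : Vec Bool m × Fin Q → ℕ × ℕ
    target x = graphColour (relabel (move x) π)

    good-seen : ∀ x → ¬ Touched (move x) (proj₁ (place x)) (proj₂ (place x)) → Seen G (target x)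
    good-seen x nt with ∈-edges (proj₁ (place x)) (proj₂ (place x)) (place-loop x)
    ... | inj₁ e∈ = lose e∈ (toggle-S b (place-free x) nt)
    ... | inj₂ e∈ = lose e∈ (trans (cong S (toggle-sym _ _ G)) (toggle-S b (place-free x) nt))

    ∑-good : ∑ index (λ x → ⟦ good? x ⟧) ≤ ∑ colours (λ t → ⟦ seen? G t ⟧)
    ∑-good = ∑-injection index colours (λ x → ⟦ good? x ⟧) (λ t → ⟦ seen? G t ⟧) target index-unique
      (λ _ _ → colour-∈ _)
      (λ {x} {y} _ _ gx gy e → colour-injective (flip x) (flip y) (proj₁ (⟦⟧≢0 (good? x) gx)) e)
      (λ x → ⟦⟧-mono (λ (_ , nt) → good-seen x nt) (good? x) (seen? G (target x)))

    ∑-nonUnit : ∑ index (λ x → ⟦ nu? x ⟧) ≤ Q * suc (2 ^ m /ₙ p)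
    ∑-nonUnit = begin
      ∑ index (λ x → ⟦ nu? x ⟧)                                             ≡⟨ ∑-cartesianProduct (bitVecs m) (allFin Q) _ ⟩
      ∑ (bitVecs m) (λ a → ∑ (allFin Q) (λ h → ⟦ nonUnit? before a h ⟧))    ≡⟨ ∑-swap (bitVecs m) (allFin Q) _ ⟩
      ∑ (allFin Q) (λ h → ∑ (bitVecs m) (λ a → ⟦ nonUnit? before a h ⟧))    ≤⟨ ∑-mono (allFin Q) (nonUnit-rare before) ⟩
      ∑ (allFin Q) (λ _ → suc (2 ^ m /ₙ p))                                  ≡⟨ ∑-const (allFin Q) _ ⟩
      length (allFin Q) * suc (2 ^ m /ₙ p)                                   ≡⟨ cong (_* suc (2 ^ m /ₙ p)) (length-tabulate {n = Q} (λ i → i)) ⟩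
      Q * suc (2 ^ m /ₙ p)                                                   ∎
      where open ≤-Reasoning

    ∑-touched : ∑ index (λ x → ⟦ to? x ⟧) ≤ disturbed G
    ∑-touched = ∑-injection index pairs (λ x → ⟦ to? x ⟧) (λ (i , j) → ⟦ touched? (toggle i j G) i j ⟧) place index-unique
      (λ _ _ → ∈-cartesianProduct⁺ (∈-allFin _) (∈-allFin _))
      (λ {x} {y} _ _ _ _ e → slot-inj x y (inj₁ (perm-injective π π-perm (cong proj₁ e) , perm-injective π π-perm (cong proj₂ e))))
      (λ x → ≤-refl)

    -- A code position is good, or has a nonunit displacement, or is disturbed by relabelling; the
    -- good ones show distinct colours.
    many-seen : 2 ^ m * Q ≤ ∑ colours (λ t → ⟦ seen? G t ⟧) + (Q * suc (2 ^ m /ₙ p) + disturbed G)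
    many-seen = begin
      2 ^ m * Q                                                           ≡⟨ length-index ⟨
      length index                                                        ≡⟨ ∑-1 index ⟨
      ∑ index (λ _ → 1)                                                   ≤⟨ ∑-mono index trichotomy ⟩
      ∑ index (λ x → ⟦ good? x ⟧ + (⟦ nu? x ⟧ + ⟦ to? x ⟧))               ≡⟨ ∑-+ index (λ x → ⟦ good? x ⟧) (λ x → ⟦ nu? x ⟧ + ⟦ to? x ⟧) ⟩
      ∑ index (λ x → ⟦ good? x ⟧) + ∑ index (λ x → ⟦ nu? x ⟧ + ⟦ to? x ⟧) ≡⟨ cong (∑ index (λ x → ⟦ good? x ⟧) +_) (∑-+ index (λ x → ⟦ nu? x ⟧) (λ x → ⟦ to? x ⟧)) ⟩
      ∑ index (λ x → ⟦ good? x ⟧) + (∑ index (λ x → ⟦ nu? x ⟧) + ∑ index (λ x → ⟦ to? x ⟧)) ≤⟨ +-mono-≤ ∑-good (+-mono-≤ ∑-nonUnit ∑-touched) ⟩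
      ∑ colours (λ t → ⟦ seen? G t ⟧) + (Q * suc (2 ^ m /ₙ p) + disturbed G) ∎
      where
      open ≤-Reasoning
      trichotomy : ∀ x → 1 ≤ ⟦ good? x ⟧ + (⟦ nu? x ⟧ + ⟦ to? x ⟧)
      trichotomy x with nu? x | to? x
      ... | yes _ | yes _ = s≤s z≤n
      ... | yes _ | no _  = s≤s z≤n
      ... | no _  | yes _ = s≤s z≤n
      ... | no _  | no _  = s≤s z≤n

  length-colours : length colours ≡ M
  length-colours = trans (length-× _,_ (upTo q) (upTo Q)) (cong₂ _*_ (length-upTo q) (length-upTo Q))

  seen+unseen : ∀ G → ∑ colours (λ t → ⟦ seen? G t ⟧) + ∑ colours (λ t → ⟦ ¬? (seen? G t) ⟧) ≡ M
  seen+unseen G = begin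
    ∑ colours (λ t → ⟦ seen? G t ⟧) + ∑ colours (λ t → ⟦ ¬? (seen? G t) ⟧) ≡⟨ ∑-+ colours (λ t → ⟦ seen? G t ⟧) (λ t → ⟦ ¬? (seen? G t) ⟧) ⟨
    ∑ colours (λ t → ⟦ seen? G t ⟧ + ⟦ ¬? (seen? G t) ⟧)                   ≡⟨ ∑-cong colours one ⟩
    ∑ colours (λ _ → 1)                                                    ≡⟨ ∑-1 colours ⟩
    length colours                                                         ≡⟨ length-colours ⟩
    M                                                                      ∎
    where
    open ≡-Reasoning
    one : ∀ t → ⟦ seen? G t ⟧ + ⟦ ¬? (seen? G t) ⟧ ≡ 1
    one t with seen? G t
    ... | yes _ = refl
    ... | no _  = refl

  -- The unseen colours are paid for by the excess of `M` over the code length and by the lost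
  -- positions. A graph without a canonical labelling may miss all `M` colours; this is charged to
  -- the last term, because in particular its identity labelling is not rigid.
  few-unseen : ∀ G → ∑ colours (λ t → ⟦ ¬? (seen? G t) ⟧) + 2 ^ m * Q ≤
    (M + Q * suc (2 ^ m /ₙ p)) + (disturbed G + M * ⟦ ¬? (rigid? G idMap) ⟧)
  few-unseen G with best G
  ... | inj₂ (π , b) = begin
    un + 2 ^ m * Q                                           ≤⟨ +-monoʳ-≤ un (Labelled.many-seen G π b) ⟩
    un + (se + (Q * suc (2 ^ m /ₙ p) + disturbed G))          ≡⟨ rearr un se (Q * suc (2 ^ m /ₙ p)) (disturbed G) ⟩
    (se + un) + Q * suc (2 ^ m /ₙ p) + disturbed G            ≡⟨ cong (λ z → z + Q * suc (2 ^ m /ₙ p) + disturbed G) (seen+unseen G) ⟩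
    M + Q * suc (2 ^ m /ₙ p) + disturbed G                    ≤⟨ +-monoʳ-≤ (M + Q * suc (2 ^ m /ₙ p)) (m≤m+n (disturbed G) _) ⟩
    _                                                        ∎
    where
    open ≤-Reasoning
    se = ∑ colours (λ t → ⟦ seen? G t ⟧)
    un = ∑ colours (λ t → ⟦ ¬? (seen? G t) ⟧)
    rearr : ∀ a b c d → a + (b + (c + d)) ≡ b + a + c + d
    rearr = solve-∀
  ... | inj₁ none with rigid? G idMap
  ...   | yes r = contradiction (idMap-perm , r) (none idMap)
  ...   | no _  = begin
    un + 2 ^ m * Q                                           ≤⟨ +-mono-≤ (≤-trans (m≤n+m un se) (≤-reflexive (seen+unseen G))) (*-monoˡ-≤ Q 2^m≤q) ⟩
    M + M                                                    ≤⟨ +-mono-≤ (m≤m+n M _) (≤-trans (≤-reflexive (sym (*-identityʳ M))) (m≤n+m (M * 1) (disturbed G))) ⟩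
    (M + Q * suc (2 ^ m /ₙ p)) + (disturbed G + M * 1)        ∎
    where
    open ≤-Reasoning
    se = ∑ colours (λ t → ⟦ seen? G t ⟧)
    un = ∑ colours (λ t → ⟦ ¬? (seen? G t) ⟧)

  touched-rare : ∀ G → ∑ pairs (λ (i , j) → ⟦ touched? G i j ⟧) ≤ 2 * (s * n)
  touched-rare G with best G
  ... | inj₁ _ = ≤-trans (≤-reflexive (trans (∑-const pairs 0) (*-zeroʳ (length pairs)))) z≤n
  ... | inj₂ (π , ((pp , _) , _)) = begin
    ∑ pairs (λ (i , j) → ⟦ t? i ⊎-dec t? j ⟧)                     ≤⟨ ∑-mono pairs (λ (i , j) → either (t? i) (t? j)) ⟩
    ∑ pairs (λ (i , j) → ⟦ t? i ⟧ + ⟦ t? j ⟧)                     ≡⟨ ∑-+ pairs (λ (i , _) → ⟦ t? i ⟧) (λ (_ , j) → ⟦ t? j ⟧) ⟩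
    ∑ pairs (λ (i , _) → ⟦ t? i ⟧) + ∑ pairs (λ (_ , j) → ⟦ t? j ⟧) ≡⟨ cong₂ _+_
        (trans (∑-cartesianProduct (allFin n) (allFin n) _) (∑-swap (allFin n) (allFin n) (λ i _ → ⟦ t? i ⟧)))
        (∑-cartesianProduct (allFin n) (allFin n) _) ⟩
    ∑ (allFin n) (λ _ → X) + ∑ (allFin n) (λ _ → X)               ≡⟨ cong₂ _+_ (∑-const (allFin n) X) (∑-const (allFin n) X) ⟩
    length (allFin n) * X + length (allFin n) * X                 ≡⟨ cong (λ z → z * X + z * X) (length-tabulate {n = n} (λ i → i)) ⟩
    n * X + n * X                                                 ≤⟨ +-mono-≤ (*-monoʳ-≤ n X≤s) (*-monoʳ-≤ n X≤s) ⟩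
    n * s + n * s                                                 ≡⟨ ring n s ⟩
    2 * (s * n)                                                   ∎
    where
    open ≤-Reasoning
    t? : ∀ i → Dec (T (π ⟨ i ⟩⁻¹))
    t? i = T? (π ⟨ i ⟩⁻¹)
    X = ∑ (allFin n) (λ i → ⟦ t? i ⟧)
    either : {P R : Set} (a : Dec P) (b : Dec R) → ⟦ a ⊎-dec b ⟧ ≤ ⟦ a ⟧ + ⟦ b ⟧
    either (yes _) _       = s≤s z≤n
    either (no _)  (yes _) = s≤s z≤n
    either (no _)  (no _)  = z≤n
    ring : ∀ n s → n * s + n * s ≡ 2 * (s * n)
    ring = solve-∀
    X≤s : X ≤ s
    X≤s = begin
      X                        ≤⟨ ∑-injection (allFin n) (upTo s) (λ i → ⟦ t? i ⟧) (λ _ → 1) (λ i → toℕ (π ⟨ i ⟩⁻¹)) (Uniq.allFin⁺ n)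
                                    (λ {i} _ ne → ∈-upTo⁺ (⟦⟧≢0 (t? i) ne))
                                    (λ _ _ _ _ e → perm-injective⁻¹ π pp (Fin.toℕ-injective e)) (λ i → ⟦⟧≤1 (t? i)) ⟩
      ∑ (upTo s) (λ _ → 1)     ≡⟨ ∑-1 (upTo s) ⟩
      length (upTo s)          ≡⟨ length-upTo s ⟩
      s                        ∎

  ∑-Gs-const : ∀ c → ∑ Gs (λ _ → c) ≡ c * tot
  ∑-Gs-const c = trans (∑-cong Gs (λ _ → sym (*-identityʳ c))) (trans (∑-* Gs c (λ _ → 1)) (cong (c *_) (∑-allGraphs-1 n)))

  -- For each pair, `∑-toggle` replaces the graph after the flip by an arbitrary graph. In its own
  -- canonical labelling `s` vertices are special, and they meet at most `2 * (s * n)` ordered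
  -- pairs.
  ∑-disturbed : ∑ Gs disturbed ≤ 2 * (s * n) * tot
  ∑-disturbed = begin
    ∑ Gs disturbed                                                        ≡⟨ ∑-swap Gs pairs _ ⟩
    ∑ pairs (λ (i , j) → ∑ Gs (λ G → ⟦ touched? (toggle i j G) i j ⟧))    ≡⟨ ∑-cong pairs (λ (i , j) → ∑-toggle i j (λ G → ⟦ touched? G i j ⟧)) ⟩
    ∑ pairs (λ (i , j) → ∑ Gs (λ G → ⟦ touched? G i j ⟧))                 ≡⟨ ∑-swap Gs pairs (λ G (i , j) → ⟦ touched? G i j ⟧) ⟨
    ∑ Gs (λ G → ∑ pairs (λ (i , j) → ⟦ touched? G i j ⟧))                 ≤⟨ ∑-mono Gs touched-rare ⟩
    ∑ Gs (λ _ → 2 * (s * n))                                              ≡⟨ ∑-Gs-const (2 * (s * n)) ⟩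
    2 * (s * n) * tot                                                     ∎
    where open ≤-Reasoning

  a u : ℕ × ℕ → ℕ
  a t = ∑ Gs (λ G → ⟦ S? G t ⟧)
  u t = ∑ Gs (λ G → ⟦ ¬? (seen? G t) ⟧)

  Δtot : ℕ
  Δtot = ∑ colours u

  Δtot-bound : Δtot + 2 ^ m * Q * tot ≤ (M + Q * suc (2 ^ m /ₙ p)) * tot + (2 * (s * n) * tot + M * nonrigid)
  Δtot-bound = begin
    Δtot + 2 ^ m * Q * tot                                          ≡⟨ cong₂ _+_ (∑-swap colours Gs _) (sym (∑-Gs-const (2 ^ m * Q))) ⟩
    ∑ Gs un + ∑ Gs (λ _ → 2 ^ m * Q)                                ≡⟨ ∑-+ Gs un (λ _ → 2 ^ m * Q) ⟨
    ∑ Gs (λ G → un G + 2 ^ m * Q)                                   ≤⟨ ∑-mono Gs few-unseen ⟩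
    ∑ Gs (λ G → c + (disturbed G + M * nr G))                       ≡⟨ ∑-+ Gs (λ _ → c) (λ G → disturbed G + M * nr G) ⟩
    ∑ Gs (λ _ → c) + ∑ Gs (λ G → disturbed G + M * nr G)            ≡⟨ cong₂ _+_ (∑-Gs-const c) (∑-+ Gs disturbed (λ G → M * nr G)) ⟩
    c * tot + (∑ Gs disturbed + ∑ Gs (λ G → M * nr G))              ≡⟨ cong (λ z → c * tot + (∑ Gs disturbed + z)) (∑-* Gs M nr) ⟩
    c * tot + (∑ Gs disturbed + M * nonrigid)                       ≤⟨ +-monoʳ-≤ (c * tot) (+-monoˡ-≤ (M * nonrigid) ∑-disturbed) ⟩
    c * tot + (2 * (s * n) * tot + M * nonrigid)                    ∎
    where
    open ≤-Reasoning
    c = M + Q * suc (2 ^ m /ₙ p)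
    un nr : Graph n → ℕ
    un G = ∑ colours (λ t → ⟦ ¬? (seen? G t) ⟧)
    nr G = ⟦ ¬? (rigid? G idMap) ⟧

  colours-unique : Unique colours
  colours-unique = Uniq.cartesianProduct⁺ (Uniq.upTo⁺ q) (Uniq.upTo⁺ Q)

  ∑-a : ∑ colours a ≤ tot
  ∑-a = begin
    ∑ colours a                                      ≡⟨ ∑-swap colours Gs _ ⟩
    ∑ Gs (λ G → ∑ colours (λ t → ⟦ S? G t ⟧))        ≤⟨ ∑-mono Gs point ⟩
    ∑ Gs (λ _ → 1)                                   ≡⟨ ∑-allGraphs-1 n ⟩
    tot                                              ∎
    where
    open ≤-Reasoning
    point : ∀ G → ∑ colours (λ t → ⟦ S? G t ⟧) ≤ 1
    point G with S G
    ... | nothing = ≤-trans (≤-reflexive (trans (∑-const colours 0) (*-zeroʳ (length colours)))) z≤n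
    ... | just c  = ∑-injection colours (c ∷ []) (λ t → ⟦ d? t ⟧) (λ _ → 1) (λ t → t) colours-unique
                      (λ {t} _ ne → here (sym (just-injective (⟦⟧≢0 (d? t) ne)))) (λ _ _ _ _ e → e) (λ t → ⟦⟧≤1 (d? t))
      where
      d? : ∀ t → Dec (just c ≡ just t)
      d? t = Maybe-≡-dec (×-≡-dec ℕ._≟_ ℕ._≟_) (just c) (just t)

  -- One choice must control both the class and the graphs that miss it. Covering forces
  -- `M * a t + u t` to be nearly `tot` at least, so an average value of `M * a t + 2 * u t`, nearly
  -- `tot` at most, leaves little room for `u t`. With weight 1 instead of 2 nothing would follow
  -- about `u t`.
  some-colour : ∃[ t ] (M * (M * a t + 2 * u t) ≤ M * tot + 2 * Δtot)
  some-colour = proj₁ pick , (begin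
    M * Φ t₀                                                       ≡⟨ cong (_* Φ t₀) length-colours ⟨
    length colours * Φ t₀                                          ≤⟨ proj₂ (proj₂ pick) ⟩
    ∑ colours Φ                                                    ≡⟨ ∑-+ colours (λ t → M * a t) (λ t → 2 * u t) ⟩
    ∑ colours (λ t → M * a t) + ∑ colours (λ t → 2 * u t)          ≡⟨ cong₂ _+_ (∑-* colours M a) (∑-* colours 2 u) ⟩
    M * ∑ colours a + 2 * Δtot                                     ≤⟨ +-monoˡ-≤ (2 * Δtot) (*-monoʳ-≤ M ∑-a) ⟩
    M * tot + 2 * Δtot                                             ∎)
    where
    open ≤-Reasoning
    Φ : ℕ × ℕ → ℕ
    Φ t = M * a t + 2 * u t
    pick : ∃[ t ] (t ∈ colours × length colours * Φ t ≤ ∑ colours Φ)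
    pick = ∑-pick colours Φ (subst (0 <_) (sym length-colours) (>-nonZero⁻¹ M {{m*n≢0 q Q}}))
    t₀ = proj₁ pick

  module Property (t : ℕ × ℕ) where

    A : Graph n → Bool
    A G = ⌊ S? G t ⌋

    A-invariant : ∀ (σ : Fin n ↔ Fin n) G H →
      (∀ i j → adj H (Inverse.to σ i) (Inverse.to σ j) ≡ adj G i j) → A G ≡ A H
    A-invariant σ G H iso = cong (λ z → ⌊ Maybe-≡-dec (×-≡-dec ℕ._≟_ ℕ._≟_) z (just t) ⌋) (S-invariant σ G H iso)

    -- `Seen` concerns flips only, so a graph already in the class may be moved to another member of
    -- it.
    f : Graph n → Graph n
    f G with seen? G t
    ... | yes e = toggle (proj₁ (proj₁ (find e))) (proj₂ (proj₁ (find e))) G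
    ... | no _  = G

    f-adversary : ∀ G (i j k l : Fin n) → i Fin.< j → k Fin.< l →
      adj G i j ≢ adj (f G) i j → adj G k l ≢ adj (f G) k l → i ≡ k × j ≡ l
    f-adversary G i j k l i<j k<l ne ne′ with seen? G t
    ... | no _  = contradiction refl ne
    ... | yes e with find e
    ...   | (x , y) , xy∈ , _ = trans (proj₁ ij) (sym (proj₁ kl)) , trans (proj₂ ij) (sym (proj₂ kl))
      where
      changed : ∀ {i j} → i Fin.< j → adj G i j ≢ adj (toggle x y G) i j → i ≡ x × j ≡ y
      changed {i} {j} i<j ne with i Fin.≟ x | j Fin.≟ y
      ... | yes e₁ | yes e₂ = e₁ , e₂
      ... | no n₁  | _      = contradiction (sym (adj-toggle-other x y G i j λ
              { (inj₁ (e₁ , _)) → n₁ e₁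
              ; (inj₂ (refl , refl)) → <-asym i<j (edges-ordered xy∈) })) ne
      ... | yes _  | no n₂  = contradiction (sym (adj-toggle-other x y G i j λ
              { (inj₁ (_ , e₂)) → n₂ e₂
              ; (inj₂ (refl , refl)) → <-asym i<j (edges-ordered xy∈) })) ne
      ij = changed i<j ne
      kl = changed k<l ne′

    ⌊⌋≟true : {P : Set} (d : Dec P) → ⟦ ⌊ d ⌋ Bool.≟ true ⟧ ≡ ⟦ d ⟧
    ⌊⌋≟true (yes _) = refl
    ⌊⌋≟true (no _)  = refl

    count-A : count n A ≡ a t
    count-A = trans (count-∑ n A) (∑-cong Gs (λ G → ⌊⌋≟true (S? G t)))

    covered : tot ≤ count n (λ G → A (f G)) + u t
    covered = begin
      tot                                                                    ≡⟨ ∑-allGraphs-1 n ⟨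
      ∑ Gs (λ _ → 1)                                                         ≤⟨ ∑-mono Gs point ⟩
      ∑ Gs (λ G → ⟦ A (f G) Bool.≟ true ⟧ + ⟦ ¬? (seen? G t) ⟧)              ≡⟨ ∑-+ Gs (λ G → ⟦ A (f G) Bool.≟ true ⟧) (λ G → ⟦ ¬? (seen? G t) ⟧) ⟩
      ∑ Gs (λ G → ⟦ A (f G) Bool.≟ true ⟧) + u t                             ≡⟨ cong (_+ u t) (count-∑ n (λ G → A (f G))) ⟨
      count n (λ G → A (f G)) + u t                                          ∎
      where
      open ≤-Reasoning
      hit : ∀ G → Seen G t → S (f G) ≡ just t
      hit G e with seen? G t
      ... | yes e′ = proj₂ (proj₂ (find e′))
      ... | no ¬e  = contradiction e ¬e
      either : {P R : Set} (x : Dec P) (y : Dec R) → (R → P) → 1 ≤ ⟦ ⌊ x ⌋ Bool.≟ true ⟧ + ⟦ ¬? y ⟧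
      either (yes _) y       h = s≤s z≤n
      either (no _)  (no _)  h = s≤s z≤n
      either (no ¬x) (yes y) h = contradiction (h y) ¬x
      point : ∀ G → 1 ≤ ⟦ A (f G) Bool.≟ true ⟧ + ⟦ ¬? (seen? G t) ⟧
      point G = either (S? (f G) t) (seen? G t) (hit G)

    -- Double counting of the flips that end in the class: a covered graph has at least one, and
    -- each member of the class is the result of `N` flips.
    lower : tot ≤ N * a t + u t
    lower = begin
      tot                                                                                  ≡⟨ ∑-allGraphs-1 n ⟨
      ∑ Gs (λ _ → 1)                                                                       ≤⟨ ∑-mono Gs point ⟩
      ∑ Gs (λ G → ∑ (edges n) (λ (i , j) → ⟦ S? (toggle i j G) t ⟧) + ⟦ ¬? (seen? G t) ⟧)  ≡⟨ ∑-+ Gs _ (λ G → ⟦ ¬? (seen? G t) ⟧) ⟩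
      ∑ Gs (λ G → ∑ (edges n) (λ (i , j) → ⟦ S? (toggle i j G) t ⟧)) + u t                 ≡⟨ cong (_+ u t) (∑-swap Gs (edges n) _) ⟩
      ∑ (edges n) (λ (i , j) → ∑ Gs (λ G → ⟦ S? (toggle i j G) t ⟧)) + u t                 ≡⟨ cong (_+ u t) (∑-cong (edges n) (λ (i , j) → ∑-toggle i j (λ G → ⟦ S? G t ⟧))) ⟩
      ∑ (edges n) (λ _ → a t) + u t                                                        ≡⟨ cong (_+ u t) (∑-const (edges n) (a t)) ⟩
      length (edges n) * a t + u t                                                         ≡⟨ cong (λ z → z * a t + u t) (length-edges n) ⟩
      N * a t + u t                                                                        ∎
      where
      open ≤-Reasoning
      near : Graph n → ℕ
      near G = ∑ (edges n) (λ (i , j) → ⟦ S? (toggle i j G) t ⟧)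
      near≥1 : ∀ G → Seen G t → 1 ≤ near G
      near≥1 G e with find e
      ... | (x , y) , xy∈ , eq = ≤-trans (≤-reflexive (sym (⟦⟧-yes (S? (toggle x y G) t) eq)))
              (∑-member (λ (i , j) → ⟦ S? (toggle i j G) t ⟧) xy∈)
      either : {R : Set} (c : ℕ) (y : Dec R) → (R → 1 ≤ c) → 1 ≤ c + ⟦ ¬? y ⟧
      either c (yes y) h = ≤-trans (h y) (m≤m+n c 0)
      either c (no _)  h = m≤n+m 1 c
      point : ∀ G → 1 ≤ near G + ⟦ ¬? (seen? G t) ⟧
      point G = either (near G) (seen? G t) (near≥1 G)

-- Products of powers of 2 and p

prime-above : ∀ k → ∃[ p ] (Prime p × k < p)
prime-above k with factorise (suc (k !))
... | record { factors = [] ; isFactorisation = eq } = contradiction (1≤n! k) (<⇒≱ (subst (k ! <_) eq (n<1+n (k !))))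
... | record { factors = p ∷ ps ; isFactorisation = eq ; factorsPrime = pr ∷ _ } = p , pr , ≰⇒> λ p≤k →
  contradiction (∣1 (∣m+n∣m⇒∣n {n = 1} (subst (p ∣ₙ_) (trans (sym eq) (+-comm 1 (k !))) (m∣m*n (product ps)))
                    (∣-trans (p∣p! p (>-nonZero⁻¹ p {{prime⇒nonZero pr}})) (m≤n⇒m!∣n! p≤k)))) λ { refl → ¬prime[1] pr }
  where
  p∣p! : ∀ p → 0 < p → p ∣ₙ p !
  p∣p! (suc p) _ = m∣m*n (p !)
  ∣1 : ∀ {p} → p ∣ₙ 1 → p ≡ 1
  ∣1 d = ∣1⇒≡1 d

n<2^n : ∀ n → n < 2 ^ n
n<2^n zero    = s≤s z≤n
n<2^n (suc n) = begin
  suc (suc n)     ≤⟨ s≤s (n<2^n n) ⟩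
  suc (2 ^ n)     ≤⟨ +-monoˡ-≤ (2 ^ n) (m^n>0 2 n) ⟩
  2 ^ n + 2 ^ n   ≡⟨ cong (2 ^ n +_) (+-identityʳ (2 ^ n)) ⟨
  2 ^ suc n       ∎
  where open ≤-Reasoning

2^suc* : ∀ e b → 2 ^ suc e * b ≡ 2 * (2 ^ e * b)
2^suc* e b = *-assoc 2 (2 ^ e) b

-- A discrete intermediate value principle; no monotonicity of `f` is involved.
crossing : ∀ (f : ℕ → ℕ) N J → f 0 ≤ N → N < f J → ∃[ k ] (k < J × f k ≤ N × N < f (suc k))
crossing f N zero    lo hi = contradiction lo (<⇒≱ hi)
crossing f N (suc J) lo hi with f J ≤? N
... | yes le = J , ≤-refl , le , hi
... | no ¬le with crossing f N J lo (≰⇒> ¬le)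
...   | k , k<J , h = k , m<n⇒m<1+n k<J , h

bracket : ∀ b N → 0 < b → b ≤ N → ∃[ e ] (2 ^ e * b ≤ N × N < 2 ^ suc e * b)
bracket b N 0<b b≤N with crossing (λ e → 2 ^ e * b) N N (subst (_≤ N) (sym (*-identityˡ b)) b≤N)
  (<-≤-trans (n<2^n N) (≤-trans (≤-reflexive (sym (*-identityʳ (2 ^ N)))) (*-monoʳ-≤ (2 ^ N) 0<b)))
... | e , _ , lo , hi = e , lo , hi

prime∤2^ : ∀ {p} → Prime p → 2 < p → ∀ c → ¬ p ∣ₙ 2 ^ c
prime∤2^ pr 2<p zero    d = <⇒≱ (<-trans (s≤s (s≤s z≤n)) 2<p) (∣⇒≤ d)
prime∤2^ pr 2<p (suc c) d with euclidsLemma 2 (2 ^ c) pr d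
... | inj₁ d′ = <⇒≱ 2<p (∣⇒≤ d′)
... | inj₂ d′ = prime∤2^ pr 2<p c d′

-- Cancelling common powers of `p` would leave `p` dividing a power of two. This makes the two
-- numbers found by the pigeonhole principle different.
2^*p^-injective : ∀ {p} → Prime p → 2 < p → ∀ c c′ i i′ → i < i′ → 2 ^ c * p ^ i ≢ 2 ^ c′ * p ^ i′
2^*p^-injective {p} pr 2<p c c′ zero    (suc i′) _         e =
  prime∤2^ pr 2<p c (subst (p ∣ₙ_) (trans (sym e) (*-identityʳ (2 ^ c))) (∣-trans (m∣m*n (p ^ i′)) (n∣m*n (2 ^ c′))))
2^*p^-injective {p} pr 2<p c c′ (suc i) (suc i′) (s≤s i<i′) e =
  2^*p^-injective pr 2<p c c′ i i′ i<i′ (*-cancelˡ-≡ _ _ p {{prime⇒nonZero pr}} (trans (rearr p (2 ^ c) (p ^ i)) (trans e (sym (rearr p (2 ^ c′) (p ^ i′))))))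
  where
  rearr : ∀ p a b → p * (a * b) ≡ a * (p * b)
  rearr = solve-∀

same-quotient : ∀ W .{{_ : NonZero W}} a b → a /ₙ W ≡ b /ₙ W → b < a + W
same-quotient W a b e = begin-strict
  b                      ≡⟨ m≡m%n+[m/n]*n b W ⟩
  b % W + b /ₙ W * W      <⟨ +-monoˡ-< (b /ₙ W * W) (m%n<n b W) ⟩
  W + b /ₙ W * W          ≡⟨ cong (λ z → W + z * W) e ⟨
  W + a /ₙ W * W          ≤⟨ +-monoʳ-≤ W (m/n*n≤m a W) ⟩
  W + a                  ≡⟨ +-comm W a ⟩
  a + W                  ∎
  where open ≤-Reasoning

-- Dirichlet's pigeonhole argument on the fractional parts of i log₂ p.
close-pair : ∀ {p} → Prime p → 2 < p → ∀ K → ∃[ c ] ∃[ i ] ∃[ c′ ] ∃[ i′ ]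
  (2 ^ c * p ^ i < 2 ^ c′ * p ^ i′ × K * (2 ^ c′ * p ^ i′) ≤ suc K * (2 ^ c * p ^ i))
close-pair {p} pr 2<p K = result (Fin.pigeonhole (n<1+n (suc K)) box)
  where
  open ≤-Reasoning
  instance
    p≢0 : NonZero p
    p≢0 = prime⇒nonZero pr
  -- Chosen to exceed every power `p ^ i` that occurs. Each of them is doubled until it lies between
  -- `W / 2` and `W`.
  W = 2 ^ (p ^ suc K)
  instance
    W≢0 : NonZero W
    W≢0 = m^n≢0 2 (p ^ suc K)
  br : (i : Fin (2 + K)) → ∃[ e ] (2 ^ e * p ^ toℕ i ≤ W × W < 2 ^ suc e * p ^ toℕ i)
  br i = bracket (p ^ toℕ i) W (m^n>0 p (toℕ i))
    (≤-trans (^-monoʳ-≤ p (Fin.toℕ≤pred[n] i)) (<⇒≤ (n<2^n (p ^ suc K))))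
  x : Fin (2 + K) → ℕ
  x i = 2 ^ proj₁ (br i) * p ^ toℕ i
  x≤W : ∀ i → x i ≤ W
  x≤W i = proj₁ (proj₂ (br i))
  W<2x : ∀ i → W < 2 * x i
  W<2x i = subst (W <_) (2^suc* (proj₁ (br i)) _) (proj₂ (proj₂ (br i)))
  quo≤ : ∀ i → 2 * K * x i /ₙ W ≤ 2 * K
  quo≤ i = begin
    2 * K * x i /ₙ W   ≤⟨ /-monoˡ-≤ W (*-monoʳ-≤ (2 * K) (x≤W i)) ⟩
    2 * K * W /ₙ W     ≡⟨ m*n/n≡m (2 * K) W ⟩
    2 * K             ∎
  ≤quo : ∀ i → K ≤ 2 * K * x i /ₙ W
  ≤quo i = begin
    K                 ≡⟨ m*n/n≡m K W ⟨
    K * W /ₙ W         ≤⟨ /-monoˡ-≤ W (*-monoʳ-≤ K (<⇒≤ (W<2x i))) ⟩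
    K * (2 * x i) /ₙ W ≡⟨ cong (_/ₙ W) (rearr K (x i)) ⟩
    2 * K * x i /ₙ W   ∎
    where
    rearr : ∀ k x → k * (2 * x) ≡ 2 * k * x
    rearr = solve-∀
  -- The quotients lie between `K` and `2 * K`, so `K + 2` numbers fall into `K + 1` boxes. Numbers
  -- in one box differ by less than `W / (2 K)`, which is below `x / K`.
  box : Fin (2 + K) → Fin (suc K)
  box i = fromℕ< {2 * K * x i /ₙ W ∸ K} (s≤s (begin
    2 * K * x i /ₙ W ∸ K   ≤⟨ ∸-monoˡ-≤ K (quo≤ i) ⟩
    2 * K ∸ K             ≡⟨ cong (_∸ K) (cong (K +_) (+-identityʳ K)) ⟩
    K + K ∸ K             ≡⟨ m+n∸n≡m K K ⟩
    K                     ∎))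
  near : ∀ i j → box i ≡ box j → K * x j ≤ suc K * x i
  near i j e = *-cancelˡ-≤ 2 (begin
    2 * (K * x j)             ≡⟨ *-assoc 2 K (x j) ⟨
    2 * K * x j               ≤⟨ <⇒≤ (same-quotient W (2 * K * x i) (2 * K * x j) quo≡) ⟩
    2 * K * x i + W           ≤⟨ +-monoʳ-≤ (2 * K * x i) (<⇒≤ (W<2x i)) ⟩
    2 * K * x i + 2 * x i     ≡⟨ rearr K (x i) ⟩
    2 * (suc K * x i)         ∎)
    where
    rearr : ∀ k x → 2 * k * x + 2 * x ≡ 2 * (suc k * x)
    rearr = solve-∀
    quo≡ : 2 * K * x i /ₙ W ≡ 2 * K * x j /ₙ W
    quo≡ = ∸-cancelʳ-≡ (≤quo i) (≤quo j) (trans (sym (Fin.toℕ-fromℕ< _)) (trans (cong toℕ e) (Fin.toℕ-fromℕ< _)))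
  result : (∃[ i ] ∃[ j ] (i Fin.< j × box i ≡ box j)) → ∃[ c ] ∃[ i ] ∃[ c′ ] ∃[ i′ ]
    (2 ^ c * p ^ i < 2 ^ c′ * p ^ i′ × K * (2 ^ c′ * p ^ i′) ≤ suc K * (2 ^ c * p ^ i))
  result (i , j , i<j , e) with <-cmp (x i) (x j)
  ... | tri< lt _ _ = proj₁ (br i) , toℕ i , proj₁ (br j) , toℕ j , lt , near i j e
  ... | tri> _ _ gt = proj₁ (br j) , toℕ j , proj₁ (br i) , toℕ i , gt , near j i (sym e)
  ... | tri≈ _ eq _ = contradiction eq (2^*p^-injective pr 2<p (proj₁ (br i)) (proj₁ (br j)) (toℕ i) (toℕ j) i<j)

bernoulli : ∀ x k → x ^ suc k + suc k * x ^ k ≤ suc x ^ suc k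
bernoulli x zero    = ≤-reflexive (rearr x)
  where
  rearr : ∀ x → x * 1 + 1 ≡ (1 + x) * 1
  rearr = solve-∀
bernoulli x (suc k) = begin
  x * (x * x ^ k) + suc (suc k) * (x * x ^ k)                     ≤⟨ m≤m+n _ (suc k * x ^ k) ⟩
  x * (x * x ^ k) + suc (suc k) * (x * x ^ k) + suc k * x ^ k     ≡⟨ rearr x k (x ^ k) ⟩
  suc x * (x * x ^ k + suc k * x ^ k)                             ≤⟨ *-monoʳ-≤ (suc x) (bernoulli x k) ⟩
  suc x * suc x ^ suc k                                           ∎
  where
  open ≤-Reasoning
  rearr : ∀ x k t → x * (x * t) + (2 + k) * (x * t) + (1 + k) * t ≡ (1 + x) * (x * t + (1 + k) * t)
  rearr = solve-∀

-- This is `(1 + 1/x) ^ x ≥ 2`, from the first two binomial terms. So `x` replacements of `x` by `y`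
-- span a whole factor of two.
doubling : ∀ {x y} → 0 < x → x < y → 2 * x ^ x ≤ y ^ x
doubling {suc x} {y} _ x<y = begin
  2 * suc x ^ suc x                            ≡⟨ cong (suc x ^ suc x +_) (+-identityʳ (suc x ^ suc x)) ⟩
  suc x ^ suc x + suc x * suc x ^ x            ≤⟨ bernoulli (suc x) x ⟩
  suc (suc x) ^ suc x                          ≤⟨ ^-monoˡ-≤ (suc x) x<y ⟩
  y ^ suc x                                    ∎
  where open ≤-Reasoning

^-distribʳ-* : ∀ a x y → (x * y) ^ a ≡ x ^ a * y ^ a
^-distribʳ-* zero    x y = refl
^-distribʳ-* (suc a) x y = trans (cong (x * y *_) (^-distribʳ-* a x y)) (rearr x y (x ^ a) (y ^ a))
  where
  rearr : ∀ x y u v → x * y * (u * v) ≡ x * u * (y * v)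
  rearr = solve-∀

^-merge : ∀ p c i a → (2 ^ c * p ^ i) ^ a ≡ 2 ^ (c * a) * p ^ (i * a)
^-merge p c i a = trans (^-distribʳ-* a (2 ^ c) (p ^ i)) (cong₂ _*_ (^-*-assoc 2 c a) (^-*-assoc p i a))

-- Between x ^ x and y ^ x ≥ 2 x ^ x the products x ^ (x ∸ k) * y ^ k grow by the
-- factor y / x at each step; powers of two cover the rest.
ladder : ∀ x y K → 0 < x → x < y → K * y ≤ suc K * x → ∀ N → x ^ x ≤ N → ∃[ e ] ∃[ k ]
  (k < x × 2 ^ e * (x ^ (x ∸ k) * y ^ k) ≤ N × K * N ≤ suc K * (2 ^ e * (x ^ (x ∸ k) * y ^ k)))
ladder x y K 0<x x<y close N big = e , k , k<x , proj₁ (proj₂ (proj₂ cross)) , (begin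
  K * N                                                     ≤⟨ *-monoʳ-≤ K (<⇒≤ (proj₂ (proj₂ (proj₂ cross)))) ⟩
  K * (2 ^ e * (x ^ (x ∸ suc k) * (y * y ^ k)))             ≡⟨ rearr₁ K (2 ^ e) (x ^ (x ∸ suc k)) y (y ^ k) ⟩
  2 ^ e * (x ^ (x ∸ suc k) * y ^ k) * (K * y)               ≤⟨ *-monoʳ-≤ (2 ^ e * (x ^ (x ∸ suc k) * y ^ k)) close ⟩
  2 ^ e * (x ^ (x ∸ suc k) * y ^ k) * (suc K * x)           ≡⟨ rearr₂ (suc K) (2 ^ e) (x ^ (x ∸ suc k)) x (y ^ k) ⟩
  suc K * (2 ^ e * (x ^ suc (x ∸ suc k) * y ^ k))           ≡⟨ cong (λ z → suc K * (2 ^ e * (x ^ z * y ^ k))) (+-∸-assoc 1 k<x) ⟨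
  suc K * (2 ^ e * (x ^ (x ∸ k) * y ^ k))                   ∎)
  where
  open ≤-Reasoning
  rearr₁ : ∀ k e a y b → k * (e * (a * (y * b))) ≡ e * (a * b) * (k * y)
  rearr₁ = solve-∀
  rearr₂ : ∀ k e a x b → e * (a * b) * (k * x) ≡ k * (e * (x * a * b))
  rearr₂ = solve-∀
  rearr₃ : ∀ a b → 2 * (a * b) ≡ a * (2 * b)
  rearr₃ = solve-∀
  br : ∃[ e ] (2 ^ e * x ^ x ≤ N × N < 2 ^ suc e * x ^ x)
  br = bracket (x ^ x) N (m^n>0 x {{>-nonZero 0<x}} x) big
  e = proj₁ br
  top : N < 2 ^ e * (x ^ (x ∸ x) * y ^ x)
  top = begin-strict
    N                              <⟨ proj₂ (proj₂ br) ⟩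
    2 ^ suc e * x ^ x              ≡⟨ 2^suc* e (x ^ x) ⟩
    2 * (2 ^ e * x ^ x)            ≡⟨ rearr₃ (2 ^ e) (x ^ x) ⟩
    2 ^ e * (2 * x ^ x)            ≤⟨ *-monoʳ-≤ (2 ^ e) (doubling 0<x x<y) ⟩
    2 ^ e * y ^ x                  ≡⟨ cong (2 ^ e *_) (*-identityˡ (y ^ x)) ⟨
    2 ^ e * (1 * y ^ x)            ≡⟨ cong (λ z → 2 ^ e * (x ^ z * y ^ x)) (n∸n≡0 x) ⟨
    2 ^ e * (x ^ (x ∸ x) * y ^ x)  ∎
  cross : ∃[ k ] (k < x × 2 ^ e * (x ^ (x ∸ k) * y ^ k) ≤ N × N < 2 ^ e * (x ^ (x ∸ suc k) * y ^ suc k))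
  cross = crossing (λ k → 2 ^ e * (x ^ (x ∸ k) * y ^ k)) N x
    (subst (_≤ N) (cong (2 ^ e *_) (sym (*-identityʳ (x ^ x)))) (proj₁ (proj₂ br))) top
  k = proj₁ cross
  k<x = proj₁ (proj₂ cross)

^-collect : ∀ p e c i c′ i′ a k →
  2 ^ e * ((2 ^ c * p ^ i) ^ a * (2 ^ c′ * p ^ i′) ^ k) ≡ 2 ^ (e + (c * a + c′ * k)) * p ^ (i * a + i′ * k)
^-collect p e c i c′ i′ a k = trans (cong₂ (λ u v → 2 ^ e * (u * v)) (^-merge p c i a) (^-merge p c′ i′ k))
  (trans (rearr (2 ^ e) (2 ^ (c * a)) (p ^ (i * a)) (2 ^ (c′ * k)) (p ^ (i′ * k)))
    (sym (cong₂ _*_ (trans (^-distribˡ-+-* 2 e _) (cong (2 ^ e *_) (^-distribˡ-+-* 2 (c * a) (c′ * k)))) (^-distribˡ-+-* p (i * a) (i′ * k)))))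
  where
  rearr : ∀ e a b c d → e * (a * b * (c * d)) ≡ e * (a * c) * (b * d)
  rearr = solve-∀

-- At most `x` factors of each kind are used, so the bound `R` on the power of `p` does not depend
-- on `N`. This is what later makes `Q * Q` negligible against `2 ^ m * Q`.
approximation : ∀ {p} → Prime p → 2 < p → ∀ K → ∃[ R ] ∃[ B ] (∀ N → B ≤ N → ∃[ m ] ∃[ j ]
  (p ^ j ≤ R × 2 ^ m * p ^ j ≤ N × K * N ≤ suc K * (2 ^ m * p ^ j)))
approximation {p} pr 2<p K = from-pair (close-pair pr 2<p K)
  where
  instance
    p≢0 : NonZero p
    p≢0 = prime⇒nonZero pr
  with-base : ∀ c i c′ i′ x y → x ≡ 2 ^ c * p ^ i → y ≡ 2 ^ c′ * p ^ i′ → x < y → K * y ≤ suc K * x →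
    ∃[ R ] ∃[ B ] (∀ N → B ≤ N → ∃[ m ] ∃[ j ]
      (p ^ j ≤ R × 2 ^ m * p ^ j ≤ N × K * N ≤ suc K * (2 ^ m * p ^ j)))
  with-base c i c′ i′ x y x≡ y≡ x<y close = p ^ (i * x + i′ * x) , x ^ x , λ N big → step N (ladder x y K 0<x x<y close N big)
    where
    0<x : 0 < x
    0<x = subst (0 <_) (sym x≡) (*-mono-≤ (m^n>0 2 c) (m^n>0 p i))
    step : ∀ N → (∃[ e ] ∃[ k ] (k < x × 2 ^ e * (x ^ (x ∸ k) * y ^ k) ≤ N × K * N ≤ suc K * (2 ^ e * (x ^ (x ∸ k) * y ^ k)))) →
      ∃[ m ] ∃[ j ] (p ^ j ≤ p ^ (i * x + i′ * x) × 2 ^ m * p ^ j ≤ N × K * N ≤ suc K * (2 ^ m * p ^ j))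
    step N (e , k , k<x , below , above) = e + (c * (x ∸ k) + c′ * k) , i * (x ∸ k) + i′ * k ,
      ^-monoʳ-≤ p (+-mono-≤ (*-monoʳ-≤ i (m∸n≤m x k)) (*-monoʳ-≤ i′ (<⇒≤ k<x))) ,
      subst (_≤ N) form below , subst (λ z → K * N ≤ suc K * z) form above
      where
      form : 2 ^ e * (x ^ (x ∸ k) * y ^ k) ≡ 2 ^ (e + (c * (x ∸ k) + c′ * k)) * p ^ (i * (x ∸ k) + i′ * k)
      form = trans (cong₂ (λ u v → 2 ^ e * (u ^ (x ∸ k) * v ^ k)) x≡ y≡) (^-collect p e c i c′ i′ (x ∸ k) k)
  from-pair : (∃[ c ] ∃[ i ] ∃[ c′ ] ∃[ i′ ]
    (2 ^ c * p ^ i < 2 ^ c′ * p ^ i′ × K * (2 ^ c′ * p ^ i′) ≤ suc K * (2 ^ c * p ^ i))) → _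
  from-pair (c , i , c′ , i′ , x<y , close) = with-base c i c′ i′ _ _ refl refl x<y close

-- Squares of logarithms against linear growth

cube : ℕ → ℕ
cube x = x * (x * x)

cube-mono : ∀ {x y} → x ≤ y → cube x ≤ cube y
cube-mono h = *-mono-≤ h (*-mono-≤ h h)

cube-3* : ∀ x → cube (3 * x) ≡ 27 * cube x
cube-3* = expanded
  where
  expanded : ∀ x → 3 * x * (3 * x * (3 * x)) ≡ 27 * (x * (x * x))
  expanded = solve-∀

cube-2^ : ∀ t → cube (2 ^ t) ≡ 2 ^ (t * 3)
cube-2^ t = trans (cong (λ z → 2 ^ t * (2 ^ t * z)) (sym (*-identityʳ (2 ^ t)))) (^-*-assoc 2 t 3)

cube≤2^ : ∀ e x t → x ≤ 3 * t → t ≤ 2 ^ e → cube x ≤ 27 * 2 ^ (e * 3)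
cube≤2^ e x t h h′ = begin
  cube x               ≤⟨ cube-mono h ⟩
  cube (3 * t)         ≡⟨ cube-3* t ⟩
  27 * cube t          ≤⟨ *-monoʳ-≤ 27 (cube-mono h′) ⟩
  27 * cube (2 ^ e)    ≡⟨ cong (27 *_) (cube-2^ e) ⟩
  27 * 2 ^ (e * 3)     ∎
  where open ≤-Reasoning

-- The exponent is cut into thirds and `t < 2 ^ t` is applied to one of them; 27 is the cube of 3.
cube-suc≤2^ : ∀ e → cube (suc e) ≤ 27 * 2 ^ e
cube-suc≤2^ e = ≤-trans (cube≤2^ (e /ₙ 3) (suc e) (suc (e /ₙ 3)) third (n<2^n (e /ₙ 3)))
  (*-monoʳ-≤ 27 (^-monoʳ-≤ 2 (m/n*n≤m e 3)))
  where
  third : suc e ≤ 3 * suc (e /ₙ 3)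
  third = begin
    suc e                       ≡⟨ cong suc (m≡m%n+[m/n]*n e 3) ⟩
    suc (e % 3) + e /ₙ 3 * 3     ≤⟨ +-monoˡ-≤ (e /ₙ 3 * 3) (m%n<n e 3) ⟩
    3 + e /ₙ 3 * 3               ≡⟨ *-comm (suc (e /ₙ 3)) 3 ⟩
    3 * suc (e /ₙ 3)             ∎
    where open ≤-Reasoning

-- `L` is the number of binary digits of `n`. From `27 * c ≤ L` and `cube L ≤ 27 * n` the factor `L`
-- is traded for `27 * c`.
log-square : ∀ c n → 2 ^ (27 * c) ≤ n → ∃[ L ] (0 < L × n ≤ 2 ^ L × c * (L * L) ≤ n)
log-square c n big with bracket 1 n (s≤s z≤n) (≤-trans (m^n>0 2 (27 * c)) big)
... | e , lo , hi = suc e , s≤s z≤n , <⇒≤ hi′ ,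
  ≤-trans (square (suc e) (2 ^ e) 27c≤ (cube-suc≤2^ e)) (≤-trans (≤-reflexive (sym (*-identityʳ (2 ^ e)))) lo)
  where
  hi′ : n < 2 ^ suc e
  hi′ = subst (n <_) (*-identityʳ (2 ^ suc e)) hi
  27c≤ : 27 * c ≤ suc e
  27c≤ = ≮⇒≥ λ lt → <⇒≱ hi′ (≤-trans (^-monoʳ-≤ 2 (<⇒≤ lt)) big)
  square : ∀ x w → 27 * c ≤ x → cube x ≤ 27 * w → c * (x * x) ≤ w
  square x w h h′ = *-cancelˡ-≤ 27 (begin
    27 * (c * (x * x))    ≡⟨ *-assoc 27 c (x * x) ⟨
    27 * c * (x * x)      ≤⟨ *-monoˡ-≤ (x * x) h ⟩
    cube x                ≤⟨ h′ ⟩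
    27 * w                ∎)
    where open ≤-Reasoning

-- Numerical estimates

average-bound : ∀ κ M tot Δ x → 0 < M → M * x ≤ M * tot + 2 * Δ → κ * Δ ≤ M * tot → κ * x ≤ (2 + κ) * tot
average-bound κ M tot Δ x 0<M h hΔ = *-cancelˡ-≤ M {{>-nonZero 0<M}} (begin
  M * (κ * x)                          ≡⟨ swap M κ x ⟩
  κ * (M * x)                          ≤⟨ *-monoʳ-≤ κ h ⟩
  κ * (M * tot + 2 * Δ)                ≡⟨ expand κ M tot Δ ⟩
  κ * (M * tot) + 2 * (κ * Δ)          ≤⟨ +-monoʳ-≤ (κ * (M * tot)) (*-monoʳ-≤ 2 hΔ) ⟩
  κ * (M * tot) + 2 * (M * tot)        ≡⟨ collect κ M tot ⟩
  M * ((2 + κ) * tot)                  ∎)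
  where
  open ≤-Reasoning
  swap : ∀ m k x → m * (k * x) ≡ k * (m * x)
  swap = solve-∀
  expand : ∀ k m t d → k * (m * t + 2 * d) ≡ k * (m * t) + 2 * (k * d)
  expand = solve-∀
  collect : ∀ k m t → k * (m * t) + 2 * (m * t) ≡ m * ((2 + k) * t)
  collect = solve-∀

-- Up to the factor `1 + 1/κ` between `N` and `M`, covering says `tot ≤ M * a + u`. Subtracting this
-- from `M * a + 2 * u ≤ (1 + 2/κ) tot` leaves at most `3/κ` of `tot` for `u`.
uncovered-bound : ∀ κ M N tot a u → κ * (M * a + 2 * u) ≤ (2 + κ) * tot → tot ≤ N * a + u →
  κ * N ≤ suc κ * M → κ * u ≤ 3 * tot
uncovered-bound κ M N tot a u h lower dense = *-cancelˡ-≤ (2 + κ) (+-cancelˡ-≤ (κ * κ * tot + κ * κ * u) _ _ (begin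
  κ * κ * tot + κ * κ * u + (2 + κ) * (κ * u)                          ≡⟨ r₁ κ tot u ⟩
  κ * (κ * tot) + 2 * (suc κ * (κ * u))                                ≤⟨ +-monoˡ-≤ _ (*-monoʳ-≤ κ (*-monoʳ-≤ κ lower)) ⟩
  κ * (κ * (N * a + u)) + 2 * (suc κ * (κ * u))                        ≡⟨ r₂ κ N a u ⟩
  κ * (κ * N * a) + (κ * κ * u + 2 * (suc κ * (κ * u)))                ≤⟨ +-monoˡ-≤ _ (*-monoʳ-≤ κ (*-monoˡ-≤ a dense)) ⟩
  κ * (suc κ * M * a) + (κ * κ * u + 2 * (suc κ * (κ * u)))            ≡⟨ r₃ κ M a u ⟩
  suc κ * (κ * (M * a + 2 * u)) + κ * κ * u                            ≤⟨ +-monoˡ-≤ (κ * κ * u) (*-monoʳ-≤ (suc κ) h) ⟩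
  suc κ * ((2 + κ) * tot) + κ * κ * u                                  ≤⟨ m≤m+n _ (4 * tot) ⟩
  suc κ * ((2 + κ) * tot) + κ * κ * u + 4 * tot                        ≡⟨ r₄ κ tot u ⟩
  κ * κ * tot + κ * κ * u + (2 + κ) * (3 * tot)                        ∎))
  where
  open ≤-Reasoning
  r₁ : ∀ k t u → k * k * t + k * k * u + (2 + k) * (k * u) ≡ k * (k * t) + 2 * ((1 + k) * (k * u))
  r₁ = solve-∀
  r₂ : ∀ k n a u → k * (k * (n * a + u)) + 2 * ((1 + k) * (k * u)) ≡ k * (k * n * a) + (k * k * u + 2 * ((1 + k) * (k * u)))
  r₂ = solve-∀
  r₃ : ∀ k m a u → k * ((1 + k) * m * a) + (k * k * u + 2 * ((1 + k) * (k * u))) ≡ (1 + k) * (k * (m * a + 2 * u)) + k * k * u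
  r₃ = solve-∀
  r₄ : ∀ k t u → (1 + k) * ((2 + k) * t) + k * k * u + 4 * t ≡ k * k * t + k * k * u + (2 + k) * (3 * t)
  r₄ = solve-∀

-- The product `(1 + 1/κ) (1 + 2/κ)` is at most `1 + 5/κ`, whence `κ = 5 K`.
density-bound : ∀ K κ M N tot a → 0 < K → κ ≡ 5 * K → κ * (M * a) ≤ (2 + κ) * tot →
  κ * N ≤ suc κ * M → K * (N * a) ≤ suc K * tot
density-bound K@(suc _) κ M N tot a _ κ≡ h dense = *-cancelˡ-≤ (κ * κ) {{m*n≢0 κ κ {{nz}} {{nz}}}} (begin
  κ * κ * (K * (N * a))                ≡⟨ r₁ κ K N a ⟩
  K * (κ * (κ * N * a))                ≤⟨ *-monoʳ-≤ K (*-monoʳ-≤ κ (*-monoˡ-≤ a dense)) ⟩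
  K * (κ * (suc κ * M * a))            ≡⟨ r₂ κ K M a ⟩
  K * (suc κ * (κ * (M * a)))          ≤⟨ *-monoʳ-≤ K (*-monoʳ-≤ (suc κ) h) ⟩
  K * (suc κ * ((2 + κ) * tot))        ≡⟨ r₃ κ K tot ⟩
  κ * κ * (K * tot) + (3 * κ * (K * tot) + 2 * 1 * (K * tot))   ≤⟨ +-monoʳ-≤ (κ * κ * (K * tot)) (+-monoʳ-≤ (3 * κ * (K * tot)) (*-monoˡ-≤ (K * tot) (*-monoʳ-≤ 2 κ>0))) ⟩
  κ * κ * (K * tot) + (3 * κ * (K * tot) + 2 * κ * (K * tot))   ≡⟨ r₄ κ K tot ⟩
  κ * κ * (K * tot) + κ * (5 * K * tot)                         ≡⟨ cong (λ z → κ * κ * (K * tot) + κ * (z * tot)) κ≡ ⟨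
  κ * κ * (K * tot) + κ * (κ * tot)                             ≡⟨ r₅ κ K tot ⟩
  κ * κ * (suc K * tot)                                         ∎)
  where
  open ≤-Reasoning
  κ>0 : 0 < κ
  κ>0 = subst (0 <_) (sym κ≡) (s≤s z≤n)
  nz : NonZero κ
  nz = >-nonZero κ>0
  r₁ : ∀ k K n a → k * k * (K * (n * a)) ≡ K * (k * (k * n * a))
  r₁ = solve-∀
  r₂ : ∀ k K m a → K * (k * ((1 + k) * m * a)) ≡ K * ((1 + k) * (k * (m * a)))
  r₂ = solve-∀
  r₃ : ∀ k K t → K * ((1 + k) * ((2 + k) * t)) ≡ k * k * (K * t) + (3 * k * (K * t) + 2 * 1 * (K * t))
  r₃ = solve-∀
  r₄ : ∀ k K t → k * k * (K * t) + (3 * k * (K * t) + 2 * k * (K * t)) ≡ k * k * (K * t) + k * (5 * K * t)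
  r₄ = solve-∀
  r₅ : ∀ k K t → k * k * (K * t) + k * (k * t) ≡ k * k * ((1 + K) * t)
  r₅ = solve-∀

-- Five errors of at most `M * tot / lam` each: rounding the modulus (`Q * Q`), nonunit
-- displacements (`Q` and `Q * w`), relabelling (`d`) and missing certificates (`r`). Hence
-- `lam = 5 κ`.
missing-bound : ∀ κ lam V M Q w d r tot Δ → lam ≡ 5 * κ →
  Δ + V * tot ≤ (M + Q * suc w) * tot + (d * tot + M * r) →
  M ≤ V + Q * Q → V ≤ M → lam * (Q * Q) ≤ V → lam * Q ≤ V → lam * (Q * w) ≤ V → lam * d ≤ V → lam * r ≤ tot →
  κ * Δ ≤ M * tot
missing-bound κ lam V M Q w d r tot Δ refl hΔ M≤ V≤M hQQ hQ hw hd hr = *-cancelˡ-≤ 5 (+-cancelˡ-≤ (lam * (V * tot)) _ _ (begin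
  lam * (V * tot) + 5 * (κ * Δ)                                              ≡⟨ r₁ κ V tot Δ ⟩
  lam * (Δ + V * tot)                                                        ≤⟨ *-monoʳ-≤ lam hΔ ⟩
  lam * ((M + Q * suc w) * tot + (d * tot + M * r))                          ≤⟨ *-monoʳ-≤ lam (+-monoˡ-≤ _ (*-monoˡ-≤ tot (+-monoˡ-≤ _ M≤))) ⟩
  lam * ((V + Q * Q + Q * suc w) * tot + (d * tot + M * r))                  ≡⟨ r₂ lam V Q w d M r tot ⟩
  lam * (V * tot) + ((lam * (Q * Q) + lam * Q + lam * (Q * w) + lam * d) * tot + M * (lam * r))
                                                                             ≤⟨ +-monoʳ-≤ (lam * (V * tot)) (+-mono-≤ (*-monoˡ-≤ tot (+-mono-≤ (+-mono-≤ (+-mono-≤ (≤-trans hQQ V≤M) (≤-trans hQ V≤M)) (≤-trans hw V≤M)) (≤-trans hd V≤M))) (*-monoʳ-≤ M hr)) ⟩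
  lam * (V * tot) + ((M + M + M + M) * tot + M * tot)                        ≡⟨ cong (lam * (V * tot) +_) (r₃ M tot) ⟩
  lam * (V * tot) + 5 * (M * tot)                                            ∎))
  where
  open ≤-Reasoning
  r₁ : ∀ k v t d → 5 * k * (v * t) + 5 * (k * d) ≡ 5 * k * (d + v * t)
  r₁ = solve-∀
  r₂ : ∀ l v q w d m r t → l * ((v + q * q + q * (1 + w)) * t + (d * t + m * r)) ≡
       l * (v * t) + ((l * (q * q) + l * q + l * (q * w) + l * d) * t + m * (l * r))
  r₂ = solve-∀
  r₃ : ∀ m t → (m + m + m + m) * t + m * t ≡ 5 * (m * t)
  r₃ = solve-∀

-- n = s + n′ with n′ much larger than s; N and N′ are the numbers of pairs.
discard-bound : ∀ K s n′ N N′ → 2 * N + (s + n′) ≡ (s + n′) * (s + n′) → 2 * N′ + n′ ≡ n′ * n′ →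
  6 * K * s ≤ n′ → s ≤ n′ → 2 ≤ n′ → K * N ≤ suc K * N′
discard-bound K s n′ N N′ eN eN′ small s≤n′ 2≤n′ = *-cancelˡ-≤ 2 (+-cancelʳ-≤ (K * (s + n′) + suc K * n′) _ _ (begin
  2 * (K * N) + (K * (s + n′) + suc K * n′)                     ≡⟨ r₁ K N (s + n′) n′ ⟩
  K * (2 * N + (s + n′)) + suc K * n′                           ≡⟨ cong (λ z → K * z + suc K * n′) eN ⟩
  K * ((s + n′) * (s + n′)) + suc K * n′                        ≡⟨ r₂ K s n′ ⟩
  K * (n′ * n′) + K * n′ + (K * s * (s + 2 * n′) + n′)          ≤⟨ +-monoʳ-≤ (K * (n′ * n′) + K * n′) rest ⟩
  K * (n′ * n′) + K * n′ + n′ * n′                              ≤⟨ m≤m+n _ (K * s) ⟩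
  K * (n′ * n′) + K * n′ + n′ * n′ + K * s                      ≡⟨ r₃ K s n′ ⟩
  suc K * (n′ * n′) + K * (s + n′)                              ≡⟨ cong (λ z → suc K * z + K * (s + n′)) eN′ ⟨
  suc K * (2 * N′ + n′) + K * (s + n′)                          ≡⟨ r₄ K N′ (s + n′) n′ ⟩
  2 * (suc K * N′) + (K * (s + n′) + suc K * n′)                ∎))
  where
  open ≤-Reasoning
  r₁ : ∀ k N n n′ → 2 * (k * N) + (k * n + (1 + k) * n′) ≡ k * (2 * N + n) + (1 + k) * n′
  r₁ = solve-∀
  r₂ : ∀ k s n → k * ((s + n) * (s + n)) + (1 + k) * n ≡ k * (n * n) + k * n + (k * s * (s + 2 * n) + n)
  r₂ = solve-∀
  r₃ : ∀ k s n → k * (n * n) + k * n + n * n + k * s ≡ (1 + k) * (n * n) + k * (s + n)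
  r₃ = solve-∀
  r₄ : ∀ k N n n′ → (1 + k) * (2 * N + n′) + k * n ≡ 2 * ((1 + k) * N) + (k * n + (1 + k) * n′)
  r₄ = solve-∀
  r₅ : ∀ k s n → 2 * (k * s * (n + 2 * n) + n) ≡ 6 * k * s * n + 2 * n
  r₅ = solve-∀
  rest : K * s * (s + 2 * n′) + n′ ≤ n′ * n′
  rest = *-cancelˡ-≤ 2 (begin
    2 * (K * s * (s + 2 * n′) + n′)      ≤⟨ *-monoʳ-≤ 2 (+-monoˡ-≤ n′ (*-monoʳ-≤ (K * s) (+-monoˡ-≤ (2 * n′) s≤n′))) ⟩
    2 * (K * s * (n′ + 2 * n′) + n′)     ≡⟨ r₅ K s n′ ⟩
    6 * K * s * n′ + 2 * n′              ≤⟨ +-mono-≤ (*-monoˡ-≤ n′ small) (*-monoˡ-≤ n′ 2≤n′) ⟩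
    n′ * n′ + n′ * n′                    ≡⟨ cong (n′ * n′ +_) (+-identityʳ (n′ * n′)) ⟨
    2 * (n′ * n′)                        ∎)

-- The square of `1 + 1/(3 κ)` is at most `1 + 1/κ`.
compose-bounds : ∀ κ K N N′ V → 0 < κ → K ≡ 3 * κ → K * N ≤ suc K * N′ → K * N′ ≤ suc K * V → κ * N ≤ suc κ * V
compose-bounds κ@(suc _) K N N′ V 0<κ refl h h′ = *-cancelˡ-≤ (9 * κ) (begin
  9 * κ * (κ * N)                        ≡⟨ r₁ κ N ⟩
  K * (K * N)                            ≤⟨ *-monoʳ-≤ K h ⟩
  K * (suc K * N′)                       ≡⟨ r₂ K (suc K) N′ ⟩
  suc K * (K * N′)                       ≤⟨ *-monoʳ-≤ (suc K) h′ ⟩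
  suc K * (suc K * V)                    ≡⟨ r₃ κ V ⟩
  (9 * κ * κ + 6 * κ + 1) * V            ≤⟨ *-monoˡ-≤ V (+-monoʳ-≤ (9 * κ * κ + 6 * κ) (≤-trans 0<κ (m≤m*n κ 3))) ⟩
  (9 * κ * κ + 6 * κ + κ * 3) * V        ≡⟨ r₄ κ V ⟩
  9 * κ * (suc κ * V)                    ∎)
  where
  open ≤-Reasoning
  r₁ : ∀ k n → 9 * k * (k * n) ≡ 3 * k * (3 * k * n)
  r₁ = solve-∀
  r₂ : ∀ a b n → a * (b * n) ≡ b * (a * n)
  r₂ = solve-∀
  r₃ : ∀ k v → (1 + 3 * k) * ((1 + 3 * k) * v) ≡ (9 * k * k + 6 * k + 1) * v
  r₃ = solve-∀
  r₄ : ∀ k v → (9 * k * k + 6 * k + k * 3) * v ≡ 9 * k * ((1 + k) * v)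
  r₄ = solve-∀

rare-bound : ∀ {c W S x tot} → 0 < S → S * x ≤ W * tot → c * W ≤ S → c * x ≤ tot
rare-bound {c} {W} {S} {x} {tot} 0<S h h′ = *-cancelˡ-≤ S {{>-nonZero 0<S}} (begin
  S * (c * x)      ≡⟨ swap S c x ⟩
  c * (S * x)      ≤⟨ *-monoʳ-≤ c h ⟩
  c * (W * tot)    ≡⟨ *-assoc c W tot ⟨
  c * W * tot      ≤⟨ *-monoˡ-≤ tot h′ ⟩
  S * tot          ∎)
  where
  open ≤-Reasoning
  swap : ∀ m k x → m * (k * x) ≡ k * (m * x)
  swap = solve-∀

-- Solutions with fixed precision

-- Together `lower`, `few` and `upper` place `(n C 2) * count n A` between `1 - 1/K` and `1 + 1/K`
-- times the number of graphs.
record Solution (K n : ℕ) : Set where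
  field
    A         : Graph n → Bool
    f         : Graph n → Graph n
    invariant : ∀ (σ : Fin n ↔ Fin n) G H →
                (∀ i j → adj H (Inverse.to σ i) (Inverse.to σ j) ≡ adj G i j) → A G ≡ A H
    adversary : ∀ G (i j k l : Fin n) → i Fin.< j → k Fin.< l →
                adj G i j ≢ adj (f G) i j → adj G k l ≢ adj (f G) k l → i ≡ k × j ≡ l
    missed    : ℕ
    covered   : 2 ^ (n C 2) ≤ count n (λ G → A (f G)) + missed
    lower     : 2 ^ (n C 2) ≤ (n C 2) * count n A + missed
    few       : K * missed ≤ 2 ^ (n C 2)
    upper     : K * ((n C 2) * count n A) ≤ suc K * 2 ^ (n C 2)

2*nC2+n : ∀ n → 2 * (n C 2) + n ≡ n * n
2*nC2+n zero    = refl
2*nC2+n (suc n) = trans (cong (_+ suc n) (2*nC2 n)) (trans (+-comm (suc n * n) (suc n)) (sym (*-suc (suc n) n)))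

lookup-injective : {A : Set} {xs : List A} → Unique xs → ∀ i j → lookupₗ xs i ≡ lookupₗ xs j → i ≡ j
lookup-injective (x∉ ∷ u) zero    zero    e = refl
lookup-injective (x∉ ∷ u) zero    (suc j) e = contradiction e (All.lookup x∉ (∈-lookup j))
lookup-injective (x∉ ∷ u) (suc i) zero    e = contradiction (sym e) (All.lookup x∉ (∈-lookup i))
lookup-injective (x∉ ∷ u) (suc i) (suc j) e = cong suc (lookup-injective u i j e)

-- Placing the code on pairs of ordinary labels

module Slots (s n′ m Q : ℕ) (room : 2 ^ m * Q ≤ n′ C 2) where

  fits : 2 ^ m * Q ≤ length (edges n′)
  fits = subst (2 ^ m * Q ≤_) (sym (length-edges n′)) room

  position : Vec Bool m × Fin Q → Fin (length (edges n′))
  position (a , h) = inject≤ (combine (fromℕ< (enc<2^k a)) h) fits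

  slot : Vec Bool m × Fin Q → Fin (s + n′) × Fin (s + n′)
  slot x = s ↑ʳ proj₁ (lookupₗ (edges n′) (position x)) , s ↑ʳ proj₂ (lookupₗ (edges n′) (position x))

  slot-high : ∀ x → (s ≤ toℕ (proj₁ (slot x))) × (s ≤ toℕ (proj₂ (slot x)))
  slot-high x = high _ , high _
    where
    high : ∀ (i : Fin n′) → s ≤ toℕ (s ↑ʳ i)
    high i = subst (s ≤_) (sym (Fin.toℕ-↑ʳ s i)) (m≤m+n s (toℕ i))

  ordered : ∀ x → proj₁ (lookupₗ (edges n′) (position x)) Fin.< proj₂ (lookupₗ (edges n′) (position x))
  ordered x = edges-ordered (∈-lookup (position x))

  slot-loop : ∀ x → proj₁ (slot x) ≢ proj₂ (slot x)
  slot-loop x e = <⇒≢ (ordered x) (cong toℕ (Fin.↑ʳ-injective s _ _ e))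

  position-injective : ∀ x y → position x ≡ position y → x ≡ y
  position-injective (a , h) (b , k) e = cong₂ _,_
    (enc-injective a b (trans (sym (Fin.toℕ-fromℕ< (enc<2^k a))) (trans (cong toℕ (proj₁ both)) (Fin.toℕ-fromℕ< (enc<2^k b)))))
    (proj₂ both)
    where
    both : fromℕ< (enc<2^k a) ≡ fromℕ< (enc<2^k b) × h ≡ k
    both = Fin.combine-injective _ h _ k (Fin.inject≤-injective fits fits _ _ e)

  slot-inj : ∀ x y → SameEdge (proj₁ (slot x)) (proj₂ (slot x)) (proj₁ (slot y)) (proj₂ (slot y)) → x ≡ y
  slot-inj x y (inj₁ (e , e′)) = position-injective x y (lookup-injective (edges-unique n′) _ _
    (cong₂ _,_ (Fin.↑ʳ-injective s _ _ e) (Fin.↑ʳ-injective s _ _ e′)))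
  slot-inj x y (inj₂ (e , e′)) = contradiction (ordered x) (<-asym (subst₂ ℕ._<_
    (sym (cong toℕ (Fin.↑ʳ-injective s _ _ e′))) (sym (cong toℕ (Fin.↑ʳ-injective s _ _ e))) (ordered y)))

-- Exponents in the union bound

module Logs (E ℓ L n s : ℕ) (0<E : 0 < E) (0<L : 0 < L) (n≤ : n ≤ E * s + E)
  (big : (E * ℓ + E + 16 * (E * E) + ℓ) * (L * L) ≤ n) where
  open ≤-Reasoning

  -- As `s` is about `n / E`, the product `b * s` is about `2 * L * n`, twice the exponent of the
  -- bound `2 ^ (L * n)` for the number of value vectors.
  b : ℕ
  b = 2 * (E * L)

  1≤LL : 1 ≤ L * L
  1≤LL = *-mono-≤ 0<L 0<L

  1≤EL : 1 ≤ E * L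
  1≤EL = *-mono-≤ 0<E 0<L

  -- Both `n` and 2 are raised to the power `2 + b * 3`, hence `suc L`. The coefficient 16 in `big`
  -- comes from here.
  twins-exponent : ℓ + suc L * (2 + b * 3) ≤ s
  twins-exponent = +-cancelˡ-≤ 1 _ _ (*-cancelˡ-≤ E {{>-nonZero 0<E}} (begin
    E * (1 + (ℓ + suc L * (2 + b * 3)))                                  ≡⟨ r₁ E ℓ (suc L) (E * L) ⟩
    (E + E * ℓ) * 1 + E * (suc L * (2 * 1 + 6 * (E * L)))                ≤⟨ +-mono-≤ (*-monoʳ-≤ (E + E * ℓ) 1≤LL)
                                                                              (*-monoʳ-≤ E (*-mono-≤ (+-monoˡ-≤ L 0<L) (+-monoˡ-≤ (6 * (E * L)) (*-monoʳ-≤ 2 1≤EL)))) ⟩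
    (E + E * ℓ) * (L * L) + E * ((L + L) * (2 * (E * L) + 6 * (E * L)))  ≤⟨ m≤m+n _ (ℓ * (L * L)) ⟩
    (E + E * ℓ) * (L * L) + E * ((L + L) * (2 * (E * L) + 6 * (E * L))) + ℓ * (L * L) ≡⟨ r₂ E ℓ L ⟩
    (E * ℓ + E + 16 * (E * E) + ℓ) * (L * L)                             ≤⟨ big ⟩
    n                                                                    ≤⟨ n≤ ⟩
    E * s + E                                                            ≡⟨ r₃ E s ⟩
    E * (1 + s)                                                          ∎))
    where
    r₁ : ∀ E l L x → E * (1 + (l + L * (2 + 2 * x * 3))) ≡ (E + E * l) * 1 + E * (L * (2 * 1 + 6 * x))
    r₁ = solve-∀
    r₂ : ∀ E l L → (E + E * l) * (L * L) + E * ((L + L) * (2 * (E * L) + 6 * (E * L))) + l * (L * L) ≡ (E * l + E + 16 * (E * E) + l) * (L * L)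
    r₂ = solve-∀
    r₃ : ∀ E s → E * s + E ≡ E * (1 + s)
    r₃ = solve-∀

  -- Rounding in `s` lowers `b * s` below `2 * (L * n)` by at most `2 * (L * E)`. A surplus of
  -- `L * n` over the leading term remains, and by `big` it absorbs all terms of order `L * L`.
  shifted-exponent : ℓ + (L * (b + (b + n)) + b * (b + b)) ≤ b * s
  shifted-exponent = +-cancelʳ-≤ (2 * (L * E)) _ _ (begin
    ℓ + (L * (b + (b + n)) + b * (b + b)) + 2 * (L * E)                       ≡⟨ r₁ E ℓ L n ⟩
    L * n + (ℓ * 1 + 4 * (E * 1) * (L * L) + 8 * (E * E) * (L * L) + 2 * (L * 1) * (E * 1)) ≤⟨ +-monoʳ-≤ (L * n) (+-mono-≤ (+-monoˡ-≤ _ (+-mono-≤ (*-monoʳ-≤ ℓ 1≤LL)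
                                                                                      (*-monoˡ-≤ (L * L) (*-monoʳ-≤ 4 (*-monoʳ-≤ E 0<E))))) (*-mono-≤ (*-monoʳ-≤ 2 (*-monoʳ-≤ L 0<L)) (*-monoʳ-≤ E 0<E))) ⟩
    L * n + (ℓ * (L * L) + 4 * (E * E) * (L * L) + 8 * (E * E) * (L * L) + 2 * (L * L) * (E * E)) ≤⟨ +-monoʳ-≤ (L * n) (m≤m+n _ ((E * ℓ + E + 2 * (E * E)) * (L * L))) ⟩
    L * n + (ℓ * (L * L) + 4 * (E * E) * (L * L) + 8 * (E * E) * (L * L) + 2 * (L * L) * (E * E) + (E * ℓ + E + 2 * (E * E)) * (L * L)) ≡⟨ cong (L * n +_) (r₂ E ℓ (L * L)) ⟩
    L * n + 1 * ((E * ℓ + E + 16 * (E * E) + ℓ) * (L * L))                    ≤⟨ +-monoʳ-≤ (L * n) (*-mono-≤ 0<L big) ⟩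
    L * n + L * n                                                             ≡⟨ cong (L * n +_) (+-identityʳ (L * n)) ⟨
    2 * (L * n)                                                               ≤⟨ *-monoʳ-≤ 2 (*-monoʳ-≤ L n≤) ⟩
    2 * (L * (E * s + E))                                                     ≡⟨ r₃ E L s ⟩
    b * s + 2 * (L * E)                                                       ∎)
    where
    r₁ : ∀ E l L n → l + (L * (2 * (E * L) + (2 * (E * L) + n)) + 2 * (E * L) * (2 * (E * L) + 2 * (E * L))) + 2 * (L * E) ≡
         L * n + (l * 1 + 4 * (E * 1) * (L * L) + 8 * (E * E) * (L * L) + 2 * (L * 1) * (E * 1))
    r₁ = solve-∀
    r₂ : ∀ E l x → l * x + 4 * (E * E) * x + 8 * (E * E) * x + 2 * x * (E * E) + (E * l + E + 2 * (E * E)) * x ≡ 1 * ((E * l + E + 16 * (E * E) + l) * x)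
    r₂ = solve-∀
    r₃ : ∀ E L s → 2 * (L * (E * s + E)) ≡ 2 * (E * L) * s + 2 * (L * E)
    r₃ = solve-∀

power-bound : ∀ {c ℓ n L k e S} → c ≤ 2 ^ ℓ → n ≤ 2 ^ L → ℓ + (L * k + e) ≤ S → c * (n ^ k * 2 ^ e) ≤ 2 ^ S
power-bound {c} {ℓ} {n} {L} {k} {e} {S} c≤ n≤ le = begin
  c * (n ^ k * 2 ^ e)                ≤⟨ *-mono-≤ c≤ (*-monoˡ-≤ (2 ^ e) (^-monoˡ-≤ k n≤)) ⟩
  2 ^ ℓ * ((2 ^ L) ^ k * 2 ^ e)      ≡⟨ cong (λ z → 2 ^ ℓ * (z * 2 ^ e)) (^-*-assoc 2 L k) ⟩
  2 ^ ℓ * (2 ^ (L * k) * 2 ^ e)      ≡⟨ cong (2 ^ ℓ *_) (^-distribˡ-+-* 2 (L * k) e) ⟨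
  2 ^ ℓ * 2 ^ (L * k + e)            ≡⟨ ^-distribˡ-+-* 2 ℓ (L * k + e) ⟨
  2 ^ (ℓ + (L * k + e))              ≤⟨ ^-monoʳ-≤ 2 le ⟩
  2 ^ S                              ∎
  where open ≤-Reasoning

nonrigid-bound : ∀ n s (s≤n : s ≤ n) lam E ℓ L → 2 * lam ≤ 2 ^ ℓ → 0 < E → 0 < L → n ≤ E * s + E → n ≤ 2 ^ L →
  (E * ℓ + E + 16 * (E * E) + ℓ) * (L * L) ≤ n →
  lam * Rarity.nonrigid n s s≤n ≤ 2 ^ (n C 2)
nonrigid-bound n s s≤n lam E ℓ L lam≤ 0<E 0<L n≤ n≤2^L big = conclude (Rarity.nonrigid-rare n s s≤n b)
  where
  open Logs E ℓ L n s 0<E 0<L n≤ big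
  tot = 2 ^ (n C 2)
  conclude : (∃[ x ] ∃[ y ] (Rarity.nonrigid n s s≤n ≤ x + y
    × 2 ^ s * x ≤ n ^ (2 + b * 3) * (2 ^ (2 + b * 3) * tot)
    × 2 ^ (b * s) * y ≤ n ^ (b + (b + n)) * (2 ^ (b * (b + b)) * tot))) →
    lam * Rarity.nonrigid n s s≤n ≤ tot
  conclude (x , y , le , hx , hy) = *-cancelˡ-≤ 2 (begin
    2 * (lam * Rarity.nonrigid n s s≤n)   ≡⟨ *-assoc 2 lam _ ⟨
    2 * lam * Rarity.nonrigid n s s≤n     ≤⟨ *-monoʳ-≤ (2 * lam) le ⟩
    2 * lam * (x + y)                     ≡⟨ *-distribˡ-+ (2 * lam) x y ⟩
    2 * lam * x + 2 * lam * y             ≤⟨ +-mono-≤ boundx boundy ⟩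
    tot + tot                             ≡⟨ cong (tot +_) (+-identityʳ tot) ⟨
    2 * tot                               ∎)
    where
    open ≤-Reasoning
    boundx : 2 * lam * x ≤ tot
    boundx = rare-bound {c = 2 * lam} {W = n ^ (2 + b * 3) * 2 ^ (2 + b * 3)} (m^n>0 2 s)
      (≤-trans hx (≤-reflexive (sym (*-assoc (n ^ (2 + b * 3)) (2 ^ (2 + b * 3)) tot))))
      (power-bound {ℓ = ℓ} {L = L} {k = 2 + b * 3} {e = 2 + b * 3} lam≤ n≤2^L
        (≤-trans (≤-reflexive (cong (ℓ +_) (+-comm (L * (2 + b * 3)) (2 + b * 3)))) twins-exponent))
    boundy : 2 * lam * y ≤ tot
    boundy = rare-bound {c = 2 * lam} {W = n ^ (b + (b + n)) * 2 ^ (b * (b + b))} (m^n>0 2 (b * s))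
      (≤-trans hy (≤-reflexive (sym (*-assoc (n ^ (b + (b + n))) (2 ^ (b * (b + b))) tot))))
      (power-bound {ℓ = ℓ} {L = L} {k = b + (b + n)} {e = b * (b + b)} lam≤ n≤2^L shifted-exponent)

module Build (K s n′ : ℕ) (0<K : 0 < K) (m p j : ℕ) (p-prime : Prime p)
  (room : 2 ^ m * p ^ j ≤ n′ C 2)
  (dense : 5 * K * ((s + n′) C 2) ≤ suc (5 * K) * (2 ^ m * p ^ j))
  (hp : 5 * (5 * K) ≤ p)
  (hQ : 5 * (5 * K) * p ^ j ≤ 2 ^ m)
  (hs : 5 * (5 * K) * (2 * (s * (s + n′))) ≤ 2 ^ m * p ^ j)
  (hr : 5 * (5 * K) * Rarity.nonrigid (s + n′) s (m≤m+n s n′) ≤ 2 ^ ((s + n′) C 2))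
  where

  n κ lam Q q V : ℕ
  n = s + n′
  κ = 5 * K
  lam = 5 * κ
  Q = p ^ j
  instance
    p≢0 : NonZero p
    p≢0 = prime⇒nonZero p-prime
    Q≢0 : NonZero Q
    Q≢0 = m^n≢0 p j
  -- A multiple of `Q`, as the code requires, lying between `2 ^ m` and `2 ^ m + Q`.
  q = suc (2 ^ m /ₙ Q) * Q
  V = 2 ^ m * Q
  instance
    q≢0 : NonZero q
    q≢0 = m*n≢0 (suc (2 ^ m /ₙ Q)) Q

  2^m≤q : 2 ^ m ≤ q
  2^m≤q = begin
    2 ^ m                              ≡⟨ m≡m%n+[m/n]*n (2 ^ m) Q ⟩
    2 ^ m % Q + 2 ^ m /ₙ Q * Q          ≤⟨ +-monoˡ-≤ (2 ^ m /ₙ Q * Q) (<⇒≤ (m%n<n (2 ^ m) Q)) ⟩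
    q                                  ∎
    where open ≤-Reasoning

  q≤ : q ≤ 2 ^ m + Q
  q≤ = ≤-trans (+-monoʳ-≤ Q (m/n*n≤m (2 ^ m) Q)) (≤-reflexive (+-comm Q (2 ^ m)))

  open Slots s n′ m Q room
  open Covering n s (m≤m+n s n′) m Q q p j p-prime refl (n∣m*n (suc (2 ^ m /ₙ Q))) 2^m≤q slot slot-high slot-loop slot-inj
    using (M; N; tot; Δtot; Δtot-bound; some-colour; a; u; module Property)

  1≤Q : 1 ≤ Q
  1≤Q = >-nonZero⁻¹ Q

  V≤M : V ≤ M
  V≤M = *-monoˡ-≤ Q 2^m≤q

  few-missing : κ * Δtot ≤ M * tot
  few-missing = missing-bound κ lam V M Q (2 ^ m /ₙ p) (2 * (s * n)) (Rarity.nonrigid n s (m≤m+n s n′)) tot Δtot refl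
    Δtot-bound
    (≤-trans (*-monoˡ-≤ Q q≤) (≤-reflexive (*-distribʳ-+ Q (2 ^ m) Q)))
    V≤M
    (≤-trans (≤-reflexive (sym (*-assoc lam Q Q))) (*-monoˡ-≤ Q hQ))
    (≤-trans hQ (m≤m*n (2 ^ m) Q))
    (begin
      lam * (Q * (2 ^ m /ₙ p))       ≡⟨ swap lam Q (2 ^ m /ₙ p) ⟩
      2 ^ m /ₙ p * lam * Q           ≤⟨ *-monoˡ-≤ Q (*-monoʳ-≤ (2 ^ m /ₙ p) hp) ⟩
      2 ^ m /ₙ p * p * Q             ≤⟨ *-monoˡ-≤ Q (m/n*n≤m (2 ^ m) p) ⟩
      V                             ∎)
    hs hr
    where
    open ≤-Reasoning
    swap : ∀ l q w → l * (q * w) ≡ w * l * q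
    swap = solve-∀

  denseM : κ * N ≤ suc κ * M
  denseM = ≤-trans dense (*-monoʳ-≤ (suc κ) V≤M)

  t : ℕ × ℕ
  t = proj₁ some-colour

  average : κ * (M * a t + 2 * u t) ≤ (2 + κ) * tot
  average = average-bound κ M tot Δtot (M * a t + 2 * u t) (*-mono-≤ (>-nonZero⁻¹ q) 1≤Q) (proj₂ some-colour) few-missing

  open Property t

  solution : Solution K n
  solution = record
    { A = A ; f = f ; invariant = A-invariant ; adversary = f-adversary ; missed = u t
    ; covered = covered
    ; lower = subst (λ z → tot ≤ N * z + u t) (sym count-A) lower
    ; few = *-cancelˡ-≤ 5 (begin
        5 * (K * u t)    ≡⟨ *-assoc 5 K (u t) ⟨
        κ * u t          ≤⟨ uncovered-bound κ M N tot (a t) (u t) average lower denseM ⟩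
        3 * tot          ≤⟨ *-monoˡ-≤ tot {3} {5} (s≤s (s≤s (s≤s z≤n))) ⟩
        5 * tot          ∎)
    ; upper = subst (λ z → K * (N * z) ≤ suc K * tot) (sym count-A)
        (density-bound K κ M N tot (a t) 0<K refl (≤-trans (*-monoʳ-≤ κ (m≤m+n (M * a t) (2 * u t))) average) denseM)
    }
    where open ≤-Reasoning

n≤nC2 : ∀ n → 3 ≤ n → n ≤ n C 2
n≤nC2 n 3≤n = *-cancelˡ-≤ 2 (+-cancelʳ-≤ n (2 * n) (2 * (n C 2)) (begin
  2 * n + n          ≡⟨ ring n ⟩
  3 * n              ≤⟨ *-monoˡ-≤ n 3≤n ⟩
  n * n              ≡⟨ 2*nC2+n n ⟨
  2 * (n C 2) + n    ∎))
  where
  open ≤-Reasoning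
  ring : ∀ n → 2 * n + n ≡ 3 * n
  ring = solve-∀

halve : ∀ κ N V → 0 < κ → κ * N ≤ suc κ * V → N ≤ 2 * V
halve κ N V 0<κ h = *-cancelˡ-≤ κ {{>-nonZero 0<κ}} (begin
  κ * N          ≤⟨ h ⟩
  suc κ * V      ≤⟨ *-monoˡ-≤ V (+-monoˡ-≤ κ 0<κ) ⟩
  (κ + κ) * V    ≡⟨ ring κ V ⟩
  κ * (2 * V)    ∎)
  where
  open ≤-Reasoning
  ring : ∀ k v → (k + k) * v ≡ k * (2 * v)
  ring = solve-∀

-- Choice of the parameters

module Parameters (K : ℕ) (0<K : 0 < K) (p : ℕ) (p-prime : Prime p) (p> : 2 + 5 * (5 * K) < p)
  (R B : ℕ)
  (approx : ∀ N → B ≤ N → ∃[ m ] ∃[ j ]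
    (p ^ j ≤ R × 2 ^ m * p ^ j ≤ N × 3 * (5 * K) * N ≤ suc (3 * (5 * K)) * (2 ^ m * p ^ j))) where

  lam E ℓ cst threshold : ℕ
  lam = 5 * (5 * K)
  -- Relabelling may spoil `2 * (s * n)` pairs, and `lam` times this must stay below `V`. As
  -- `E * s ≤ n` and `n * n ≤ 4 * N ≤ 8 * V`, the factor is `2 * 8`.
  E = 16 * lam
  ℓ = 2 * lam
  cst = E * ℓ + E + 16 * (E * E) + ℓ
  -- The first summand is for `log-square`. The second makes `n′`, which is at least half of `n`,
  -- large enough for the approximation and for `lam * Q ≤ 2 ^ m`.
  threshold = 2 ^ (27 * cst) + 2 * (B + 2 * (lam * (R * R)) + 3)

  0<lam : 0 < lam
  0<lam = *-mono-≤ {1} {5} (s≤s z≤n) (*-mono-≤ {1} {5} (s≤s z≤n) 0<K)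

  0<E : 0 < E
  0<E = *-mono-≤ {1} {16} (s≤s z≤n) 0<lam

  0<κ : 0 < 5 * K
  0<κ = *-mono-≤ {1} {5} (s≤s z≤n) 0<K

  module Split (s n′ : ℕ) (Es≤n : E * s ≤ s + n′) (n≤Es+E : s + n′ ≤ E * s + E) (large : threshold ≤ s + n′) where
    open ≤-Reasoning

    n N N′ : ℕ
    n = s + n′
    N = n C 2
    N′ = n′ C 2

    s≤K*s : ∀ c → s ≤ suc c * K * s
    s≤K*s c = begin
      s               ≡⟨ *-identityˡ s ⟨
      1 * s           ≤⟨ *-monoˡ-≤ s (*-mono-≤ {1} {suc c} (s≤s z≤n) 0<K) ⟩
      suc c * K * s   ∎

    small : 6 * (3 * (5 * K)) * s ≤ n′
    small = +-cancelˡ-≤ s _ _ (begin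
      -- `E` equals `400 * K`: the discarding bound takes `90 * K`, and the remaining `310 * K` pays
      -- for the single `s`.
      s + 6 * (3 * (5 * K)) * s             ≤⟨ +-monoˡ-≤ _ (s≤K*s 309) ⟩
      310 * K * s + 6 * (3 * (5 * K)) * s   ≡⟨ ring K s ⟩
      E * s                                 ≤⟨ Es≤n ⟩
      s + n′                                ∎)
      where
      ring : ∀ k s → 310 * k * s + 6 * (3 * (5 * k)) * s ≡ 16 * (5 * (5 * k)) * s
      ring = solve-∀

    s≤n′ : s ≤ n′
    s≤n′ = ≤-trans (≤-trans (s≤K*s 89) (≤-reflexive (ring K s))) small
      where
      ring : ∀ k s → 90 * k * s ≡ 6 * (3 * (5 * k)) * s
      ring = solve-∀

    n′-large : B + 2 * (lam * (R * R)) + 3 ≤ n′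
    n′-large = *-cancelˡ-≤ 2 (begin
      2 * (B + 2 * (lam * (R * R)) + 3)   ≤⟨ m≤n+m _ (2 ^ (27 * cst)) ⟩
      threshold                           ≤⟨ large ⟩
      s + n′                              ≤⟨ +-monoˡ-≤ n′ s≤n′ ⟩
      n′ + n′                             ≡⟨ cong (n′ +_) (+-identityʳ n′) ⟨
      2 * n′                              ∎)

    3≤n′ : 3 ≤ n′
    3≤n′ = ≤-trans (m≤n+m 3 _) n′-large

    N′-large : B + 2 * (lam * (R * R)) ≤ N′
    N′-large = ≤-trans (≤-trans (m≤m+n _ 3) n′-large) (n≤nC2 n′ 3≤n′)

    solve-with : (∃[ m ] ∃[ j ] (p ^ j ≤ R × 2 ^ m * p ^ j ≤ N′ × 3 * (5 * K) * N′ ≤ suc (3 * (5 * K)) * (2 ^ m * p ^ j))) →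
      (∃[ L ] (0 < L × n ≤ 2 ^ L × cst * (L * L) ≤ n)) → Solution K n
    solve-with (m , j , Q≤R , room , close) (L , 0<L , n≤2^L , LL≤n) =
      Build.solution K s n′ 0<K m p j p-prime room dense (≤-trans (m≤n+m lam 2) (<⇒≤ p>)) hQ hs
        (nonrigid-bound n s (m≤m+n s n′) lam E ℓ L (<⇒≤ (n<2^n ℓ)) 0<E 0<L n≤Es+E n≤2^L LL≤n)
      where
      V = 2 ^ m * p ^ j
      instance
        p≢0 : NonZero p
        p≢0 = prime⇒nonZero p-prime
      dense : 5 * K * N ≤ suc (5 * K) * V
      dense = compose-bounds (5 * K) (3 * (5 * K)) N N′ V 0<κ refl
        (discard-bound (3 * (5 * K)) s n′ N N′ (2*nC2+n n) (2*nC2+n n′) small s≤n′ (≤-trans (s≤s (s≤s z≤n)) 3≤n′))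
        close
      hQ : lam * p ^ j ≤ 2 ^ m
      hQ = ≤-trans (*-monoʳ-≤ lam Q≤R) (*-cancelˡ-≤ (2 * R) {{m*n≢0 2 R {{_}} {{>-nonZero (≤-trans (m^n>0 p j) Q≤R)}}}} (begin
        2 * R * (lam * R)            ≡⟨ r₁ R lam ⟩
        2 * (lam * (R * R))          ≤⟨ m≤n+m _ B ⟩
        B + 2 * (lam * (R * R))      ≤⟨ N′-large ⟩
        N′                           ≤⟨ halve (3 * (5 * K)) N′ V (*-mono-≤ {1} {3} (s≤s z≤n) 0<κ) close ⟩
        2 * (2 ^ m * p ^ j)          ≤⟨ *-monoʳ-≤ 2 (*-monoʳ-≤ (2 ^ m) Q≤R) ⟩
        2 * (2 ^ m * R)              ≡⟨ r₂ (2 ^ m) R ⟩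
        2 * R * 2 ^ m                ∎))
        where
        r₁ : ∀ r l → 2 * r * (l * r) ≡ 2 * (l * (r * r))
        r₁ = solve-∀
        r₂ : ∀ a r → 2 * (a * r) ≡ 2 * r * a
        r₂ = solve-∀
      hs : lam * (2 * (s * n)) ≤ V
      hs = *-cancelˡ-≤ 8 (begin
        8 * (lam * (2 * (s * n)))    ≡⟨ r₁ lam s n ⟩
        E * s * n                    ≤⟨ *-monoˡ-≤ n Es≤n ⟩
        n * n                        ≡⟨ 2*nC2+n n ⟨
        2 * N + n                    ≤⟨ +-monoʳ-≤ (2 * N) (≤-trans (n≤nC2 n (≤-trans 3≤n′ (m≤n+m n′ s))) (m≤n*m N 2)) ⟩
        2 * N + 2 * N                ≤⟨ +-mono-≤ (*-monoʳ-≤ 2 N≤2V) (*-monoʳ-≤ 2 N≤2V) ⟩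
        2 * (2 * V) + 2 * (2 * V)    ≡⟨ r₂ V ⟩
        8 * V                        ∎)
        where
        N≤2V : N ≤ 2 * V
        N≤2V = halve (5 * K) N V 0<κ dense
        r₁ : ∀ l s n → 8 * (l * (2 * (s * n))) ≡ 16 * l * s * n
        r₁ = solve-∀
        r₂ : ∀ v → 2 * (2 * v) + 2 * (2 * v) ≡ 8 * v
        r₂ = solve-∀

    result : Solution K n
    result = solve-with (approx N′ (≤-trans (m≤m+n B _) N′-large)) (log-square cst n (≤-trans (m≤m+n _ _) large))

  solution : ∀ n → threshold ≤ n → Solution K n
  solution n large = subst (Solution K) (m+[n∸m]≡n s≤n) (Split.result s (n ∸ s)
    (subst (E * s ≤_) (sym (m+[n∸m]≡n s≤n)) (≤-trans (≤-reflexive (*-comm E s)) (m/n*n≤m n E)))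
    (subst (_≤ E * s + E) (sym (m+[n∸m]≡n s≤n)) upper)
    (subst (threshold ≤_) (sym (m+[n∸m]≡n s≤n)) large))
    where
    open ≤-Reasoning
    instance
      E≢0 : NonZero E
      E≢0 = >-nonZero 0<E
    s = n /ₙ E
    s≤n : s ≤ n
    s≤n = m/n≤m n E
    upper : n ≤ E * s + E
    upper = begin
      n                  ≡⟨ m≡m%n+[m/n]*n n E ⟩
      n % E + s * E      ≤⟨ +-monoˡ-≤ (s * E) (<⇒≤ (m%n<n n E)) ⟩
      E + s * E          ≡⟨ ring E s ⟩
      E * s + E          ∎
      where
      ring : ∀ e s → e + s * e ≡ e * s + e
      ring = solve-∀

eventually : ∀ K → 0 < K → ∃[ N₀ ] (∀ n → N₀ ≤ n → Solution K n)
eventually K 0<K = with-prime (prime-above (2 + 5 * (5 * K)))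
  where
  with-prime : (∃[ p ] (Prime p × 2 + 5 * (5 * K) < p)) → ∃[ N₀ ] (∀ n → N₀ ≤ n → Solution K n)
  with-prime (p , p-prime , p>) = with-approx (approximation p-prime (≤-<-trans (m≤m+n 2 _) p>) (3 * (5 * K)))
    where
    with-approx : (∃[ R ] ∃[ B ] (∀ N → B ≤ N → ∃[ m ] ∃[ j ]
      (p ^ j ≤ R × 2 ^ m * p ^ j ≤ N × 3 * (5 * K) * N ≤ suc (3 * (5 * K)) * (2 ^ m * p ^ j)))) →
      ∃[ N₀ ] (∀ n → N₀ ≤ n → Solution K n)
    with-approx (R , B , approx) = Parameters.threshold K 0<K p p-prime p> R B approx , Parameters.solution K 0<K p p-prime p> R B approx

-- Passage to the limit

record Bounds (K n : ℕ) (A : Graph n → Bool) (f : Graph n → Graph n) : Set where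
  field
    missed  : ℕ
    covered : 2 ^ (n C 2) ≤ count n (λ G → A (f G)) + missed
    lower   : 2 ^ (n C 2) ≤ (n C 2) * count n A + missed
    few     : K * missed ≤ 2 ^ (n C 2)
    upper   : K * ((n C 2) * count n A) ≤ suc K * 2 ^ (n C 2)

-- The thresholds are enormous; from here on only `solutionAt` is known about them.
abstract
  threshold : ℕ → ℕ
  threshold k = proj₁ (eventually (suc k) (s≤s z≤n))

  solutionAt : ∀ k n → threshold k ≤ n → Solution (suc k) n
  solutionAt k = proj₂ (eventually (suc k) (s≤s z≤n))

-- One class must serve every precision `k ≤ b` whose threshold `n` has passed. Thresholds are not
-- known to increase with `k`, so the search descends from `b` to the first one passed; its solution
-- is fine enough for all smaller `k`.
record Choice (n b : ℕ) : Set where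
  field
    A         : Graph n → Bool
    f         : Graph n → Graph n
    invariant : ∀ (σ : Fin n ↔ Fin n) G H →
                (∀ i j → adj H (Inverse.to σ i) (Inverse.to σ j) ≡ adj G i j) → A G ≡ A H
    adversary : ∀ G (i j k l : Fin n) → i Fin.< j → k Fin.< l →
                adj G i j ≢ adj (f G) i j → adj G k l ≢ adj (f G) k l → i ≡ k × j ≡ l
    bounds    : ∀ k → k ≤ b → threshold k ≤ n → ∃[ K ] (k < K × Bounds K n A f)

fromSolution : ∀ {n b} → Solution (suc b) n → Choice n b
fromSolution {b = b} sol = record
  { A = A ; f = f ; invariant = invariant ; adversary = adversary
  ; bounds = λ k k≤b _ → suc b , s≤s k≤b , record { missed = missed ; covered = covered ; lower = lower ; few = few ; upper = upper }
  }
  where open Solution sol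

fallback : ∀ {n} → ¬ threshold 0 ≤ n → Choice n 0
fallback ¬le = record
  { A = λ _ → false ; f = λ G → G ; invariant = λ _ _ _ _ → refl
  ; adversary = λ _ _ _ _ _ _ _ ne _ → contradiction refl ne
  ; bounds = λ { zero z≤n le → contradiction le ¬le } }

skip : ∀ {n b} → ¬ threshold (suc b) ≤ n → Choice n b → Choice n (suc b)
skip ¬le c = record
  { A = A ; f = f ; invariant = invariant ; adversary = adversary
  ; bounds = λ k k≤ le → bounds k (≤-pred (≤∧≢⇒< k≤ λ { refl → ¬le le })) le }
  where open Choice c

decide : ∀ {n b} → (¬ threshold b ≤ n → Choice n b) → Dec (threshold b ≤ n) → Choice n b
decide {n} {b} _    (yes le) = fromSolution (solutionAt b n le)
decide         else (no ¬le) = else ¬le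

choose : ∀ n b → Choice n b
choose n zero    = decide fallback (threshold 0 ≤? n)
choose n (suc b) = decide (λ ¬le → skip ¬le (choose n b)) (threshold (suc b) ≤? n)

∣∣<⇐ : ∀ {z y} → z <ℤ y → neg z <ℤ y → pos ∣ z ∣ <ℤ y
∣∣<⇐ {pos _}     h _ = h
∣∣<⇐ { -[1+ _ ]} _ h = h

-- A positive `ε` is at least the reciprocal of its denominator `D`, so a distance below `1 / D`
-- suffices; the two hypotheses say this with fractions cleared.
near : ∀ x t .{{_ : NonZero t}} c (ε : ℚ) → 0ℚ <ℚ ε →
  ℚ.denominatorℕ ε * x < ℚ.denominatorℕ ε * (c * t) + t →
  ℚ.denominatorℕ ε * (c * t) < ℚ.denominatorℕ ε * x + t →
  ∣ (pos x / t) -ℚ (pos c / 1) ∣ℚ <ℚ ε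
near x zero c ε _ _ _ = contradiction refl (≢-nonZero⁻¹ 0)
near x (suc t) c (mkℚ (pos zero) d _) (*<* (ℤ.+<+ ())) _ _
near x (suc t) c (mkℚ -[1+ e ] d _) (*<* ()) _ _
near x (suc t) c ε@(mkℚ (pos (suc e)) d _) _ below above =
  ℚₚ.toℚᵘ-cancel-< (ℚᵘₚ.<-respˡ-≃ (ℚᵘₚ.≃-sym eq) (*<* main))
  where
  T D : ℤ
  T = pos (suc t)
  D = pos (suc d)
  Z : ℤ
  Z = pos x *ℤ pos 1 +ℤ (neg (pos c)) *ℤ T
  eq : toℚᵘ ∣ (pos x / suc t) -ℚ (pos c / 1) ∣ℚ ≃ᵘ ∣ mkℚᵘ (pos x) t +ᵘ (-ᵘ mkℚᵘ (pos c) 0) ∣ᵘ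
  eq = ℚᵘₚ.≃-trans (ℚₚ.toℚᵘ-homo-∣-∣ ((pos x / suc t) -ℚ (pos c / 1))) (ℚᵘₚ.∣-∣-cong
    (ℚᵘₚ.≃-trans (ℚₚ.toℚᵘ-homo-+ (pos x / suc t) (-ℚ (pos c / 1)))
      (ℚᵘₚ.+-cong (ℚₚ.toℚᵘ-fromℚᵘ (mkℚᵘ (pos x) t))
        (ℚᵘₚ.≃-trans (ℚₚ.toℚᵘ-homo‿- (pos c / 1)) (ℚᵘₚ.-‿cong (ℚₚ.toℚᵘ-fromℚᵘ (mkℚᵘ (pos c) 0)))))))
  gap : ∀ a b → suc d * a < suc d * b + suc t → (pos a -ℤ pos b) *ℤ D <ℤ pos (suc e) *ℤ pos (suc t * 1)
  gap a b h = ℤ.<-≤-trans (subst₂ _<ℤ_ lhs rhs (ℤ.+-monoˡ-< (neg (pos (suc d * b))) (ℤ.+<+ h)))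
    (subst (pos (suc t) ≤ℤ_) (ℤ.pos-* (suc e) (suc t * 1))
      (ℤ.+≤+ (≤-trans (≤-reflexive (sym (*-identityʳ (suc t)))) (m≤n*m (suc t * 1) (suc e)))))
    where
    ring₁ : ∀ a b d → d *ℤ a -ℤ d *ℤ b ≡ (a -ℤ b) *ℤ d
    ring₁ = ℤ-Solver.solve-∀
    ring₂ : ∀ u v → (u +ℤ v) -ℤ u ≡ v
    ring₂ = ℤ-Solver.solve-∀
    lhs : pos (suc d * a) -ℤ pos (suc d * b) ≡ (pos a -ℤ pos b) *ℤ D
    lhs = trans (cong₂ _-ℤ_ (ℤ.pos-* (suc d) a) (ℤ.pos-* (suc d) b)) (ring₁ (pos a) (pos b) D)
    rhs : pos (suc d * b + suc t) -ℤ pos (suc d * b) ≡ pos (suc t)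
    rhs = trans (cong (_-ℤ pos (suc d * b)) (ℤ.pos-+ (suc d * b) (suc t))) (ring₂ (pos (suc d * b)) (pos (suc t)))
  Z≡ : Z ≡ pos x -ℤ pos (c * suc t)
  Z≡ = trans (ring (pos x) (pos c) T) (cong (pos x -ℤ_) (sym (ℤ.pos-* c (suc t))))
    where
    ring : ∀ x c t → x *ℤ pos 1 +ℤ (neg c) *ℤ t ≡ x -ℤ c *ℤ t
    ring = ℤ-Solver.solve-∀
  main : pos ∣ Z ∣ *ℤ D <ℤ pos (suc e) *ℤ pos (suc t * 1)
  main = subst (_<ℤ pos (suc e) *ℤ pos (suc t * 1)) (trans (cong pos (ℤ.abs-* Z D)) (ℤ.pos-* ∣ Z ∣ (suc d)))
    (∣∣<⇐ (subst (λ z → z *ℤ D <ℤ pos (suc e) *ℤ pos (suc t * 1)) (sym Z≡) (gap x (c * suc t) below))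
      (subst (_<ℤ pos (suc e) *ℤ pos (suc t * 1)) flip (gap (c * suc t) x above)))
    where
    ring : ∀ a b d → (b -ℤ a) *ℤ d ≡ neg ((a -ℤ b) *ℤ d)
    ring = ℤ-Solver.solve-∀
    flip : (pos (c * suc t) -ℤ pos x) *ℤ D ≡ neg (Z *ℤ D)
    flip = trans (ring (pos x) (pos (c * suc t)) D) (cong (λ z → neg (z *ℤ D)) (sym Z≡))

*-/ : ∀ k x t .{{_ : NonZero t}} → (pos k / 1) *ℚ (pos x / t) ≡ pos (k * x) / t
*-/ k x zero = contradiction refl (≢-nonZero⁻¹ 0)
*-/ k x (suc t) = ℚₚ.toℚᵘ-injective (ℚᵘₚ.≃-trans (ℚₚ.toℚᵘ-homo-* (pos k / 1) (pos x / suc t))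
  (ℚᵘₚ.≃-trans (ℚᵘₚ.*-cong (ℚₚ.toℚᵘ-fromℚᵘ (mkℚᵘ (pos k) 0)) (ℚₚ.toℚᵘ-fromℚᵘ (mkℚᵘ (pos x) t)))
    (ℚᵘₚ.≃-trans (*≡* (cong₂ _*ℤ_ (sym (ℤ.pos-* k x)) (cong (λ z → pos (suc z)) (sym (+-identityʳ t)))))
      (ℚᵘₚ.≃-sym (ℚₚ.toℚᵘ-fromℚᵘ (mkℚᵘ (pos (k * x)) t))))))

*-strict : ∀ {D u t} → 0 < t → suc D * u ≤ t → D * u < t
*-strict {D} {zero}  {t} 0<t _ = subst (_< t) (sym (*-zeroʳ D)) 0<t
*-strict {D} {suc u} {t} _   h = ≤-trans (s≤s (m≤n+m (D * suc u) u)) h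

module Estimates {K n A f} (bd : Bounds K n A f) (D : ℕ) (8D<K : 8 * D < K) (big : 16 * D + 3 ≤ n) where
  open Bounds bd
  open ≤-Reasoning

  N t a : ℕ
  N = n C 2
  t = 2 ^ N
  a = count n A

  0<t : 0 < t
  0<t = m^n>0 2 N

  3≤n : 3 ≤ n
  3≤n = ≤-trans (m≤n+m 3 (16 * D)) big

  Na≤2t : N * a ≤ 2 * t
  Na≤2t = halve K (N * a) t (≤-trans (s≤s z≤n) 8D<K) upper

  8Dn≤N : 8 * D * n ≤ N
  8Dn≤N = *-cancelˡ-≤ 2 (+-cancelʳ-≤ n _ _ (begin
    2 * (8 * D * n) + n     ≡⟨ ring D n ⟩
    (16 * D + 1) * n        ≤⟨ *-monoˡ-≤ n (≤-trans (+-monoʳ-≤ (16 * D) (s≤s z≤n)) big) ⟩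
    n * n                   ≡⟨ 2*nC2+n n ⟨
    2 * N + n               ∎))
    where
    ring : ∀ d n → 2 * (8 * d * n) + n ≡ (16 * d + 1) * n
    ring = solve-∀

  2Du<t : 2 * D * missed < t
  2Du<t = *-strict {2 * D} 0<t (≤-trans (*-monoˡ-≤ missed (≤-trans (s≤s (*-monoˡ-≤ D {2} {8} (s≤s (s≤s z≤n)))) 8D<K)) few)

  2D+2≤N : 2 * suc D ≤ N
  2D+2≤N = begin
    2 * suc D        ≡⟨ *-suc 2 D ⟩
    2 + 2 * D        ≤⟨ +-mono-≤ {2} {3} (s≤s (s≤s z≤n)) (*-monoˡ-≤ D {2} {16} (s≤s (s≤s z≤n))) ⟩
    3 + 16 * D       ≡⟨ +-comm 3 (16 * D) ⟩
    16 * D + 3       ≤⟨ big ⟩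
    n                ≤⟨ n≤nC2 n 3≤n ⟩
    N                ∎

  vanishing : D * a < D * (0 * t) + t
  vanishing = subst (λ z → D * a < z + t) (sym (*-zeroʳ D)) (*-strict {D} 0<t (*-cancelˡ-≤ 2 (begin
    2 * (suc D * a)       ≡⟨ *-assoc 2 (suc D) a ⟨
    2 * suc D * a         ≤⟨ *-monoˡ-≤ a 2D+2≤N ⟩
    N * a                 ≤⟨ Na≤2t ⟩
    2 * t                 ∎)))

  vanishing′ : D * (0 * t) < D * a + t
  vanishing′ = subst (λ z → z < D * a + t) (sym (*-zeroʳ D)) (≤-trans 0<t (m≤n+m t (D * a)))

  x : ℕ
  x = count n (λ G → A (f G))

  full : D * x < D * (1 * t) + t
  full = ≤-<-trans (*-monoʳ-≤ D (≤-trans x≤t (≤-reflexive (sym (*-identityˡ t))))) (m<m+n (D * (1 * t)) 0<t)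
    where
    x≤t : x ≤ t
    x≤t = begin
      x                                  ≡⟨ count-∑ n (λ G → A (f G)) ⟩
      ∑ (allGraphs n) _                  ≤⟨ ∑-mono (allGraphs n) (λ G → ⟦⟧≤1 _) ⟩
      ∑ (allGraphs n) (λ _ → 1)          ≡⟨ ∑-allGraphs-1 n ⟩
      t                                  ∎

  full′ : D * (1 * t) < D * x + t
  full′ = begin-strict
    D * (1 * t)              ≡⟨ cong (D *_) (*-identityˡ t) ⟩
    D * t                    ≤⟨ *-monoʳ-≤ D covered ⟩
    D * (x + missed)         ≡⟨ *-distribˡ-+ D x missed ⟩
    D * x + D * missed       <⟨ +-monoʳ-< (D * x) (≤-<-trans (*-monoˡ-≤ missed (m≤n*m D 2)) 2Du<t) ⟩
    D * x + t                ∎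

  -- `n * n` exceeds `2 * N` by `n`. After multiplication by 4 the part `2 * N` contributes an error
  -- of at most `t` because `8 * D < K`, and the part `n` at most `t` because `8 * D * n ≤ N`; the
  -- allowance is `4 * t`.
  rate : D * (n * n * a) < D * (2 * t) + t
  rate = *-cancelˡ-< 4 _ _ (begin-strict
    4 * (D * (n * n * a))                           ≡⟨ cong (λ z → 4 * (D * (z * a))) (2*nC2+n n) ⟨
    4 * (D * ((2 * N + n) * a))                     ≡⟨ ring₁ D N n a ⟩
    8 * (D * (N * a)) + 4 * (D * n * a)             ≤⟨ +-mono-≤ main side ⟩
    8 * (D * t) + t + t                             <⟨ +-monoʳ-< (8 * (D * t) + t) (m<m+n t (*-mono-≤ {1} {2} (s≤s z≤n) 0<t)) ⟩
    8 * (D * t) + t + (t + 2 * t)                   ≡⟨ ring₂ D t ⟩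
    4 * (D * (2 * t) + t)                           ∎)
    where
    ring₁ : ∀ d N n a → 4 * (d * ((2 * N + n) * a)) ≡ 8 * (d * (N * a)) + 4 * (d * n * a)
    ring₁ = solve-∀
    ring₂ : ∀ d t → 8 * (d * t) + t + (t + 2 * t) ≡ 4 * (d * (2 * t) + t)
    ring₂ = solve-∀
    ring₃ : ∀ d n a → 2 * (4 * (d * n * a)) ≡ 8 * d * n * a
    ring₃ = solve-∀
    ring₄ : ∀ k d x → k * (8 * (d * x)) ≡ 8 * d * (k * x)
    ring₄ = solve-∀
    ring₅ : ∀ k d t → 8 * d * (suc k * t) ≡ k * (8 * (d * t)) + 8 * d * t
    ring₅ = solve-∀
    side : 4 * (D * n * a) ≤ t
    side = *-cancelˡ-≤ 2 (begin
      2 * (4 * (D * n * a))      ≡⟨ ring₃ D n a ⟩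
      8 * D * n * a              ≤⟨ *-monoˡ-≤ a 8Dn≤N ⟩
      N * a                      ≤⟨ Na≤2t ⟩
      2 * t                      ∎)
    main : 8 * (D * (N * a)) ≤ 8 * (D * t) + t
    main = *-cancelˡ-≤ K {{>-nonZero (≤-trans (s≤s z≤n) 8D<K)}} (begin
      K * (8 * (D * (N * a)))            ≡⟨ ring₄ K D (N * a) ⟩
      8 * D * (K * (N * a))              ≤⟨ *-monoʳ-≤ (8 * D) upper ⟩
      8 * D * (suc K * t)                ≡⟨ ring₅ K D t ⟩
      K * (8 * (D * t)) + 8 * D * t      ≤⟨ +-monoʳ-≤ (K * (8 * (D * t))) (*-monoˡ-≤ t (<⇒≤ 8D<K)) ⟩
      K * (8 * (D * t)) + K * t          ≡⟨ *-distribˡ-+ K (8 * (D * t)) t ⟨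
      K * (8 * (D * t) + t)              ∎)

  rate′ : D * (2 * t) < D * (n * n * a) + t
  rate′ = begin-strict
    D * (2 * t)                              ≤⟨ *-monoʳ-≤ D (*-monoʳ-≤ 2 lower) ⟩
    D * (2 * (N * a + missed))               ≡⟨ ring D N a missed ⟩
    D * (2 * N * a) + 2 * D * missed         ≤⟨ +-monoˡ-≤ (2 * D * missed) (*-monoʳ-≤ D (*-monoˡ-≤ a (≤-trans (m≤m+n (2 * N) n) (≤-reflexive (2*nC2+n n))))) ⟩
    D * (n * n * a) + 2 * D * missed         <⟨ +-monoʳ-< (D * (n * n * a)) 2Du<t ⟩
    D * (n * n * a) + t                      ∎
    where
    ring : ∀ d N a u → d * (2 * (N * a + u)) ≡ d * (2 * N * a) + 2 * d * u
    ring = solve-∀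

-- The search for a precision starts at `n`, so every fixed precision eventually comes within its
-- range.
A∞ : Property
A∞ n = Choice.A (choose n n)

f∞ : Adversary
f∞ n = Choice.f (choose n n)

limit : ∀ (x : ℕ → ℕ) c (a : ℕ → ℚ) →
  (∀ n → a n ≡ _/_ (pos (x n)) (2 ^ (n C 2)) {{m^n≢0 2 (n C 2)}}) →
  (∀ {K n} → Bounds K n (A∞ n) (f∞ n) → ∀ D → 8 * D < K → 16 * D + 3 ≤ n →
     D * x n < D * (c * 2 ^ (n C 2)) + 2 ^ (n C 2) × D * (c * 2 ^ (n C 2)) < D * x n + 2 ^ (n C 2)) →
  Tendsto a (pos c / 1)
limit x c a a≡ est ε 0<ε = N₁ , close
  where
  D k N₁ : ℕ
  D = ℚ.denominatorℕ ε
  k = 8 * D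
  N₁ = (k ⊔ threshold k) ⊔ (16 * D + 3)
  close : ∀ n → N₁ ≤ n → ∣ a n -ℚ (pos c / 1) ∣ℚ <ℚ ε
  close n N₁≤n = subst (λ z → ∣ z -ℚ (pos c / 1) ∣ℚ <ℚ ε) (sym (a≡ n))
    (finish (Choice.bounds (choose n n) k
      (≤-trans (≤-trans (m≤m⊔n k (threshold k)) (m≤m⊔n _ (16 * D + 3))) N₁≤n)
      (≤-trans (≤-trans (m≤n⊔m k (threshold k)) (m≤m⊔n _ (16 * D + 3))) N₁≤n)))
    where
    finish : (∃[ K ] (k < K × Bounds K n (A∞ n) (f∞ n))) →
      ∣ _/_ (pos (x n)) (2 ^ (n C 2)) {{m^n≢0 2 (n C 2)}} -ℚ (pos c / 1) ∣ℚ <ℚ ε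
    finish (K , k<K , bd) = near (x n) (2 ^ (n C 2)) {{m^n≢0 2 (n C 2)}} c ε 0<ε (proj₁ e) (proj₂ e)
      where
      e = est bd D k<K (≤-trans (m≤n⊔m (k ⊔ threshold k) (16 * D + 3)) N₁≤n)

open import Data.Integer using (+_)

theorem1 : ∃[ A ] (IsomorphismInvariant A × AntiStochastic A ×
    Tendsto (λ n → ((+ (n * n)) / 1) *ℚ Pr n (A n)) (+ 2 / 1))
theorem1 = A∞ , (λ n → Choice.invariant (choose n n)) ,
  ( limit (λ n → count n (A∞ n)) 0 _ (λ _ → refl)
      (λ bd D h h′ → Estimates.vanishing bd D h h′ , Estimates.vanishing′ bd D h h′)
  , f∞ , (λ n → Choice.adversary (choose n n))
  , limit (λ n → count n (λ G → A∞ n (f∞ n G))) 1 _ (λ _ → refl)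
      (λ bd D h h′ → Estimates.full bd D h h′ , Estimates.full′ bd D h h′)) ,
  limit (λ n → n * n * count n (A∞ n)) 2 _ (λ n → *-/ (n * n) (count n (A∞ n)) (2 ^ (n C 2)) {{m^n≢0 2 (n C 2)}})
    (λ bd D h h′ → Estimates.rate bd D h h′ , Estimates.rate′ bd D h h′)
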